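{- Let $m,n,s,k,c$ be positive integers such that $2\leq s\leq n$, $2\leq k\leq m$ and $ms=nk$, and set $d=\gcd(s,k)$. (1) A $\mathrm{M}^0\mathrm{S}_{\mathbb{Z}_{nkc}}(m,n;s,k;c)$ exists if and only if $nkc$ is odd. (2) If $d\equiv 0\pmod 4$, then there exists a $\mathrm{M}^0\mathrm{S}_{\Gamma}(m,n;s,k;c)$ for every abelian group $\Gamma\in\mathcal{G}$ of order $nkc$. (3) If $nk$ is odd and $\gcd(n,d-1)=1$, then there exists a $\mathrm{M}^0_{\mathbb{Z}_d\oplus\mathbb{Z}_{nk/d}}(m,n;s,k)$. (4) A $\mathrm{M}^0\mathrm{S}_{\mathbb{Z}_{2nc+1}^*}(2,n;n,2;c)$ exists if and only if $n\geq 3$. (5) A $\mathrm{M}^0_{\mathbb{Z}_{mn+1}^*}(m,n;n,m)$ exists if and only if $mn$ is even and $mn>5$. (6) Let $\Gamma$ be an abelian group of order $2n+1$. There exists a $\mathrm{M}^0_{\Gamma^*}(2,n;n,2)$ if and only if $\Gamma\notin\{\mathbb{Z}_5,\mathbb{Z}_3\oplus\mathbb{Z}_3\}$.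
   Context: A partially filled array of size $m\times n$ is an $m\times n$ array in which some cells may be empty. Given a subset $\Omega$ of an abelian group $(\Gamma,+)$, a zero-sum magic partially filled array set $\mathrm{M}^0\mathrm{S}_\Omega(m,n;s,k;c)$ is a set of $c$ partially filled $m\times n$ arrays with entries in $\Omega$ such that every element of $\Omega$ appears exactly once, in exactly one of the arrays; in every array each row has exactly $s$ filled cells and each column has exactly $k$ filled cells; and in every array the entries of each row and of each column sum to $0\in\Gamma$. A zero-sum magic partially filled array $\mathrm{M}^0_\Omega(m,n;s,k)$ is such a set with $c=1$ (i.e. a single array). For an abelian group $\Gamma$, $\Gamma^*=\Gamma\setminus\{0_\Gamma\}$; $\mathbb{Z}_r$ is the cyclic group of order $r$. $\mathcal{G}$ denotes the set of all finite abelian groups that either have odd order or contain more than one element of order $2$. -}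

module Defs where

open import Level using (Level; _⊔_; 0ℓ)
open import Data.Nat as ℕ using (ℕ; zero; suc)
open import Data.Nat.Divisibility as ℕD using ()
open import Data.Integer as ℤ using (ℤ; +_; _+_; _-_; -_)
open import Data.Integer.Properties as ℤP using ()
open import Data.Integer.Divisibility.Signed as Div using (∣-refl)
open import Data.Integer.Solver using (module +-*-Solver)
open import Data.Fin using (Fin; zero; suc)
open import Data.Maybe using (Maybe; just; nothing)
open import Data.Sum using (_⊎_)
open import Data.Product using (Σ; ∃; ∃-syntax; _×_; _,_)
open import Data.Unit using (⊤)
open import Relation.Nullary using (¬_)
open import Relation.Binary.PropositionalEquality using (_≡_; refl; sym; cong)
open import Algebra.Bundles using (AbelianGroup)
open import Algebra.Morphism.Structures using (module GroupMorphisms)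
import Algebra.Construct.DirectProduct as DP

_≡[mod_]_ : ℤ → ℕ → ℤ → Set
x ≡[mod r ] y = (+ r) Div.∣ (x - y)

private
  open +-*-Solver

  lem-sym : ∀ x y → y - x ≡ - (x - y)
  lem-sym = solve 2 (λ x y → y :- x := :- (x :- y)) refl

  lem-trans : ∀ x y z → x - z ≡ (x - y) + (y - z)
  lem-trans = solve 3 (λ x y z → x :- z := (x :- y) :+ (y :- z)) refl

  lem-cong : ∀ x y u v → (x + u) - (y + v) ≡ (x - y) + (u - v)
  lem-cong = solve 4 (λ x y u v → (x :+ u) :- (y :+ v) := (x :- y) :+ (u :- v)) refl

  lem-neg : ∀ x y → (- x) - (- y) ≡ - (x - y)
  lem-neg = solve 2 (λ x y → (:- x) :- (:- y) := :- (x :- y)) refl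

  lem-zero : ∀ x r → x - x ≡ ℤ.0ℤ ℤ.* r
  lem-zero = solve 2 (λ x r → x :- x := con ℤ.0ℤ :* r) refl

  lem-rew : ∀ {a b k} → a ≡ b → k Div.∣ a → k Div.∣ b
  lem-rew refl p = p

  ≡⇒≈ : ∀ r {x y} → x ≡ y → x ≡[mod r ] y
  ≡⇒≈ r {x} refl = Div.divides ℤ.0ℤ (lem-zero x (+ r))

  ≈-sym : ∀ r {x y} → x ≡[mod r ] y → y ≡[mod r ] x
  ≈-sym r {x} {y} p = lem-rew (sym (lem-sym x y)) (Div.∣m⇒∣-m p)

  ≈-trans : ∀ r {x y z} → x ≡[mod r ] y → y ≡[mod r ] z → x ≡[mod r ] z
  ≈-trans r {x} {y} {z} p q = lem-rew (sym (lem-trans x y z)) (Div.∣m∣n⇒∣m+n p q)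

  +-cong : ∀ r {x y u v} → x ≡[mod r ] y → u ≡[mod r ] v → (x + u) ≡[mod r ] (y + v)
  +-cong r {x} {y} {u} {v} p q = lem-rew (sym (lem-cong x y u v)) (Div.∣m∣n⇒∣m+n p q)

  neg-cong : ∀ r {x y} → x ≡[mod r ] y → (- x) ≡[mod r ] (- y)
  neg-cong r {x} {y} p = lem-rew (sym (lem-neg x y)) (Div.∣m⇒∣-m p)

-- ℤ_r : the cyclic group of order r (for r ≥ 1), as an abelian group
-- on ℤ whose equality is congruence modulo r.
ℤ/ : ℕ → AbelianGroup 0ℓ 0ℓ
ℤ/ r = record
  { Carrier = ℤ
  ; _≈_ = λ x y → x ≡[mod r ] y
  ; _∙_ = _+_
  ; ε = ℤ.0ℤ
  ; _⁻¹ = -_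
  ; isAbelianGroup = record
    { isGroup = record
      { isMonoid = record
        { isSemigroup = record
          { isMagma = record
            { isEquivalence = record
              { refl = λ {x} → ≡⇒≈ r {x} refl
              ; sym = λ {x} {y} → ≈-sym r {x} {y}
              ; trans = λ {x} {y} {z} → ≈-trans r {x} {y} {z} }
            ; ∙-cong = λ {x} {y} {u} {v} → +-cong r {x} {y} {u} {v}
            }
          ; assoc = λ x y z → ≡⇒≈ r (ℤP.+-assoc x y z)
          }
        ; identity = (λ x → ≡⇒≈ r (ℤP.+-identityˡ x)) , (λ x → ≡⇒≈ r (ℤP.+-identityʳ x))
        }
      ; inverse = (λ x → ≡⇒≈ r (ℤP.+-inverseˡ x)) , (λ x → ≡⇒≈ r (ℤP.+-inverseʳ x))
      ; ⁻¹-cong = λ {x} {y} → neg-cong r {x} {y}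
      }
    ; comm = λ x y → ≡⇒≈ r (ℤP.+-comm x y)
    }
  }

_⊕_ : ∀ {a ℓ₁ b ℓ₂} → AbelianGroup a ℓ₁ → AbelianGroup b ℓ₂ → AbelianGroup (a ⊔ b) (ℓ₁ ⊔ ℓ₂)
G ⊕ H = DP.abelianGroup G H

module _ {a ℓ} (G : AbelianGroup a ℓ) where
  open AbelianGroup G

  HasOrder : ℕ → Set (a ⊔ ℓ)
  HasOrder N = Σ (Fin N → Carrier) λ f →
    (∀ i j → f i ≈ f j → i ≡ j) × (∀ x → ∃[ i ] (f i ≈ x))

  OfOrder2 : Carrier → Set ℓ
  OfOrder2 x = (¬ (x ≈ ε)) × ((x ∙ x) ≈ ε)

  -- G ∈ 𝒢 (given that G is finite of order N): N is odd, or G has more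
  -- than one element of order 2.
  In𝒢 : ℕ → Set (a ⊔ ℓ)
  In𝒢 N = (¬ (2 ℕD.∣ N)) ⊎ (∃[ x ] ∃[ y ] (OfOrder2 x × OfOrder2 y × ¬ (x ≈ y)))

  Whole : Carrier → Set
  Whole _ = ⊤

  Nonzero : Carrier → Set ℓ
  Nonzero x = ¬ (x ≈ ε)

  filled : ∀ {n} → (Fin n → Maybe Carrier) → ℕ
  filled {zero} f = 0
  filled {suc n} f with f zero
  ... | just _  = suc (filled (λ j → f (suc j)))
  ... | nothing = filled (λ j → f (suc j))

  lineSum : ∀ {n} → (Fin n → Maybe Carrier) → Carrier
  lineSum {zero} f = ε
  lineSum {suc n} f with f zero
  ... | just x  = x ∙ lineSum (λ j → f (suc j))
  ... | nothing = lineSum (λ j → f (suc j))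

  Contains : ∀ {c m n} → (Fin c → Fin m → Fin n → Maybe Carrier) →
             Fin c × Fin m × Fin n → Carrier → Set (a ⊔ ℓ)
  Contains A (t , i , j) x = ∃[ y ] (A t i j ≡ just y × y ≈ x)

  record M⁰S {p} (Ω : Carrier → Set p) (m n s k c : ℕ) : Set (a ⊔ ℓ ⊔ p) where
    field
      arrays   : Fin c → Fin m → Fin n → Maybe Carrier
      entries∈Ω : ∀ t i j x → arrays t i j ≡ just x → Ω x
      appears  : ∀ x → Ω x → ∃[ pos ] Contains arrays pos x
      once     : ∀ x pos pos′ → Contains arrays pos x → Contains arrays pos′ x → pos ≡ pos′
      rowFilled : ∀ t i → filled (arrays t i) ≡ s
      colFilled : ∀ t j → filled (λ i → arrays t i j) ≡ k
      rowSum : ∀ t i → lineSum (arrays t i) ≈ ε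
      colSum : ∀ t j → lineSum (λ i → arrays t i j) ≈ ε

  M⁰ : ∀ {p} (Ω : Carrier → Set p) (m n s k : ℕ) → Set (a ⊔ ℓ ⊔ p)
  M⁰ Ω m n s k = M⁰S Ω m n s k 1

_≅_ : ∀ {a ℓ₁ b ℓ₂} → AbelianGroup a ℓ₁ → AbelianGroup b ℓ₂ → Set (a ⊔ b ⊔ ℓ₁ ⊔ ℓ₂)
G ≅ H = Σ (AbelianGroup.Carrier G → AbelianGroup.Carrier H)
          (GroupMorphisms.IsGroupIsomorphism (AbelianGroup.rawGroup G) (AbelianGroup.rawGroup H))

{-# OPTIONS --safe #-}
module Submission where

-- With d = gcd s k, s = s′ d and k = k′ d, the hypotheses give m = l k′, n = l s′
-- and d ≤ l, so an array is an l × l array of k′ × s′ blocks of which d consecutive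
-- cyclic diagonals are filled. For d odd and d > 1 the entry on the e-th diagonal is
-- e + d wₑ W, where W numbers the positions within a diagonal and the weights
-- wₑ ∈ {±1, ±2} satisfy Σ wₑ = Σ e wₑ = 0, so that both lines sum to zero (parts (1)
-- and (3)); for d = 1 the filled blocks are k′ × s′ rectangles with k′ and s′ coprime.
-- If 4 ∣ d, the group is partitioned into X, a - X, b - X and X - a - b, and these are
-- spread over groups of four diagonals (part (2)).
--
-- A 2 × n array has columns (x , -x), so parts (4)–(6) are about half-sets of G*, one
-- element from each pair ±x. In (4) the numbers 1, …, nc have to be split into c signed
-- n-sets of sum zero: Skolem sequences do this for n = 3 (and, modified, for n = 5 and
-- n = 6), and runs of four consecutive numbers raise n by four. Part (5) stacks these
-- arrays. In (6) one flips the signs of at most three elements of a half-set; if that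
-- never makes its sum vanish, the half-set is so rigid that G is ℤ₅ or ℤ₃ ⊕ ℤ₃.

open import Defs
open import Level using (Level; _⊔_)
open import Data.Bool as Bool using (Bool; true; false; not; if_then_else_)
open import Data.Empty using (⊥; ⊥-elim)
open import Data.Fin as Fin using
  (Fin; zero; suc; toℕ; fromℕ; fromℕ<; combine; remQuot; inject₁; punchIn; punchOut; splitAt; join; cast; _↑ˡ_; _↑ʳ_)
open import Data.Fin.Patterns using (0F; 1F; 2F; 3F; 4F; 5F)
import Data.Fin.Properties as Finₚ
open import Data.Integer as ℤ using (ℤ; +_; -_; -[1+_]; 0ℤ; ∣_∣; _⊖_)
import Data.Integer.DivMod as ℤDivMod
import Data.Integer.Divisibility.Signed as ℤ∣
import Data.Integer.Properties as ℤₚ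
import Data.Integer.Tactic.RingSolver as ℤRing
open import Data.List as List using (List; []; _∷_; length; _++_)
import Data.List.Properties as Listₚ
open import Data.List.Relation.Unary.All using (All; []; _∷_)
import Data.List.Relation.Unary.All.Properties as Allₚ
open import Data.Maybe using (Maybe; just; nothing; maybe)
open import Data.Maybe.Properties using (just-injective)
open import Data.Nat as ℕ using (ℕ; zero; suc; _+_; _*_; _∸_; _≤_; _<_; z≤n; s≤s; NonZero)
import Data.Nat.Coprimality as Coprimality
open Coprimality using (Coprime)
open import Data.Nat.DivMod as DivMod using (_%_; _/_)
open import Data.Nat.Divisibility as ℕ∣ using (_∣_)
open import Data.Nat.GCD as GCD using (gcd)
open import Data.Nat.Primality using (euclidsLemma; prime[2])
import Data.Nat.Properties as ℕₚ
open import Data.Nat.Tactic.RingSolver using (solve-∀)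
open import Data.Product using (Σ; ∃; ∃-syntax; _×_; _,_; proj₁; proj₂; uncurry)
open import Data.Sum using (_⊎_; inj₁; inj₂; [_,_]′)
open import Data.Unit using (tt)
open import Data.Vec as Vec using (Vec; []; _∷_)
open import Function using (_∘_; id; const)
open import Function.Bundles using (_⇔_; mk⇔)
open import Relation.Binary using (tri<; tri≈; tri>)
open import Relation.Binary.PropositionalEquality as ≡ using (_≡_; _≢_; cong; cong₂; subst)
import Relation.Binary.Reasoning.Setoid as SetoidReasoning
open import Relation.Nullary using (¬_; Dec; yes; no; does)
open import Relation.Nullary.Decidable using
  (_×-dec_; ¬?; decidable-stable; does-⇔; dec-true; dec-false; True; toWitness; map′)
open import Algebra.Bundles using (AbelianGroup; CommutativeMonoid)
import Algebra.Morphism.Structures as Morphisms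
import Algebra.Properties.Semiring.Sum ℤₚ.+-*-semiring as ℤSum
import Algebra.Solver.CommutativeMonoid.Normal as CommutativeMonoidNormal

-- Finite sums and the lines of an array

-- A column in block j meets the e-th diagonal in block row j - e, so W is affine in e along a
-- column: hence the condition Σ e wₑ = 0. The weights must also cancel modulo the odd number of
-- values of W, which ±1 and ±2 do. A single diagonal leaves no room for such weights, so for d = 1
-- the zero sums have to arise inside one block, where rows and columns compete for the same entry;
-- the residue modulo k′ is therefore made to determine the weight used modulo s′. Skolem sequences
-- exist only for orders 0 and 1 modulo 4. The other orders have hooked sequences, which put N + 1
-- in the place of N in 1, ..., N; as N + 1 is -N modulo 2N + 1, nothing is lost in the group. In
-- (6), flipping members of a half-set lowers its total by twice their sum, so a set of members
-- summing to half the total is sought. If no set of at most three members does, and t denotes minus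
-- that half, the half-set is closed under adding t up to one exception, and the cosets of the
-- subgroup generated by t decide the rest.

module MonoidSums {a ℓ} (M : CommutativeMonoid a ℓ) where
  open CommutativeMonoid M
  open import Algebra.Properties.CommutativeMonoid.Sum M public
    using (sum; sum-remove; ∑-comm; ∑-distrib-+; sum-cong-≋; sum-replicate-zero; sum-init-last)

  sum-cong : ∀ {n} {F H : Fin n → Carrier} → (∀ i → F i ≈ H i) → sum F ≈ sum H
  sum-cong eq = sum-cong-≋ eq

  sum-ε : ∀ {n} {F : Fin n → Carrier} → (∀ i → F i ≈ ε) → sum F ≈ ε
  sum-ε {n} eq = trans (sum-cong eq) (sum-replicate-zero n)

  sum-single : ∀ {n} (F : Fin n → Carrier) (i : Fin n) → (∀ j → j ≢ i → F j ≈ ε) → sum F ≈ F i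
  sum-single {suc n} F i off = trans (sum-remove {i = i} F)
    (trans (∙-congˡ (sum-ε λ j → off (punchIn i j) (Finₚ.punchInᵢ≢i i j))) (identityʳ (F i)))

  -- Induction on the number of values: the term at `g zero` is split off and the other values of
  -- `g` are renumbered by `punchOut`. Fill counts, line sums, totals and changes of index all go
  -- through this.
  sum-embed : ∀ {s n} (g : Fin s → Fin n) → (∀ x y → g x ≡ g y → x ≡ y) →
              {F : Fin n → Carrier} {H : Fin s → Carrier} →
              (∀ x → F (g x) ≈ H x) → (∀ j → (∀ x → g x ≢ j) → F j ≈ ε) → sum F ≈ sum H
  sum-embed {zero} g inj on off = sum-ε λ j → off j (λ ())
  sum-embed {suc s} {zero} g inj on off with () ← g zero
  sum-embed {suc s} {suc n} g inj {F} {H} on off = trans (sum-remove {i = g zero} F)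
    (∙-cong (on zero) (sum-embed g′ g′-inj on′ off′))
    where
    apart : ∀ x → g zero ≢ g (suc x)
    apart x eq with () ← inj zero (suc x) eq
    g′ : Fin s → Fin n
    g′ x = punchOut (apart x)
    g′-inj : ∀ x y → g′ x ≡ g′ y → x ≡ y
    g′-inj x y eq = Finₚ.suc-injective
      (inj (suc x) (suc y) (Finₚ.punchOut-injective (apart x) (apart y) eq))
    on′ : ∀ x → F (punchIn (g zero) (g′ x)) ≈ H (suc x)
    on′ x = trans (reflexive (cong F (Finₚ.punchIn-punchOut (apart x)))) (on (suc x))
    off′ : ∀ j → (∀ x → g′ x ≢ j) → F (punchIn (g zero) j) ≈ ε
    off′ j miss = off (punchIn (g zero) j) λ where
      zero eq → Finₚ.punchInᵢ≢i (g zero) j (≡.sym eq)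
      (suc x) eq → miss x (Finₚ.punchIn-injective (g zero) _ _
        (≡.trans (Finₚ.punchIn-punchOut (apart x)) eq))

  sum-++ : ∀ m {n} (F : Fin (m + n) → Carrier) →
           sum F ≈ sum (λ i → F (i ↑ˡ n)) ∙ sum (λ j → F (m ↑ʳ j))
  sum-++ zero F = sym (identityˡ _)
  sum-++ (suc m) F = trans (∙-congˡ (sum-++ m (F ∘ suc))) (sym (assoc _ _ _))

  sum-combine : ∀ m {n} (F : Fin (m * n) → Carrier) →
                sum F ≈ sum (λ i → sum (λ j → F (combine {m} {n} i j)))
  sum-combine zero F = refl
  sum-combine (suc m) {n} F = trans (sum-++ n F) (∙-congˡ (sum-combine m (λ j → F (n ↑ʳ j))))

-- A missed value could be punched out of the codomain, leaving an injection into a smaller set.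
injective⇒surjective : ∀ {n} (g : Fin n → Fin n) → (∀ x y → g x ≡ g y → x ≡ y) → ∀ y → ∃[ x ] g x ≡ y
injective⇒surjective {suc n} g inj y with Finₚ.any? (λ x → g x Fin.≟ y)
... | yes hit = hit
... | no miss = ⊥-elim (ℕₚ.1+n≰n (Finₚ.injective⇒≤ {f = λ x → punchOut (apart x)}
        (λ {x} {z} eq → inj x z (Finₚ.punchOut-injective (apart x) (apart z) eq))))
  where
  apart : ∀ x → y ≢ g x
  apart x eq = miss (x , ≡.sym eq)

module Lines {a ℓ} (G : AbelianGroup a ℓ) where
  open AbelianGroup G
  open MonoidSums commutativeMonoid public
  private module ℕΣ = MonoidSums ℕₚ.+-0-commutativeMonoid

  lineSum≈sum : ∀ {n} (f : Fin n → Maybe Carrier) → lineSum G f ≈ sum (λ j → maybe id ε (f j))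
  lineSum≈sum {zero} f = refl
  lineSum≈sum {suc n} f with f zero
  ... | just x  = ∙-congˡ (lineSum≈sum (f ∘ suc))
  ... | nothing = trans (lineSum≈sum (f ∘ suc)) (sym (identityˡ _))

  filled≡sum : ∀ {n} (f : Fin n → Maybe Carrier) → filled G f ≡ ℕΣ.sum (λ j → maybe (const 1) 0 (f j))
  filled≡sum {zero} f = ≡.refl
  filled≡sum {suc n} f with f zero
  ... | just x  = cong suc (filled≡sum (f ∘ suc))
  ... | nothing = filled≡sum (f ∘ suc)

  count-all : ∀ s → ℕΣ.sum {s} (const 1) ≡ s
  count-all zero    = ≡.refl
  count-all (suc s) = cong suc (count-all s)

  module _ {n s} (f : Fin n → Maybe Carrier) (g : Fin s → Fin n) (H : Fin s → Carrier)
           (inj : ∀ x y → g x ≡ g y → x ≡ y) (on : ∀ x → f (g x) ≡ just (H x))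
           (off : ∀ j → (∀ x → g x ≢ j) → f j ≡ nothing) where

    filled-enum : filled G f ≡ s
    filled-enum = ≡.trans (filled≡sum f) (≡.trans
      (ℕΣ.sum-embed g inj {H = const 1} (λ x → cong (maybe (const 1) 0) (on x))
        (λ j miss → cong (maybe (const 1) 0) (off j miss)))
      (count-all s))

    lineSum-enum : lineSum G f ≈ sum H
    lineSum-enum = trans (lineSum≈sum f)
      (sum-embed g inj (λ x → reflexive (cong (maybe id ε) (on x)))
        (λ j miss → reflexive (cong (maybe id ε) (off j miss))))

module FiniteGroup {a ℓ} (G : AbelianGroup a ℓ) {N : ℕ} (order : HasOrder G N) where
  open AbelianGroup G

  elem : Fin N → Carrier
  elem = proj₁ order

  elem-injective : ∀ i j → elem i ≈ elem j → i ≡ j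
  elem-injective = proj₁ (proj₂ order)

  index : Carrier → Fin N
  index x = proj₁ (proj₂ (proj₂ order) x)

  elem-index : ∀ x → elem (index x) ≈ x
  elem-index x = proj₂ (proj₂ (proj₂ order) x)

  index-cong : ∀ {x y} → x ≈ y → index x ≡ index y
  index-cong {x} {y} eq = elem-injective _ _ (trans (elem-index x) (trans eq (sym (elem-index y))))

  index-injective : ∀ {x y} → index x ≡ index y → x ≈ y
  index-injective {x} {y} eq = trans (sym (elem-index x)) (trans (reflexive (cong elem eq)) (elem-index y))

  index-elem : ∀ i → index (elem i) ≡ i
  index-elem i = elem-injective _ _ (elem-index (elem i))

  infix 4 _≈?_
  _≈?_ : ∀ x y → Dec (x ≈ y)
  x ≈? y = map′ index-injective index-cong (index x Fin.≟ index y)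

  exists? : ∀ {p} {P : Carrier → Set p} → (∀ x → Dec (P x)) → (∀ {x y} → x ≈ y → P x → P y) → Dec (∃ P)
  exists? P? resp with Finₚ.any? (P? ∘ elem)
  ... | yes (i , p) = yes (elem i , p)
  ... | no none     = no λ (x , p) → none (index x , resp (sym (elem-index x)) p)

  injective⇒exhaustive : (g : Fin N → Carrier) → (∀ i j → g i ≈ g j → i ≡ j) → ∀ x → ∃[ i ] g i ≈ x
  injective⇒exhaustive g inj x
    with i , eq ← injective⇒surjective (index ∘ g) (λ i j eq → inj i j (index-injective eq)) (index x)
    = i , index-injective eq

  bijection⇒size≡ : ∀ {M} (g : Fin M → Carrier) → (∀ i j → g i ≈ g j → i ≡ j) → (∀ x → ∃[ i ] g i ≈ x) → M ≡ N
  bijection⇒size≡ g inj surj = ℕₚ.≤-antisym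
    (Finₚ.injective⇒≤ {f = index ∘ g} λ {i} {j} eq → inj i j (index-injective eq))
    (Finₚ.injective⇒≤ {f = proj₁ ∘ surj ∘ elem} λ {i} {j} eq → elem-injective i j
      (trans (sym (proj₂ (surj (elem i)))) (trans (reflexive (cong g eq)) (proj₂ (surj (elem j))))))

-- Cyclic diagonals

%-absorbˡ : ∀ x y l .{{_ : NonZero l}} → (x % l + y) % l ≡ (x + y) % l
%-absorbˡ x y l = ≡.trans (DivMod.%-distribˡ-+ (x % l) y l)
  (≡.trans (cong (λ z → (z + y % l) % l) (DivMod.m%n%n≡m%n x l)) (≡.sym (DivMod.%-distribˡ-+ x y l)))

infixl 6 _⊞_ _⊟_

_⊞_ : ∀ {l} → Fin l → ℕ → Fin l
_⊞_ {suc l} i x = fromℕ< (DivMod.m%n<n (toℕ i + x) (suc l))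

_⊟_ : ∀ {l} → Fin l → ℕ → Fin l
_⊟_ {l} i x = i ⊞ (l ∸ x)

toℕ-⊞ : ∀ {l} (i : Fin (suc l)) x → toℕ (i ⊞ x) ≡ (toℕ i + x) % suc l
toℕ-⊞ {l} i x = Finₚ.toℕ-fromℕ< (DivMod.m%n<n (toℕ i + x) (suc l))

⊞-⊞ : ∀ {l} (i : Fin l) x y → i ⊞ x ⊞ y ≡ i ⊞ (x + y)
⊞-⊞ {suc l} i x y = Finₚ.toℕ-injective (begin
  toℕ (i ⊞ x ⊞ y)                    ≡⟨ toℕ-⊞ (i ⊞ x) y ⟩
  (toℕ (i ⊞ x) + y) % suc l          ≡⟨ cong (λ z → (z + y) % suc l) (toℕ-⊞ i x) ⟩
  ((toℕ i + x) % suc l + y) % suc l  ≡⟨ %-absorbˡ (toℕ i + x) y (suc l) ⟩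
  (toℕ i + x + y) % suc l            ≡⟨ cong (_% suc l) (ℕₚ.+-assoc (toℕ i) x y) ⟩
  (toℕ i + (x + y)) % suc l          ≡⟨ toℕ-⊞ i (x + y) ⟨
  toℕ (i ⊞ (x + y))                  ∎)
  where open ≡.≡-Reasoning

⊞-period : ∀ {l} (i : Fin l) → i ⊞ l ≡ i
⊞-period {suc l} i = Finₚ.toℕ-injective (≡.trans (toℕ-⊞ i (suc l))
  (≡.trans (DivMod.[m+n]%n≡m%n (toℕ i) (suc l)) (DivMod.m<n⇒m%n≡m (Finₚ.toℕ<n i))))

⊟-⊞ : ∀ {l} (j : Fin l) {x} → x ≤ l → j ⊟ x ⊞ x ≡ j
⊟-⊞ {l} j {x} x≤l = ≡.trans (⊞-⊞ j (l ∸ x) x) (≡.trans (cong (j ⊞_) (ℕₚ.m∸n+n≡m x≤l)) (⊞-period j))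

offset : ∀ {l} → Fin l → Fin l → ℕ
offset i j = toℕ (j ⊟ toℕ i)

offset-⊞ : ∀ {l} (i : Fin l) {x} → x < l → offset i (i ⊞ x) ≡ x
offset-⊞ {suc l} i {x} x<l = begin
  toℕ (i ⊞ x ⊞ (suc l ∸ toℕ i))           ≡⟨ cong toℕ (⊞-⊞ i x _) ⟩
  toℕ (i ⊞ (x + (suc l ∸ toℕ i)))         ≡⟨ toℕ-⊞ i _ ⟩
  (toℕ i + (x + (suc l ∸ toℕ i))) % suc l ≡⟨ cong (_% suc l) (arith (ℕₚ.<⇒≤ (Finₚ.toℕ<n i))) ⟩
  (x + suc l) % suc l                     ≡⟨ DivMod.[m+n]%n≡m%n x (suc l) ⟩
  x % suc l                               ≡⟨ DivMod.m<n⇒m%n≡m x<l ⟩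
  x                                       ∎
  where
  open ≡.≡-Reasoning
  arith : ∀ {p} → p ≤ suc l → p + (x + (suc l ∸ p)) ≡ x + suc l
  arith {p} p≤ = ≡.trans (ℕₚ.+-comm p _) (≡.trans (ℕₚ.+-assoc x _ p) (cong (λ z → x + z) (ℕₚ.m∸n+n≡m p≤)))

⊞-offset : ∀ {l} (i j : Fin l) → i ⊞ offset i j ≡ j
⊞-offset {suc l} i j = Finₚ.toℕ-injective (begin
  toℕ (i ⊞ offset i j)                                   ≡⟨ toℕ-⊞ i _ ⟩
  (toℕ i + offset i j) % suc l                           ≡⟨ cong (λ z → (toℕ i + z) % suc l) (toℕ-⊞ j _) ⟩
  (toℕ i + (toℕ j + (suc l ∸ toℕ i)) % suc l) % suc l    ≡⟨ cong (_% suc l) (ℕₚ.+-comm (toℕ i) _) ⟩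
  ((toℕ j + (suc l ∸ toℕ i)) % suc l + toℕ i) % suc l    ≡⟨ %-absorbˡ (toℕ j + (suc l ∸ toℕ i)) (toℕ i)
      (suc l) ⟩
  (toℕ j + (suc l ∸ toℕ i) + toℕ i) % suc l              ≡⟨ cong (_% suc l) (ℕₚ.+-assoc (toℕ j) _ (toℕ i)) ⟩
  (toℕ j + (suc l ∸ toℕ i + toℕ i)) % suc l              ≡⟨ cong (λ z → (toℕ j + z) % suc l)
      (ℕₚ.m∸n+n≡m (ℕₚ.<⇒≤ (Finₚ.toℕ<n i))) ⟩
  (toℕ j + suc l) % suc l                                ≡⟨ toℕ-⊞ j (suc l) ⟨
  toℕ (j ⊞ suc l)                                        ≡⟨ cong toℕ (⊞-period j) ⟩
  toℕ j                                                  ∎)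
  where open ≡.≡-Reasoning

⊞-injective : ∀ {l} (i : Fin l) {x y} → x < l → y < l → i ⊞ x ≡ i ⊞ y → x ≡ y
⊞-injective i x<l y<l eq = ≡.trans (≡.sym (offset-⊞ i x<l)) (≡.trans (cong (offset i) eq) (offset-⊞ i y<l))

offset-⊟ : ∀ {l} (j : Fin l) {x} → x < l → offset (j ⊟ x) j ≡ x
offset-⊟ j {x} x<l = ≡.trans (cong (offset (j ⊟ x)) (≡.sym (⊟-⊞ j (ℕₚ.<⇒≤ x<l)))) (offset-⊞ (j ⊟ x) x<l)

combine-injective′ : ∀ {m n} {x y : Fin (m * n)} → remQuot {m} n x ≡ remQuot {m} n y → x ≡ y
combine-injective′ {m} {n} {x} {y} eq = ≡.trans (≡.sym (Finₚ.combine-remQuot {m} n x))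
  (≡.trans (cong (uncurry combine) eq) (Finₚ.combine-remQuot {m} n y))

-- An l × l array of k′ × s′ blocks in which the block in position (i , j) is
-- filled exactly when j lies less than d cyclic steps after i.
module CyclicDesign {a ℓ} (G : AbelianGroup a ℓ) (l d k′ s′ c : ℕ) (d≤l : d ≤ l)
  {N : ℕ} (order : HasOrder G N) (count : c * (l * (d * (k′ * s′))) ≡ N)
  (val : Fin c → Fin l → Fin d → Fin k′ → Fin s′ → AbelianGroup.Carrier G) where

  open AbelianGroup G
  open Lines G

  Position : Set
  Position = Fin c × Fin l × Fin d × Fin k′ × Fin s′

  valAt : Position → Carrier
  valAt (t , i , e , u , v) = val t i e u v

  module _
    (injective : ∀ p q → valAt p ≈ valAt q → p ≡ q)
    (rows : ∀ t i u → sum (λ v → sum (λ e → val t i e u v)) ≈ ε)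
    (cols : ∀ t j v → sum (λ u → sum (λ e → val t (j ⊟ toℕ e) e u v)) ≈ ε) where

    private
      e<l : (e : Fin d) → toℕ e < l
      e<l e = ℕₚ.<-≤-trans (Finₚ.toℕ<n e) d≤l

      cell : Fin c → Fin l × Fin k′ → Fin l × Fin s′ → Maybe Carrier
      cell t (i , u) (j , v) with offset i j ℕ.<? d
      ... | yes near = just (val t i (fromℕ< near) u v)
      ... | no _     = nothing

      cell-filled : ∀ t {i j} e u v → offset i j ≡ toℕ e → cell t (i , u) (j , v) ≡ just (val t i e u v)
      cell-filled t {i} {j} e u v eq with offset i j ℕ.<? d
      ... | yes near = cong (λ e → just (val t i e u v))
              (Finₚ.toℕ-injective (≡.trans (Finₚ.toℕ-fromℕ< near) eq))
      ... | no far = ⊥-elim (far (subst (_< d) (≡.sym eq) (Finₚ.toℕ<n e)))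

      cell-empty : ∀ t i j u v → (∀ e → offset i j ≢ toℕ e) → cell t (i , u) (j , v) ≡ nothing
      cell-empty t i j u v far with offset i j ℕ.<? d
      ... | yes near = ⊥-elim (far (fromℕ< near) (≡.sym (Finₚ.toℕ-fromℕ< near)))
      ... | no _ = ≡.refl

      cell-just : ∀ t i j u v {y} → cell t (i , u) (j , v) ≡ just y →
                  ∃[ e ] (offset i j ≡ toℕ e × val t i e u v ≡ y)
      cell-just t i j u v eq with offset i j ℕ.<? d
      ... | yes near = fromℕ< near , ≡.sym (Finₚ.toℕ-fromℕ< near) , just-injective eq
      cell-just t i j u v () | no _

      arrays : Fin c → Fin (l * k′) → Fin (l * s′) → Maybe Carrier
      arrays t r q = cell t (remQuot k′ r) (remQuot s′ q)

      module Row (t : Fin c) (r : Fin (l * k′)) where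
        i = proj₁ (remQuot {l} k′ r)
        u = proj₂ (remQuot {l} k′ r)

        place : Fin s′ × Fin d → Fin (l * s′)
        place (v , e) = combine (i ⊞ toℕ e) v

        value : Fin s′ × Fin d → Carrier
        value (v , e) = val t i e u v

        place-injective : ∀ x y → place x ≡ place y → x ≡ y
        place-injective (v , e) (v′ , e′) eq
          with j≡ , v≡ ← Finₚ.combine-injective (i ⊞ toℕ e) v (i ⊞ toℕ e′) v′ eq =
          cong₂ _,_ v≡ (Finₚ.toℕ-injective (⊞-injective i (e<l e) (e<l e′) j≡))

        on : ∀ x → arrays t r (place x) ≡ just (value x)
        on (v , e) = ≡.trans (cong (cell t (i , u)) (Finₚ.remQuot-combine (i ⊞ toℕ e) v))
          (cell-filled t e u v (offset-⊞ i (e<l e)))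

        off : ∀ q → (∀ x → place x ≢ q) → arrays t r q ≡ nothing
        off q miss = cell-empty t i j u v λ e eq → miss (v , e)
          (≡.trans (cong (λ z → combine z v) (≡.trans (cong (i ⊞_) (≡.sym eq)) (⊞-offset i j)))
                   (Finₚ.combine-remQuot {l} s′ q))
          where
          j = proj₁ (remQuot {l} s′ q)
          v = proj₂ (remQuot {l} s′ q)

        enum = remQuot {s′} d

        enum-injective : ∀ x y → place (enum x) ≡ place (enum y) → x ≡ y
        enum-injective x y eq = combine-injective′ {s′} (place-injective _ _ eq)

        enum-off : ∀ q → (∀ x → place (enum x) ≢ q) → arrays t r q ≡ nothing
        enum-off q miss = off q λ (v , e) eq →
          miss (combine v e) (≡.trans (cong place (Finₚ.remQuot-combine v e)) eq)

        sum-value : sum (value ∘ enum) ≈ ε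
        sum-value = trans (sum-combine s′ (value ∘ enum))
          (trans (sum-cong (λ v → sum-cong (λ e → reflexive (cong value (Finₚ.remQuot-combine v e)))))
                 (rows t i u))

      module Col (t : Fin c) (q : Fin (l * s′)) where
        j = proj₁ (remQuot {l} s′ q)
        v = proj₂ (remQuot {l} s′ q)

        place : Fin k′ × Fin d → Fin (l * k′)
        place (u , e) = combine (j ⊟ toℕ e) u

        value : Fin k′ × Fin d → Carrier
        value (u , e) = val t (j ⊟ toℕ e) e u v

        ⊟-injective : ∀ e e′ → j ⊟ toℕ e ≡ j ⊟ toℕ e′ → e ≡ e′
        ⊟-injective e e′ eq = Finₚ.toℕ-injective (≡.trans (≡.sym (offset-⊟ j (e<l e)))
          (≡.trans (cong (λ z → offset z j) eq) (offset-⊟ j (e<l e′))))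

        place-injective : ∀ x y → place x ≡ place y → x ≡ y
        place-injective (u , e) (u′ , e′) eq
          with i≡ , u≡ ← Finₚ.combine-injective (j ⊟ toℕ e) u (j ⊟ toℕ e′) u′ eq =
          cong₂ _,_ u≡ (⊟-injective e e′ i≡)

        on : ∀ x → arrays t (place x) q ≡ just (value x)
        on (u , e) = ≡.trans (cong (λ z → cell t z (j , v)) (Finₚ.remQuot-combine (j ⊟ toℕ e) u))
          (cell-filled t e u v (offset-⊟ j (e<l e)))

        off : ∀ r → (∀ x → place x ≢ r) → arrays t r q ≡ nothing
        off r miss = cell-empty t i j u v λ e eq → miss (u , e)
          (≡.trans (cong (λ z → combine z u) (back e eq)) (Finₚ.combine-remQuot {l} k′ r))
          where
          i = proj₁ (remQuot {l} k′ r)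
          u = proj₂ (remQuot {l} k′ r)
          back : ∀ e → offset i j ≡ toℕ e → j ⊟ toℕ e ≡ i
          back e eq = begin
            j ⊟ toℕ e                   ≡⟨ cong (_⊟ toℕ e) (⊞-offset i j) ⟨
            i ⊞ offset i j ⊟ toℕ e      ≡⟨ cong (λ z → i ⊞ z ⊟ toℕ e) eq ⟩
            i ⊞ toℕ e ⊞ (l ∸ toℕ e)     ≡⟨ ⊞-⊞ i (toℕ e) (l ∸ toℕ e) ⟩
            i ⊞ (toℕ e + (l ∸ toℕ e))   ≡⟨ cong (i ⊞_) (ℕₚ.m+[n∸m]≡n (ℕₚ.<⇒≤ (e<l e))) ⟩
            i ⊞ l                       ≡⟨ ⊞-period i ⟩
            i                           ∎
            where open ≡.≡-Reasoning

        enum = remQuot {k′} d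

        enum-injective : ∀ x y → place (enum x) ≡ place (enum y) → x ≡ y
        enum-injective x y eq = combine-injective′ {k′} (place-injective _ _ eq)

        enum-off : ∀ r → (∀ x → place (enum x) ≢ r) → arrays t r q ≡ nothing
        enum-off r miss = off r λ (u , e) eq →
          miss (combine u e) (≡.trans (cong place (Finₚ.remQuot-combine u e)) eq)

        sum-value : sum (value ∘ enum) ≈ ε
        sum-value = trans (sum-combine k′ (value ∘ enum))
          (trans (sum-cong (λ u → sum-cong (λ e → reflexive (cong value (Finₚ.remQuot-combine u e)))))
                 (cols t j v))

      decode : Fin (c * (l * (d * (k′ * s′)))) → Position
      decode x = let t , x₁ = remQuot {c} (l * (d * (k′ * s′))) x
                     i , x₂ = remQuot {l} (d * (k′ * s′)) x₁
                     e , x₃ = remQuot {d} (k′ * s′) x₂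
                     u , v  = remQuot {k′} s′ x₃
                 in t , i , e , u , v

      decode-injective : ∀ x y → decode x ≡ decode y → x ≡ y
      decode-injective x y eq = combine-injective′ {c} (cong₂ _,_ (cong proj₁ eq)
        (combine-injective′ {l} (cong₂ _,_ (cong (proj₁ ∘ proj₂) eq)
          (combine-injective′ {d} (cong₂ _,_ (cong (proj₁ ∘ proj₂ ∘ proj₂) eq)
            (combine-injective′ {k′} (cong (proj₂ ∘ proj₂ ∘ proj₂) eq)))))))

      -- By `count` there are as many positions as group elements, so injectivity alone makes every
      -- element appear.
      exhaustive : ∀ x → ∃[ p ] valAt p ≈ x
      exhaustive x with p , eq ← FiniteGroup.injective⇒exhaustive G
                          (subst (HasOrder G) (≡.sym count) order) (valAt ∘ decode)
                          (λ p q eq → decode-injective p q (injective _ _ eq)) x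
        = decode p , eq

      slot : Fin c × Fin (l * k′) × Fin (l * s′) → Fin d → Position
      slot (t , r , q) e = t , proj₁ (remQuot {l} k′ r) , e , proj₂ (remQuot {l} k′ r) , proj₂
          (remQuot {l} s′ q)

      contains⇒slot : ∀ x pos → Contains G arrays pos x →
        ∃[ e ] (offset (proj₁ (remQuot {l} k′ (proj₁ (proj₂ pos)))) (proj₁ (remQuot {l} s′ (proj₂ (proj₂ pos)))) ≡ toℕ e
                × valAt (slot pos e) ≈ x)
      contains⇒slot x (t , r , q) (y , eq , y≈x)
        with e , off , ≡.refl ← cell-just t (proj₁ (remQuot {l} k′ r)) _ (proj₂ (remQuot {l} k′ r)) _ eq
        = e , off , y≈x

    design : M⁰S G (Whole G) (l * k′) (l * s′) (s′ * d) (k′ * d) c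
    design .M⁰S.arrays = arrays
    design .M⁰S.entries∈Ω _ _ _ _ _ = tt
    design .M⁰S.appears x _ with (t , i , e , u , v) , eq ← exhaustive x =
      (t , combine i u , combine (i ⊞ toℕ e) v) , val t i e u v ,
      ≡.trans (cong₂ (cell t) (Finₚ.remQuot-combine i u) (Finₚ.remQuot-combine (i ⊞ toℕ e) v))
        (cell-filled t e u v (offset-⊞ i (e<l e))) ,
      eq
    design .M⁰S.once x pos@(t , r , q) pos′@(t′ , r′ , q′) p p′
      with e , o , eq ← contains⇒slot x pos p | e′ , o′ , eq′ ← contains⇒slot x pos′ p′
      with same ← injective _ _ (trans eq (sym eq′))
      = cong₂ _,_ (cong proj₁ same) (cong₂ _,_
          (combine-injective′ {l} (cong₂ _,_ i≡ (cong (proj₁ ∘ proj₂ ∘ proj₂ ∘ proj₂) same)))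
          (combine-injective′ {l} (cong₂ _,_ j≡ (cong (proj₂ ∘ proj₂ ∘ proj₂ ∘ proj₂) same))))
      where
      i≡ = cong (proj₁ ∘ proj₂) same
      -- The column block is not part of a position; it is recovered from the row block and the
      -- diagonal.
      j≡ : proj₁ (remQuot {l} s′ q) ≡ proj₁ (remQuot {l} s′ q′)
      j≡ = ≡.trans (≡.sym (⊞-offset _ _)) (≡.trans
             (cong₂ _⊞_ i≡ (≡.trans o (≡.trans (cong (toℕ ∘ proj₁ ∘ proj₂ ∘ proj₂) same) (≡.sym o′))))
             (⊞-offset _ _))
    design .M⁰S.rowFilled t r = filled-enum (arrays t r) (place ∘ enum) (value ∘ enum) enum-injective
        (on ∘ enum) enum-off
      where open Row t r
    design .M⁰S.colFilled t q = filled-enum (λ r → arrays t r q) (place ∘ enum) (value ∘ enum) enum-injective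
        (on ∘ enum) enum-off
      where open Col t q
    design .M⁰S.rowSum t r = trans (lineSum-enum (arrays t r) (place ∘ enum) (value ∘ enum) enum-injective (on ∘ enum) enum-off) sum-value
      where open Row t r
    design .M⁰S.colSum t q = trans (lineSum-enum (λ r → arrays t r q) (place ∘ enum) (value ∘ enum) enum-injective (on ∘ enum) enum-off) sum-value
      where open Col t q

-- Residues and weights of total zero

module ℤΣ = MonoidSums ℤₚ.+-0-commutativeMonoid
module ℤ/ (r : ℕ) = AbelianGroup (ℤ/ r)
module ≈-Reasoning (r : ℕ) = SetoidReasoning (AbelianGroup.setoid (ℤ/ r))

≡⇒mod : ∀ r {x y} → x ≡ y → x ≡[mod r ] y
≡⇒mod r {x} ≡.refl = ℤ/.refl r {x}

multiple-bounded : ∀ {r x} → + r ℤ∣.∣ x → ∣ x ∣ < r → x ≡ 0ℤ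
multiple-bounded {r} {x} r∣x x<r with ∣ x ∣ in eq
... | zero = ℤₚ.∣i∣≡0⇒i≡0 eq
... | suc a = ⊥-elim (ℕ∣.>⇒∤ x<r (subst (r ℕ∣.∣_) eq (ℤ∣.∣⇒∣ᵤ r∣x)))

∣-∣<-bounded : ∀ {m n r} → m < r → n < r → ∣ + m ℤ.- + n ∣ < r
∣-∣<-bounded {m} {n} m<r n<r = ℕₚ.≤-<-trans
  (ℕₚ.≤-trans (ℕₚ.≤-reflexive (cong ∣_∣ (ℤₚ.[+m]-[+n]≡m⊖n m n))) (ℤₚ.∣m⊝n∣≤m⊔n m n))
  (ℕₚ.⊔-pres-<m m<r n<r)

residue-injective : ∀ {m n r} → m < r → n < r → (+ m) ≡[mod r ] (+ n) → m ≡ n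
residue-injective {m} {n} m<r n<r eq =
    ℤₚ.+-injective (ℤₚ.i-j≡0⇒i≡j (+ m) (+ n) (multiple-bounded eq (∣-∣<-bounded m<r n<r)))

Fin-residue-injective : ∀ {r} (i j : Fin r) → (+ toℕ i) ≡[mod r ] (+ toℕ j) → i ≡ j
Fin-residue-injective i j eq = Finₚ.toℕ-injective (residue-injective (Finₚ.toℕ<n i) (Finₚ.toℕ<n j) eq)

residue : ∀ x r .{{_ : NonZero r}} → ∃[ i ] (+ toℕ {r} i) ≡[mod r ] x
residue x r = fromℕ< r> , ℤ/.sym r {x} {+ toℕ (fromℕ< r>)}
    (≡.subst (λ z → (+ r) ℤ∣.∣ (x ℤ.- + z)) (≡.sym (Finₚ.toℕ-fromℕ< r>))
  (ℤ∣.divides (x ℤDivMod./ℕ r) (begin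
    x ℤ.- + (x ℤDivMod.%ℕ r)
      ≡⟨ cong (ℤ._- + (x ℤDivMod.%ℕ r)) (ℤDivMod.a≡a%ℕn+[a/ℕn]*n x r) ⟩
    + (x ℤDivMod.%ℕ r) ℤ.+ (x ℤDivMod./ℕ r) ℤ.* + r ℤ.- + (x ℤDivMod.%ℕ r)
      ≡⟨ lemma (+ (x ℤDivMod.%ℕ r)) _ ⟩
    (x ℤDivMod./ℕ r) ℤ.* + r ∎)))
  where
  open ≡.≡-Reasoning
  r> = ℤDivMod.n%ℕd<d x r
  lemma : ∀ a b → a ℤ.+ b ℤ.- a ≡ b
  lemma = ℤRing.solve-∀

ℤ/-order : ∀ r .{{_ : NonZero r}} → HasOrder (ℤ/ r) r
ℤ/-order r = (λ i → + toℕ i) , Fin-residue-injective , λ x → residue x r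

⊕-order : ∀ {a ℓ b ℓ′} {G : AbelianGroup a ℓ} {H : AbelianGroup b ℓ′} {M N} →
          HasOrder G M → HasOrder H N → HasOrder (G ⊕ H) (M * N)
⊕-order {G = G} {H} {M} {N} (f , f-inj , f-surj) (g , g-inj , g-surj) = fg ∘ remQuot {M} N , inj , surj
  where
  module GH = AbelianGroup (G ⊕ H)
  fg : Fin M × Fin N → GH.Carrier
  fg (i , j) = f i , g j
  inj : ∀ x y → fg (remQuot {M} N x) GH.≈ fg (remQuot {M} N y) → x ≡ y
  inj x y (p , q) = combine-injective′ {M} (cong₂ _,_ (f-inj _ _ p) (g-inj _ _ q))
  surj : ∀ z → ∃[ x ] fg (remQuot {M} N x) GH.≈ z
  surj (x , y) = combine (proj₁ (f-surj x)) (proj₁ (g-surj y)) , GH.trans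
    (GH.reflexive (cong fg (Finₚ.remQuot-combine (proj₁ (f-surj x)) (proj₁ (g-surj y)))))
    (proj₂ (f-surj x) , proj₂ (g-surj y))

-- Odd moduli, centred digits and weights

Odd : ℕ → Set
Odd n = ¬ (2 ℕ∣.∣ n)

odd⇒1+2* : ∀ {n} → Odd n → ∃[ h ] n ≡ suc (h + h)
odd⇒1+2* {zero} odd = ⊥-elim (odd (2 ℕ∣.∣0))
odd⇒1+2* {suc zero} odd = 0 , ≡.refl
odd⇒1+2* {suc (suc n)} odd
  with h , eq ← odd⇒1+2* {n} (λ 2∣n → odd (ℕ∣.∣m∣n⇒∣m+n (ℕ∣.∣-refl {2}) 2∣n)) =
  suc h , cong (λ z → suc (suc z)) (≡.trans eq (≡.sym (ℕₚ.+-suc h h)))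

odd-∣ : ∀ {m n} → m ℕ∣.∣ n → Odd n → Odd m
odd-∣ m∣n odd 2∣m = odd (ℕ∣.∣-trans 2∣m m∣n)

-- Cancellation modulo every odd number at once, so that weights can be fixed before the modulus is
-- known.
Unit : ℤ → Set
Unit z = ∀ {r} → Odd r → ∀ x → + r ℤ∣.∣ z ℤ.* x → + r ℤ∣.∣ x

1-unit : Unit (+ 1)
1-unit _ x = subst (_ ℤ∣.∣_) (ℤₚ.*-identityˡ x)

-- With r = 1 + 2h one has x = r x - h (2x).
2-unit : Unit (+ 2)
2-unit {r} odd x r∣2x with h , ≡.refl ← odd⇒1+2* odd = subst (+ r ℤ∣.∣_) (lemma (+ h) x)
  (ℤ∣.∣m∣n⇒∣m-n (ℤ∣.∣m⇒∣m*n {+ r} x ℤ∣.∣-refl) (ℤ∣.∣n⇒∣m*n (+ h) r∣2x))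
  where
  lemma : ∀ h x → (+ 1 ℤ.+ (h ℤ.+ h)) ℤ.* x ℤ.- h ℤ.* (+ 2 ℤ.* x) ≡ x
  lemma = ℤRing.solve-∀

neg-unit : ∀ {z} → Unit z → Unit (- z)
neg-unit {z} unit odd x r∣ = unit odd x (subst (_ ℤ∣.∣_) (lemma z x) (ℤ∣.∣m⇒∣-m r∣))
  where
  lemma : ∀ z x → - ((- z) ℤ.* x) ≡ z ℤ.* x
  lemma = ℤRing.solve-∀

*-unit : ∀ {y z} → Unit y → Unit z → Unit (y ℤ.* z)
*-unit {y} {z} uy uz odd x r∣ = uz odd x (uy odd (z ℤ.* x) (subst (_ ℤ∣.∣_) (ℤₚ.*-assoc y z x) r∣))

-- The odd number 2h + 1, by a recursion that lets a sum over `Fin (width h)` lose its first and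
-- last terms by computation.
width : ℕ → ℕ
width zero = 1
width (suc h) = suc (suc (width h))

width≡ : ∀ h → width h ≡ suc (h + h)
width≡ zero = ≡.refl
width≡ (suc h) = cong (λ z → suc (suc z)) (≡.trans (width≡ h) (≡.sym (ℕₚ.+-suc h h)))

centred : ∀ h → Fin (width h) → ℤ
centred h i = toℕ i ⊖ h

centred-last : ∀ h → width h ⊖ h ≡ + suc h
centred-last h = ≡.trans (ℤₚ.⊖-≥ (subst (h ≤_) (≡.sym (width≡ h)) (ℕₚ.m≤n⇒m≤1+n (ℕₚ.m≤m+n h h))))
  (cong +_ (≡.trans (cong (_∸ h) (width≡ h)) (≡.trans (ℕₚ.+-∸-assoc 1 (ℕₚ.m≤m+n h h)) (cong suc (ℕₚ.m+n∸m≡n h h)))))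

toℕ≡centred+ : ∀ h (i : Fin (width h)) → + toℕ i ≡ centred h i ℤ.+ + h
toℕ≡centred+ h i = ≡.trans (lemma (+ toℕ i) (+ h)) (cong (ℤ._+ + h) (ℤₚ.[+m]-[+n]≡m⊖n (toℕ i) h))
  where
  lemma : ∀ a b → a ≡ a ℤ.- b ℤ.+ b
  lemma = ℤRing.solve-∀

centred-injective : ∀ h {r} (i j : Fin (width h)) → width h ≤ r → centred h i ≡[mod r ] centred h j → i ≡ j
centred-injective h {r} i j w≤r eq = Finₚ.toℕ-injective (residue-injective
  (ℕₚ.<-≤-trans (Finₚ.toℕ<n i) w≤r) (ℕₚ.<-≤-trans (Finₚ.toℕ<n j) w≤r)
  (subst (+ r ℤ∣.∣_) (≡.trans (lemma (centred h i) (centred h j) (+ h))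
    (≡.sym (cong₂ ℤ._-_ (toℕ≡centred+ h i) (toℕ≡centred+ h j)))) eq))
  where
  lemma : ∀ a b c → a ℤ.- b ≡ a ℤ.+ c ℤ.- (b ℤ.+ c)
  lemma = ℤRing.solve-∀

toℕ-last : ∀ n → toℕ (fromℕ n) ≡ n
toℕ-last = Finₚ.toℕ-fromℕ

sum-centred : ∀ h (F : ℤ → ℤ) → ℤΣ.sum {width h} (F ∘ centred h) ≡
              F 0ℤ ℤ.+ ℤΣ.sum {h} (λ j → F (+ suc (toℕ j)) ℤ.+ F (- (+ suc (toℕ j))))
sum-centred zero F = ≡.refl
sum-centred (suc h) F = begin
  F (0 ⊖ suc h) ℤ.+ ℤΣ.sum {suc (width h)} (λ i → F (suc (toℕ i) ⊖ suc h))
    ≡⟨ cong (λ z → F (- (+ suc h)) ℤ.+ z)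
        (ℤΣ.sum-cong {suc (width h)} (λ i → cong F (ℤₚ.[1+m]⊖[1+n]≡m⊖n (toℕ i) h))) ⟩
  F (- (+ suc h)) ℤ.+ ℤΣ.sum {suc (width h)} (λ i → F (toℕ i ⊖ h))
    ≡⟨ cong (λ z → F (- (+ suc h)) ℤ.+ z) (ℤΣ.sum-init-last {width h} (λ i → F (toℕ i ⊖ h))) ⟩
  F (- (+ suc h)) ℤ.+ (ℤΣ.sum {width h} (λ i → F (toℕ (inject₁ i) ⊖ h)) ℤ.+ F (toℕ (fromℕ (width h)) ⊖ h))
    ≡⟨ cong (λ z → F (- (+ suc h)) ℤ.+ z) (cong₂ ℤ._+_
        (≡.trans (ℤΣ.sum-cong {width h} (λ i → cong (λ z → F (z ⊖ h)) (Finₚ.toℕ-inject₁ i))) (sum-centred h F))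
        (cong F (≡.trans (cong (_⊖ h) (toℕ-last (width h))) (centred-last h)))) ⟩
  F (- (+ suc h)) ℤ.+ (F 0ℤ ℤ.+ S ℤ.+ F (+ suc h))
    ≡⟨ lemma (F (- (+ suc h))) (F 0ℤ) S (F (+ suc h)) ⟩
  F 0ℤ ℤ.+ (S ℤ.+ (F (+ suc h) ℤ.+ F (- (+ suc h))))
    ≡⟨ cong (λ z → F 0ℤ ℤ.+ z) (cong₂ ℤ._+_
        (ℤΣ.sum-cong {h} (λ j → cong pair (Finₚ.toℕ-inject₁ j)))
        (cong pair (toℕ-last h))) ⟨
  F 0ℤ ℤ.+ (ℤΣ.sum {h} (λ j → pair (toℕ (inject₁ j))) ℤ.+ pair (toℕ (fromℕ h)))
    ≡⟨ cong (λ z → F 0ℤ ℤ.+ z) (ℤΣ.sum-init-last {h} (λ j → pair (toℕ j))) ⟨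
  F 0ℤ ℤ.+ ℤΣ.sum {suc h} (λ j → pair (toℕ j)) ∎
  where
  open ≡.≡-Reasoning
  pair : ℕ → ℤ
  pair j = F (+ suc j) ℤ.+ F (- (+ suc j))
  S = ℤΣ.sum {h} (λ j → pair (toℕ j))
  lemma : ∀ a b c d → a ℤ.+ (b ℤ.+ c ℤ.+ d) ≡ b ℤ.+ (c ℤ.+ (d ℤ.+ a))
  lemma = ℤRing.solve-∀

sum-odd : ∀ h (F : ℤ → ℤ) → (∀ x → F (- x) ≡ - F x) → ℤΣ.sum {width h} (F ∘ centred h) ≡ 0ℤ
sum-odd h F odd = ≡.trans (sum-centred h F) (cong₂ ℤ._+_ F0≡0 (ℤΣ.sum-ε {h} λ j →
    ≡.trans (cong (λ z → F (+ suc (toℕ j)) ℤ.+ z) (odd (+ suc (toℕ j)))) (ℤₚ.+-inverseʳ (F (+ suc (toℕ j))))))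
  where
  self-neg : ∀ {x} → x ≡ - x → x ≡ 0ℤ
  self-neg {+ 0} eq = ≡.refl
  self-neg { -[1+ n ]} ()
  F0≡0 : F 0ℤ ≡ 0ℤ
  F0≡0 = self-neg (odd 0ℤ)

-- Values at the distances 1, …, h from the centre, of total 1.
tailWeight : ℕ → ℕ → ℤ
tailWeight 2 0 = + 2
tailWeight 2 1 = - (+ 1)
tailWeight (suc (suc (suc h))) 1 = - (+ 1)
tailWeight (suc (suc (suc h))) (suc (suc j)) = tailWeight (suc h) j
tailWeight _ _ = + 1

-- The centre carries -2 against a total of 1 on each side. Being an even function of the digit, the
-- weight times the digit is odd and sums to zero for free.
weight : ℕ → ℤ → ℤ
weight h x with ∣ x ∣
... | zero = - (+ 2)
... | suc j = tailWeight h j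

tailWeight-unit : ∀ h j → Unit (tailWeight h j)
tailWeight-unit 0 j = 1-unit
tailWeight-unit 1 j = 1-unit
tailWeight-unit 2 0 = 2-unit
tailWeight-unit 2 1 = neg-unit {+ 1} 1-unit
tailWeight-unit 2 (suc (suc j)) = 1-unit
tailWeight-unit (suc (suc (suc h))) 0 = 1-unit
tailWeight-unit (suc (suc (suc h))) 1 = neg-unit {+ 1} 1-unit
tailWeight-unit (suc (suc (suc h))) (suc (suc j)) = tailWeight-unit (suc h) j

weight-unit : ∀ h x → Unit (weight h x)
weight-unit h x with ∣ x ∣
... | zero = neg-unit {+ 2} 2-unit
... | suc j = tailWeight-unit h j

weight-even : ∀ h x → weight h (- x) ≡ weight h x
weight-even h x rewrite ℤₚ.∣-i∣≡∣i∣ x = ≡.refl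

sum-tailWeight : ∀ h → ℤΣ.sum {suc h} (λ j → tailWeight (suc h) (toℕ j)) ≡ + 1
sum-tailWeight 0 = ≡.refl
sum-tailWeight 1 = ≡.refl
sum-tailWeight (suc (suc h)) = cong (λ z → + 1 ℤ.+ (- (+ 1) ℤ.+ z)) (sum-tailWeight h)

sum-weight : ∀ h → ℤΣ.sum {width (suc h)} (weight (suc h) ∘ centred (suc h)) ≡ 0ℤ
sum-weight h = ≡.trans (sum-centred (suc h) (weight (suc h)))
  (cong (λ z → - (+ 2) ℤ.+ z) (≡.trans (ℤΣ.∑-distrib-+ {suc h} f f) (cong₂ ℤ._+_ (sum-tailWeight h) (sum-tailWeight h))))
  where
  f : Fin (suc h) → ℤ
  f j = tailWeight (suc h) (toℕ j)

module Weighted (h : ℕ) where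
  d : ℕ
  d = width (suc h)

  digit w : Fin d → ℤ
  digit = centred (suc h)
  w = weight (suc h) ∘ digit

  sum-w : ℤΣ.sum w ≡ 0ℤ
  sum-w = sum-weight h

  sum-w*digit : ℤΣ.sum (λ e → w e ℤ.* digit e) ≡ 0ℤ
  sum-w*digit = sum-odd (suc h) (λ x → weight (suc h) x ℤ.* x) λ x →
    ≡.trans (cong (ℤ._* (- x)) (weight-even (suc h) x)) (≡.sym (ℤₚ.neg-distribʳ-* (weight (suc h) x) x))

  -- A digit is e minus a constant, so the vanishing of Σ w and Σ w digit kills every affine
  -- function of e. Rows use slope 0 and columns slope `- Q₀`.
  sum-w* : ∀ A B → ℤΣ.sum (λ e → w e ℤ.* (A ℤ.+ B ℤ.* + toℕ e)) ≡ 0ℤ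
  sum-w* A B = begin
    ℤΣ.sum (λ e → w e ℤ.* (A ℤ.+ B ℤ.* + toℕ e))
      ≡⟨ ℤΣ.sum-cong (λ e → ≡.trans (cong (λ z → w e ℤ.* (A ℤ.+ B ℤ.* z)) (toℕ≡centred+ (suc h) e)) (lemma (w e) A B (digit e) (+ suc h))) ⟩
    ℤΣ.sum (λ e → w e ℤ.* (A ℤ.+ B ℤ.* + suc h) ℤ.+ w e ℤ.* digit e ℤ.* B)
      ≡⟨ ℤΣ.∑-distrib-+ (λ e → w e ℤ.* (A ℤ.+ B ℤ.* + suc h)) (λ e → w e ℤ.* digit e ℤ.* B) ⟩
    ℤΣ.sum (λ e → w e ℤ.* (A ℤ.+ B ℤ.* + suc h)) ℤ.+ ℤΣ.sum (λ e → w e ℤ.* digit e ℤ.* B)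
      ≡⟨ cong₂ ℤ._+_ (≡.sym (ℤSum.*-distribʳ-sum (A ℤ.+ B ℤ.* + suc h) w))
           (≡.sym (ℤSum.*-distribʳ-sum B (λ e → w e ℤ.* digit e))) ⟩
    ℤΣ.sum w ℤ.* (A ℤ.+ B ℤ.* + suc h) ℤ.+ ℤΣ.sum (λ e → w e ℤ.* digit e) ℤ.* B
      ≡⟨ cong₂ (λ x y → x ℤ.* (A ℤ.+ B ℤ.* + suc h) ℤ.+ y ℤ.* B) sum-w sum-w*digit ⟩
    0ℤ ∎
    where
    open ≡.≡-Reasoning
    lemma : ∀ w A B x h → w ℤ.* (A ℤ.+ B ℤ.* (x ℤ.+ h)) ≡ w ℤ.* (A ℤ.+ B ℤ.* h) ℤ.+ w ℤ.* x ℤ.* B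
    lemma = ℤRing.solve-∀

-- `sum-antisymmetric` is kept for an arbitrary odd function because `CoprimeBlocks` applies it to a
-- twisted multiple of the digit.
record Weights (d : ℕ) : Set where
  field
    digit : Fin d → ℤ
    weightAt : ℤ → ℤ
  w : Fin d → ℤ
  w e = weightAt (digit e)
  field
    digit-injective : ∀ e e′ → digit e ≡[mod d ] digit e′ → e ≡ e′
    unit : ∀ x → Unit (weightAt x)
    even : ∀ x → weightAt (- x) ≡ weightAt x
    sum-antisymmetric : ∀ (F : ℤ → ℤ) → (∀ x → F (- x) ≡ - F x) → ℤΣ.sum (λ e → F (digit e)) ≡ 0ℤ
    sum-w : ℤΣ.sum w ≡ 0ℤ
    sum-w* : ∀ A B → ℤΣ.sum (λ e → w e ℤ.* (A ℤ.+ B ℤ.* + toℕ e)) ≡ 0ℤ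
  sum-digit : ℤΣ.sum digit ≡ 0ℤ
  sum-digit = sum-antisymmetric id (λ _ → ≡.refl)

weights : ∀ h → Weights (width (suc h))
weights h = record
  { digit = digit
  ; weightAt = weight (suc h)
  ; digit-injective = λ e e′ → centred-injective (suc h) {width (suc h)} e e′ ℕₚ.≤-refl
  ; unit = weight-unit (suc h)
  ; even = weight-even (suc h)
  ; sum-antisymmetric = sum-odd (suc h)
  ; sum-w = sum-w
  ; sum-w* = sum-w*
  }
  where open Weighted h

-- Affine entries on the diagonals for odd d greater than 1

⊟-residue : ∀ {l} (j : Fin l) {x} → x ≤ l → (+ toℕ (j ⊟ x)) ≡[mod l ] (+ toℕ j ℤ.- + x)
⊟-residue {suc l} j {x} x≤l = ℤ∣.divides (+ q) (begin
  + y ℤ.- (+ toℕ j ℤ.- + x)              ≡⟨ lemma (+ y) (+ toℕ j) (+ x) ⟩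
  + (y + x) ℤ.- + toℕ j                  ≡⟨ cong₂ (λ a b → + a ℤ.- + b) (DivMod.m≡m%n+[m/n]*n (y + x) (suc l))
      j≡ ⟩
  + ((y + x) % suc l + q * suc l) ℤ.- + ((y + x) % suc l)
    ≡⟨ cong (ℤ._- + ((y + x) % suc l)) (ℤₚ.pos-+ ((y + x) % suc l) (q * suc l)) ⟩
  + ((y + x) % suc l) ℤ.+ + (q * suc l) ℤ.- + ((y + x) % suc l) ≡⟨ lemma₂ (+ ((y + x) % suc l))
      (+ (q * suc l)) ⟩
  + (q * suc l) ≡⟨ ℤₚ.pos-* q (suc l) ⟩
  + q ℤ.* + suc l ∎)
  where
  open ≡.≡-Reasoning
  y = toℕ (j ⊟ x)
  q = (y + x) / suc l
  j≡ : toℕ j ≡ (y + x) % suc l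
  j≡ = ≡.trans (cong toℕ (≡.sym (⊟-⊞ j x≤l))) (toℕ-⊞ (j ⊟ x) x)
  lemma : ∀ y j x → y ℤ.- (j ℤ.- x) ≡ y ℤ.+ x ℤ.- j
  lemma = ℤRing.solve-∀
  lemma₂ : ∀ a b → a ℤ.+ b ℤ.- a ≡ b
  lemma₂ = ℤRing.solve-∀

scale-mod : ∀ n {r} x y → x ≡[mod r ] y → (+ n ℤ.* x) ≡[mod n * r ] (+ n ℤ.* y)
scale-mod n {r} x y r∣ = ≡.subst₂ ℤ∣._∣_ (≡.sym (ℤₚ.pos-* n r)) (lemma (+ n) x y) (ℤ∣.*-monoʳ-∣ (+ n) r∣)
  where
  lemma : ∀ n x y → n ℤ.* (x ℤ.- y) ≡ n ℤ.* x ℤ.- n ℤ.* y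
  lemma = ℤRing.solve-∀

unscale-mod : ∀ n .{{_ : NonZero n}} {r} x y → (+ n ℤ.* x) ≡[mod n * r ] (+ n ℤ.* y) → x ≡[mod r ] y
unscale-mod n@(suc _) {r} x y eq = ℤ∣.*-cancelˡ-∣ (+ n) {{_}}
  (≡.subst₂ ℤ∣._∣_ (ℤₚ.pos-* n r) (lemma (+ n) x y) eq)
  where
  lemma : ∀ n x y → n ℤ.* x ℤ.- n ℤ.* y ≡ n ℤ.* (x ℤ.- y)
  lemma = ℤRing.solve-∀

weaken-mod : ∀ {r r′} x y → r ℕ∣.∣ r′ → x ≡[mod r′ ] y → x ≡[mod r ] y
weaken-mod x y r∣r′ = ℤ∣.∣-trans (ℤ∣.∣ᵤ⇒∣ r∣r′)

unit-cancel : ∀ {z r} x y → Unit z → Odd r → (z ℤ.* x) ≡[mod r ] (z ℤ.* y) → x ≡[mod r ] y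
unit-cancel {z} {r} x y unit odd eq = unit odd (x ℤ.- y) (subst (+ r ℤ∣.∣_) (lemma z x y) eq)
  where
  lemma : ∀ z x y → z ℤ.* x ℤ.- z ℤ.* y ≡ z ℤ.* (x ℤ.- y)
  lemma = ℤRing.solve-∀

module OddDiagonals (l d k′ s′ c : ℕ) (weights : Weights d) (d≤l : d ≤ l) {{_ : NonZero d}} where
  open Weights weights

  Q₀ Q : ℕ
  Q₀ = c * (k′ * s′)
  Q = l * Q₀

  low : Fin c → Fin k′ → Fin s′ → Fin Q₀
  low t u v = combine t (combine u v)

  -- The block row is the leading digit, so W is `Q₀` times i plus a constant, and reducing i modulo
  -- l amounts to reducing W modulo `Q`.
  W : Fin c → Fin l → Fin k′ → Fin s′ → Fin Q
  W t i u v = combine i (low t u v)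

  W-injective : ∀ t i u v t′ i′ u′ v′ → W t i u v ≡ W t′ i′ u′ v′ → (t , i , u , v) ≡ (t′ , i′ , u′ , v′)
  W-injective t i u v t′ i′ u′ v′ eq
    with ≡.refl , eq₁ ← Finₚ.combine-injective i (low t u v) i′ (low t′ u′ v′) eq
    with ≡.refl , eq₂ ← Finₚ.combine-injective t (combine u v) t′ (combine u′ v′) eq₁
    with ≡.refl , ≡.refl ← Finₚ.combine-injective u v u′ v′ eq₂ = ≡.refl

  high : Fin c → Fin l → Fin d → Fin k′ → Fin s′ → ℤ
  high t i e u v = w e ℤ.* + toℕ (W t i u v)

  module 𝐐 = AbelianGroup (ℤ/ Q)
  module QΣ = MonoidSums 𝐐.commutativeMonoid

  high-rows : ∀ t i u v → ℤΣ.sum (λ e → high t i e u v) ≡[mod Q ] 0ℤ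
  high-rows t i u v = ≡⇒mod Q (≡.trans
    (ℤΣ.sum-cong {d} (λ e → cong (w e ℤ.*_) (≡.sym (ℤₚ.+-identityʳ (+ toℕ (W t i u v))))))
    (sum-w* (+ toℕ (W t i u v)) 0ℤ))

  -- In column block j the e-th diagonal lies in block row j - e modulo l, so modulo `Q` the number
  -- W becomes affine in e with slope `- Q₀`.
  high-cols : ∀ t j u v → ℤΣ.sum (λ e → high t (j ⊟ toℕ e) e u v) ≡[mod Q ] 0ℤ
  high-cols t j u v = begin
    ℤΣ.sum (λ e → high t (j ⊟ toℕ e) e u v)
      ≈⟨ QΣ.sum-cong {d} {λ e → high t (j ⊟ toℕ e) e u v} {λ e → w e ℤ.* (A ℤ.+ (- (+ Q₀)) ℤ.* + toℕ e)} step ⟩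
    ℤΣ.sum (λ e → w e ℤ.* (A ℤ.+ (- (+ Q₀)) ℤ.* + toℕ e))
      ≡⟨ sum-w* A (- (+ Q₀)) ⟩
    0ℤ ∎
    where
    open ≈-Reasoning Q
    z = toℕ (low t u v)
    A = + Q₀ ℤ.* + toℕ j ℤ.+ + z
    lemma : ∀ w q j x z → w ℤ.* (q ℤ.* (j ℤ.- x) ℤ.+ z) ≡ w ℤ.* (q ℤ.* j ℤ.+ z ℤ.+ (- q) ℤ.* x)
    lemma = ℤRing.solve-∀
    factor : ∀ w x y → w ℤ.* (x ℤ.- y) ≡ w ℤ.* x ℤ.- w ℤ.* y
    factor = ℤRing.solve-∀
    step : ∀ e → high t (j ⊟ toℕ e) e u v 𝐐.≈ w e ℤ.* (A ℤ.+ (- (+ Q₀)) ℤ.* + toℕ e)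
    step e = begin
      w e ℤ.* + toℕ (W t i u v)                               ≡⟨ cong (w e ℤ.*_) W≡ ⟩
      w e ℤ.* (+ Q₀ ℤ.* + toℕ i ℤ.+ + z)                      ≈⟨ mult ⟩
      w e ℤ.* (+ Q₀ ℤ.* (+ toℕ j ℤ.- + toℕ e) ℤ.+ + z)        ≡⟨ lemma (w e) (+ Q₀) (+ toℕ j) (+ toℕ e) (+ z) ⟩
      w e ℤ.* (A ℤ.+ (- (+ Q₀)) ℤ.* + toℕ e)                  ∎
      where
      i = j ⊟ toℕ e
      W≡ : + toℕ (W t i u v) ≡ + Q₀ ℤ.* + toℕ i ℤ.+ + z
      W≡ = ≡.trans (cong +_ (Finₚ.toℕ-combine i (low t u v))) (cong (ℤ._+ + z) (ℤₚ.pos-* Q₀ (toℕ i)))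
      base : (+ Q₀ ℤ.* + toℕ i ℤ.+ + z) ≡[mod Q ] (+ Q₀ ℤ.* (+ toℕ j ℤ.- + toℕ e) ℤ.+ + z)
      base = 𝐐.∙-congʳ {+ z} {+ Q₀ ℤ.* + toℕ i} {+ Q₀ ℤ.* (+ toℕ j ℤ.- + toℕ e)}
        (subst (λ r → (+ Q₀ ℤ.* + toℕ i) ≡[mod r ] (+ Q₀ ℤ.* (+ toℕ j ℤ.- + toℕ e))) (ℕₚ.*-comm Q₀ l)
          (scale-mod Q₀ {l} (+ toℕ i) (+ toℕ j ℤ.- + toℕ e) (⊟-residue j (ℕₚ.≤-trans (ℕₚ.<⇒≤ (Finₚ.toℕ<n e)) d≤l))))
      mult : (w e ℤ.* (+ Q₀ ℤ.* + toℕ i ℤ.+ + z)) ≡[mod Q ] (w e ℤ.* (+ Q₀ ℤ.* (+ toℕ j ℤ.- + toℕ e) ℤ.+ + z))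
      mult = subst (+ Q ℤ∣.∣_) (factor (w e) (+ Q₀ ℤ.* + toℕ i ℤ.+ + z) (+ Q₀ ℤ.* (+ toℕ j ℤ.- + toℕ e) ℤ.+ + z))
               (ℤ∣.∣n⇒∣m*n (w e) base)

  high-injective : Odd Q → ∀ t i e u v t′ i′ e′ u′ v′ → e ≡ e′ → high t i e u v ≡[mod Q ] high t′ i′ e′ u′ v′ →
                   (t , i , e , u , v) ≡ (t′ , i′ , e′ , u′ , v′)
  high-injective odd t i e u v t′ i′ e u′ v′ ≡.refl eq =
    cong (λ (t , i , u , v) → t , i , e , u , v) (W-injective t i u v t′ i′ u′ v′
      (Fin-residue-injective _ _ (unit-cancel {w e} (+ toℕ (W t i u v)) (+ toℕ (W t′ i′ u′ v′)) (unit (digit e)) odd eq)))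

  private
    reshape : c * (l * (d * (k′ * s′))) ≡ d * Q
    reshape = lemma c l d k′ s′
      where
      lemma : ∀ c l d k s → c * (l * (d * (k * s))) ≡ d * (l * (c * (k * s)))
      lemma = solve-∀

  module _ (odd : Odd Q) {{_ : NonZero Q}} where

    direct-sum : M⁰S (ℤ/ d ⊕ ℤ/ Q) (Whole (ℤ/ d ⊕ ℤ/ Q)) (l * k′) (l * s′) (s′ * d) (k′ * d) c
    direct-sum = design inj rows cols
      where
      module 𝐆 = AbelianGroup (ℤ/ d ⊕ ℤ/ Q)
      open MonoidSums 𝐆.commutativeMonoid
      val : Fin c → Fin l → Fin d → Fin k′ → Fin s′ → ℤ × ℤ
      val t i e u v = digit e , high t i e u v
      open CyclicDesign (ℤ/ d ⊕ ℤ/ Q) l d k′ s′ c d≤l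
        (⊕-order {G = ℤ/ d} {ℤ/ Q} (ℤ/-order d) (ℤ/-order Q)) reshape val
      sum-pair : ∀ {n} (f g : Fin n → ℤ) → sum (λ x → f x , g x) ≡ (ℤΣ.sum f , ℤΣ.sum g)
      sum-pair {zero} f g = ≡.refl
      sum-pair {suc n} f g rewrite sum-pair (f ∘ suc) (g ∘ suc) = ≡.refl
      line : ∀ {n} (H : Fin n → Fin d → ℤ) → (∀ x → ℤΣ.sum (H x) ≡[mod Q ] 0ℤ) →
             sum (λ x → sum (λ e → digit e , H x e)) 𝐆.≈ 𝐆.ε
      line H zero-sum = sum-ε {F = λ x → sum (λ e → digit e , H x e)} λ x →
        subst (𝐆._≈ 𝐆.ε) (≡.sym (sum-pair digit (H x))) (≡⇒mod d sum-digit , zero-sum x)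
      inj : ∀ p q → valAt p 𝐆.≈ valAt q → p ≡ q
      inj (t , i , e , u , v) (t′ , i′ , e′ , u′ , v′) (p , q) =
        high-injective odd t i e u v t′ i′ e′ u′ v′ (digit-injective e e′ p) q
      rows : ∀ t i u → sum (λ v → sum (λ e → val t i e u v)) 𝐆.≈ 𝐆.ε
      rows t i u = line (λ v e → high t i e u v) (λ v → high-rows t i u v)
      cols : ∀ t j v → sum (λ u → sum (λ e → val t (j ⊟ toℕ e) e u v)) 𝐆.≈ 𝐆.ε
      cols t j v = line (λ u e → high t (j ⊟ toℕ e) e u v) (λ u → high-cols t j u v)

    -- Both coordinates of `direct-sum` are packed into one residue: modulo d only the digit is
    -- visible, and once the digits agree d cancels from what remains.
    cyclic : M⁰S (ℤ/ (d * Q)) (Whole (ℤ/ (d * Q))) (l * k′) (l * s′) (s′ * d) (k′ * d) c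
    cyclic = design inj rows cols
      where
      module 𝐆 = AbelianGroup (ℤ/ (d * Q))
      open MonoidSums 𝐆.commutativeMonoid
      val : Fin c → Fin l → Fin d → Fin k′ → Fin s′ → ℤ
      val t i e u v = digit e ℤ.+ + d ℤ.* high t i e u v
      open CyclicDesign (ℤ/ (d * Q)) l d k′ s′ c d≤l (ℤ/-order (d * Q) {{ℕₚ.m*n≢0 d Q}}) reshape val
      line : ∀ {n} (H : Fin n → Fin d → ℤ) → (∀ x → ℤΣ.sum (H x) ≡[mod Q ] 0ℤ) →
             sum (λ x → sum (λ e → digit e ℤ.+ + d ℤ.* H x e)) 𝐆.≈ 0ℤ
      line H zero-sum = sum-ε {F = λ x → sum (λ e → digit e ℤ.+ + d ℤ.* H x e)} λ x → begin
        sum (λ e → digit e ℤ.+ + d ℤ.* H x e)               ≡⟨ ℤΣ.∑-distrib-+ digit (λ e → + d ℤ.* H x e) ⟩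
        ℤΣ.sum digit ℤ.+ ℤΣ.sum (λ e → + d ℤ.* H x e)       ≡⟨ cong₂ ℤ._+_ sum-digit
            (≡.sym (ℤSum.*-distribˡ-sum (+ d) (H x))) ⟩
        0ℤ ℤ.+ + d ℤ.* ℤΣ.sum (H x)                         ≡⟨ ℤₚ.+-identityˡ _ ⟩
        + d ℤ.* ℤΣ.sum (H x)                                ≈⟨ scale-mod d (ℤΣ.sum (H x)) 0ℤ (zero-sum x) ⟩
        + d ℤ.* 0ℤ                                          ≡⟨ ℤₚ.*-zeroʳ (+ d) ⟩
        0ℤ                                                  ∎
        where open ≈-Reasoning (d * Q)
      drop : ∀ x y a b → (x ℤ.+ + d ℤ.* a) ≡[mod d ] (y ℤ.+ + d ℤ.* b) → x ≡[mod d ] y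
      drop x y a b eq = subst (+ d ℤ∣.∣_) (lemma (+ d) x y a b)
          (ℤ∣.∣m∣n⇒∣m-n eq (ℤ∣.∣m⇒∣m*n (a ℤ.- b) (ℤ∣.∣-refl {+ d})))
        where
        lemma : ∀ d x y a b → x ℤ.+ d ℤ.* a ℤ.- (y ℤ.+ d ℤ.* b) ℤ.- d ℤ.* (a ℤ.- b) ≡ x ℤ.- y
        lemma = ℤRing.solve-∀
      cancel : ∀ x y a b → x ≡ y → (x ℤ.+ + d ℤ.* a) ≡[mod d * Q ] (y ℤ.+ + d ℤ.* b) →
          (+ d ℤ.* a) ≡[mod d * Q ] (+ d ℤ.* b)
      cancel x x a b ≡.refl = subst (+ (d * Q) ℤ∣.∣_) (lemma (+ d) x a b)
        where
        lemma : ∀ d x a b → x ℤ.+ d ℤ.* a ℤ.- (x ℤ.+ d ℤ.* b) ≡ d ℤ.* a ℤ.- d ℤ.* b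
        lemma = ℤRing.solve-∀
      inj : ∀ p q → valAt p 𝐆.≈ valAt q → p ≡ q
      inj (t , i , e , u , v) (t′ , i′ , e′ , u′ , v′) eq =
        high-injective odd t i e u v t′ i′ e′ u′ v′ e≡ (unscale-mod d (high t i e u v) (high t′ i′ e′ u′ v′)
          (cancel (digit e) (digit e′) (high t i e u v) (high t′ i′ e′ u′ v′) (cong digit e≡) eq))
        where
        e≡ : e ≡ e′
        e≡ = digit-injective e e′ (drop (digit e) (digit e′) (high t i e u v) (high t′ i′ e′ u′ v′)
               (weaken-mod (val t i e u v) (val t′ i′ e′ u′ v′) (ℕ∣.m∣m*n {d} Q) eq))
      rows : ∀ t i u → sum (λ v → sum (λ e → val t i e u v)) 𝐆.≈ 𝐆.ε
      rows t i u = line (λ v e → high t i e u v) (λ v → high-rows t i u v)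
      cols : ∀ t j v → sum (λ u → sum (λ e → val t (j ⊟ toℕ e) e u v)) 𝐆.≈ 𝐆.ε
      cols t j v = line (λ u e → high t (j ⊟ toℕ e) e u v) (λ u → high-cols t j u v)

-- Coprime blocks on the diagonal

coprime-cancel : ∀ {m n} → Coprime m n → ∀ x y → (+ n ℤ.* x) ≡[mod m ] (+ n ℤ.* y) → x ≡[mod m ] y
coprime-cancel {m} {n} coprime x y eq = ℤ∣.∣ᵤ⇒∣ (Coprimality.coprime-divisor coprime
  (subst (m ℕ∣.∣_) (ℤₚ.abs-* (+ n) (x ℤ.- y)) (ℤ∣.∣⇒∣ᵤ (subst (+ m ℤ∣.∣_) (lemma (+ n) x y) eq))))
  where
  lemma : ∀ n x y → n ℤ.* x ℤ.- n ℤ.* y ≡ n ℤ.* (x ℤ.- y)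
  lemma = ℤRing.solve-∀

sum-reindex : ∀ {n} (f : Fin n → ℤ) (g : Fin n → Fin n) → (∀ x y → g x ≡ g y → x ≡ y) →
              ℤΣ.sum (f ∘ g) ≡ ℤΣ.sum f
sum-reindex f g inj = ≡.sym (ℤΣ.sum-embed g inj (λ _ → ≡.refl)
  (λ j miss → let x , eq = injective⇒surjective g inj j in ⊥-elim (miss x eq)))

sum-linear₃ : ∀ {n} (f g h : Fin n → ℤ) (A B C : ℤ) →
              ℤΣ.sum f ≡ 0ℤ → ℤΣ.sum g ≡ 0ℤ → ℤΣ.sum h ≡ 0ℤ →
              ℤΣ.sum (λ x → A ℤ.* f x ℤ.+ B ℤ.* g x ℤ.+ C ℤ.* h x) ≡ 0ℤ
sum-linear₃ f g h A B C f0 g0 h0 = begin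
  ℤΣ.sum (λ x → A ℤ.* f x ℤ.+ B ℤ.* g x ℤ.+ C ℤ.* h x)
    ≡⟨ ℤΣ.∑-distrib-+ (λ x → A ℤ.* f x ℤ.+ B ℤ.* g x) (λ x → C ℤ.* h x) ⟩
  ℤΣ.sum (λ x → A ℤ.* f x ℤ.+ B ℤ.* g x) ℤ.+ ℤΣ.sum (λ x → C ℤ.* h x)
    ≡⟨ cong₂ ℤ._+_ (ℤΣ.∑-distrib-+ (λ x → A ℤ.* f x) (λ x → B ℤ.* g x)) (vanish C h h0) ⟩
  ℤΣ.sum (λ x → A ℤ.* f x) ℤ.+ ℤΣ.sum (λ x → B ℤ.* g x) ℤ.+ 0ℤ
    ≡⟨ cong₂ (λ x y → x ℤ.+ y ℤ.+ 0ℤ) (vanish A f f0) (vanish B g g0) ⟩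
  0ℤ ∎
  where
  open ≡.≡-Reasoning
  vanish : ∀ A f → ℤΣ.sum f ≡ 0ℤ → ℤΣ.sum (λ x → A ℤ.* f x) ≡ 0ℤ
  vanish A f f0 = ≡.trans (≡.sym (ℤSum.*-distribˡ-sum A f)) (≡.trans (cong (A ℤ.*_) f0) (ℤₚ.*-zeroʳ A))

-- Only the diagonal blocks are filled; they are k′ × s′ rectangles indexed by
-- W, and the coprimality of k′ and s′ separates the first two summands of val.
module CoprimeBlocks (l k′ s′ c : ℕ) (weightsᵏ : Weights k′) (weightsˢ : Weights s′) (coprime : Coprime k′ s′)
  (1≤l : 1 ≤ l) {{_ : NonZero k′}} {{_ : NonZero s′}} where
  private
    module U = Weights weightsᵏ
    module V = Weights weightsˢ

  Q : ℕ
  Q = l * c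

  -- Modulo k′ an entry reveals, up to the factor s′, exactly this residue. The first summand of
  -- `val` takes its weight here and not at u, so that the weight is already known when v is read
  -- off modulo s′.
  p : Fin k′ → ℤ → Fin k′
  p u y = proj₁ (residue (V.weightAt y ℤ.* U.digit u) k′)

  p≈ : ∀ u y → (+ toℕ (p u y)) ≡[mod k′ ] (V.weightAt y ℤ.* U.digit u)
  p≈ u y = proj₂ (residue (V.weightAt y ℤ.* U.digit u) k′)

  W : Fin c → Fin l → Fin Q
  W t i = combine i t

  val : Fin c → Fin l → Fin 1 → Fin k′ → Fin s′ → ℤ
  val t i _ u v = + k′ ℤ.* (U.w (p u (V.digit v)) ℤ.* V.digit v) ℤ.+ + s′ ℤ.* (V.w v ℤ.* U.digit u)
    ℤ.+ + (k′ * s′) ℤ.* (U.w u ℤ.* V.w v ℤ.* + toℕ (W t i))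

  private
    N : ℕ
    N = k′ * s′ * Q
    instance
      ks≢0 : NonZero (k′ * s′)
      ks≢0 = ℕₚ.m*n≢0 k′ s′

    reshape : c * (l * (1 * (k′ * s′))) ≡ N
    reshape = lemma c l k′ s′
      where
      lemma : ∀ c l k s → c * (l * (1 * (k * s))) ≡ k * s * (l * c)
      lemma = solve-∀

  module _ (odd : Odd N) {{_ : NonZero Q}} where
    private
      odd-Q : Odd Q
      odd-Q = odd-∣ (ℕ∣.n∣m*n (k′ * s′)) odd

      odd-k′ : Odd k′
      odd-k′ = odd-∣ (ℕ∣.∣-trans (ℕ∣.m∣m*n s′) (ℕ∣.m∣m*n Q)) odd

      odd-s′ : Odd s′
      odd-s′ = odd-∣ (ℕ∣.∣-trans (ℕ∣.n∣m*n k′) (ℕ∣.m∣m*n Q)) odd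

      cancel-weight : ∀ y u u′ → (V.weightAt y ℤ.* U.digit u) ≡[mod k′ ] (V.weightAt y ℤ.* U.digit u′) → u ≡ u′
      cancel-weight y u u′ eq = U.digit-injective u u′
        (unit-cancel {V.weightAt y} (U.digit u) (U.digit u′) (V.unit y) odd-k′ eq)

      p-injective : ∀ y u u′ → p u y ≡ p u′ y → u ≡ u′
      p-injective y u u′ eq = cancel-weight y u u′ (begin
        V.weightAt y ℤ.* U.digit u      ≈⟨ p≈ u y ⟨
        + toℕ (p u y)                   ≡⟨ cong (λ z → + toℕ z) eq ⟩
        + toℕ (p u′ y)                  ≈⟨ p≈ u′ y ⟩
        V.weightAt y ℤ.* U.digit u′     ∎)
        where open ≈-Reasoning k′

      -- The twist `p u y` depends on y only through the even function `V.weightAt`, so the first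
      -- summand is odd in the digit y; the other two are multiples of `V.w v`.
      row : ∀ t i u → ℤΣ.sum (λ v → val t i zero u v) ≡ 0ℤ
      row t i u = ≡.trans (ℤΣ.sum-cong λ v → lemma (+ k′) (+ s′) (+ (k′ * s′)) (U.w (p u (V.digit v)) ℤ.* V.digit v)
                             (V.w v) (U.digit u) (U.w u) (+ toℕ (W t i)))
        (sum-linear₃ (λ v → U.w (p u (V.digit v)) ℤ.* V.digit v) V.w V.w
          (+ k′) (+ s′ ℤ.* U.digit u) (+ (k′ * s′) ℤ.* (U.w u ℤ.* + toℕ (W t i)))
          (V.sum-antisymmetric (λ y → U.w (p u y) ℤ.* y) flip) V.sum-w V.sum-w)
        where
        lemma : ∀ k s ks x a u A W → k ℤ.* x ℤ.+ s ℤ.* (a ℤ.* u) ℤ.+ ks ℤ.* (A ℤ.* a ℤ.* W)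
                ≡ k ℤ.* x ℤ.+ s ℤ.* u ℤ.* a ℤ.+ ks ℤ.* (A ℤ.* W) ℤ.* a
        lemma = ℤRing.solve-∀
        flip : ∀ y → U.w (p u (- y)) ℤ.* (- y) ≡ - (U.w (p u y) ℤ.* y)
        flip y = ≡.trans (cong (λ z → U.w (proj₁ (residue (z ℤ.* U.digit u) k′)) ℤ.* (- y)) (V.even y))
          (≡.sym (ℤₚ.neg-distribʳ-* (U.w (p u y)) y))

      -- For fixed v the twist permutes the row indices, so the twisted weights still sum to zero;
      -- the other two summands are multiples of `U.digit u` and `U.w u`.
      col : ∀ t i v → ℤΣ.sum (λ u → val t i zero u v) ≡ 0ℤ
      col t i v = ≡.trans (ℤΣ.sum-cong λ u → lemma (+ k′) (+ s′) (+ (k′ * s′)) (U.w (p u (V.digit v))) (V.digit v)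
                             (V.w v) (U.digit u) (U.w u) (+ toℕ (W t i)))
        (sum-linear₃ (λ u → U.w (p u (V.digit v))) U.digit U.w
          (+ k′ ℤ.* V.digit v) (+ s′ ℤ.* V.w v) (+ (k′ * s′) ℤ.* (V.w v ℤ.* + toℕ (W t i)))
          (≡.trans (sum-reindex U.w (λ u → p u (V.digit v)) (p-injective (V.digit v))) U.sum-w) U.sum-digit
              U.sum-w)
        where
        lemma : ∀ k s ks x v a u A W → k ℤ.* (x ℤ.* v) ℤ.+ s ℤ.* (a ℤ.* u) ℤ.+ ks ℤ.* (A ℤ.* a ℤ.* W)
                ≡ k ℤ.* v ℤ.* x ℤ.+ s ℤ.* a ℤ.* u ℤ.+ ks ℤ.* (a ℤ.* W) ℤ.* A
        lemma = ℤRing.solve-∀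

      open MonoidSums (AbelianGroup.commutativeMonoid (ℤ/ N)) using (sum; sum-cong)
      open CyclicDesign (ℤ/ N) l 1 k′ s′ c 1≤l (ℤ/-order N {{ℕₚ.m*n≢0 (k′ * s′) Q}}) reshape val

      rows : ∀ t i u → sum (λ v → sum (λ e → val t i e u v)) ≡[mod N ] 0ℤ
      rows t i u = ≡⇒mod N (≡.trans (ℤΣ.sum-cong λ v → ℤₚ.+-identityʳ (val t i zero u v)) (row t i u))

      cols : ∀ t j v → sum (λ u → sum (λ e → val t (j ⊟ toℕ e) e u v)) ≡[mod N ] 0ℤ
      cols t j v = ≡⇒mod N (≡.trans (ℤΣ.sum-cong λ u → ℤₚ.+-identityʳ (val t (j ⊟ 0) zero u v)) (col t (j ⊟ 0) v))

      extract : ∀ m k s x y z x′ y′ z′ → + m ℤ∣.∣ k →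
        (k ℤ.* x ℤ.+ s ℤ.* y ℤ.+ k ℤ.* s ℤ.* z) ≡[mod m ] (k ℤ.* x′ ℤ.+ s ℤ.* y′ ℤ.+ k ℤ.* s ℤ.* z′) →
        (s ℤ.* y) ≡[mod m ] (s ℤ.* y′)
      extract m k s x y z x′ y′ z′ m∣k eq = subst (+ m ℤ∣.∣_) (lemma k s x y z x′ y′ z′)
        (ℤ∣.∣m∣n⇒∣m-n eq (ℤ∣.∣m⇒∣m*n (x ℤ.- x′ ℤ.+ s ℤ.* (z ℤ.- z′)) m∣k))
        where
        lemma : ∀ k s x y z x′ y′ z′ → (k ℤ.* x ℤ.+ s ℤ.* y ℤ.+ k ℤ.* s ℤ.* z ℤ.- (k ℤ.* x′ ℤ.+ s ℤ.* y′ ℤ.+ k ℤ.* s ℤ.* z′))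
                ℤ.- k ℤ.* (x ℤ.- x′ ℤ.+ s ℤ.* (z ℤ.- z′)) ≡ s ℤ.* y ℤ.- s ℤ.* y′
        lemma = ℤRing.solve-∀

      swap : ∀ k s x y z x′ y′ z′ → k ℤ.* x ℤ.+ s ℤ.* y ℤ.+ k ℤ.* s ℤ.* z ℤ.-
          (k ℤ.* x′ ℤ.+ s ℤ.* y′ ℤ.+ k ℤ.* s ℤ.* z′)
             ≡ s ℤ.* y ℤ.+ k ℤ.* x ℤ.+ s ℤ.* k ℤ.* z ℤ.- (s ℤ.* y′ ℤ.+ k ℤ.* x′ ℤ.+ s ℤ.* k ℤ.* z′)
      swap = ℤRing.solve-∀

      last : ∀ m x y z z′ → (x ℤ.+ y ℤ.+ z) ≡[mod m ] (x ℤ.+ y ℤ.+ z′) → z ≡[mod m ] z′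
      last m x y z z′ = subst (+ m ℤ∣.∣_) (lemma x y z z′)
        where
        lemma : ∀ x y z z′ → x ℤ.+ y ℤ.+ z ℤ.- (x ℤ.+ y ℤ.+ z′) ≡ z ℤ.- z′
        lemma = ℤRing.solve-∀

      module _ (t : Fin c) (i : Fin l) (u : Fin k′) (v : Fin s′) (t′ : Fin c) (i′ : Fin l) (u′ : Fin k′)
          (v′ : Fin s′) where
        x = U.w (p u (V.digit v)) ℤ.* V.digit v
        y = V.w v ℤ.* U.digit u
        z = U.w u ℤ.* V.w v ℤ.* + toℕ (W t i)
        x′ = U.w (p u′ (V.digit v′)) ℤ.* V.digit v′
        y′ = V.w v′ ℤ.* U.digit u′
        z′ = U.w u′ ℤ.* V.w v′ ℤ.* + toℕ (W t′ i′)

        module _ (eq : val t i zero u v ≡[mod N ] val t′ i′ zero u′ v′) where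
          eq′ : ∀ {m} → m ℕ∣.∣ N → (+ k′ ℤ.* x ℤ.+ + s′ ℤ.* y ℤ.+ + k′ ℤ.* + s′ ℤ.* z) ≡[mod m ]
                                   (+ k′ ℤ.* x′ ℤ.+ + s′ ℤ.* y′ ℤ.+ + k′ ℤ.* + s′ ℤ.* z′)
          eq′ m∣N = weaken-mod (+ k′ ℤ.* x ℤ.+ + s′ ℤ.* y ℤ.+ + k′ ℤ.* + s′ ℤ.* z)
              (+ k′ ℤ.* x′ ℤ.+ + s′ ℤ.* y′ ℤ.+ + k′ ℤ.* + s′ ℤ.* z′) m∣N
            (subst (λ r → (+ k′ ℤ.* x ℤ.+ + s′ ℤ.* y ℤ.+ r ℤ.* z) ≡[mod N ] (+ k′ ℤ.* x′ ℤ.+ + s′ ℤ.* y′ ℤ.+ r ℤ.* z′))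
              (ℤₚ.pos-* k′ s′) eq)

          -- Modulo k′ only the second summand of `val` survives, and s′ cancels by coprimality.
          p≡ : p u (V.digit v) ≡ p u′ (V.digit v′)
          p≡ = Fin-residue-injective _ _ (begin
            + toℕ (p u (V.digit v))    ≈⟨ p≈ u (V.digit v) ⟩
            y                          ≈⟨ coprime-cancel coprime y y′ (extract k′ (+ k′) (+ s′) x y z x′ y′ z′
                                            ℤ∣.∣-refl (eq′ (ℕ∣.∣-trans (ℕ∣.m∣m*n s′) (ℕ∣.m∣m*n Q)))) ⟩
            y′                         ≈⟨ p≈ u′ (V.digit v′) ⟨
            + toℕ (p u′ (V.digit v′))  ∎)
            where open ≈-Reasoning k′

          -- Modulo s′ only the first summand survives. By `p≡` both sides carry the same weight,
          -- which is a unit and cancels.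
          v≡ : v ≡ v′
          v≡ = V.digit-injective v v′
            (unit-cancel {U.w (p u (V.digit v))} (V.digit v) (V.digit v′) (U.unit (U.digit (p u (V.digit v)))) odd-s′
              (subst (λ q → x ≡[mod s′ ] (U.w q ℤ.* V.digit v′)) (≡.sym p≡)
                (coprime-cancel (Coprimality.sym coprime) x x′ (extract s′ (+ s′) (+ k′) y x z y′ x′ z′ ℤ∣.∣-refl
                  (subst (+ s′ ℤ∣.∣_) (swap (+ k′) (+ s′) x y z x′ y′ z′)
                    (eq′ (ℕ∣.∣-trans (ℕ∣.n∣m*n k′) (ℕ∣.m∣m*n Q))))))))

      inj : ∀ p q → valAt p ≡[mod N ] valAt q → p ≡ q
      inj (t , i , zero , u , v) (t′ , i′ , zero , u′ , v′) eq = glue u≡ (v≡ t i u v t′ i′ u′ v′ eq)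
        (Fin-residue-injective (W t i) (W t′ i′)
          (unit-cancel {U.w u ℤ.* V.w v} (+ toℕ (W t i)) (+ toℕ (W t′ i′))
            (*-unit {U.w u} {V.w v} (U.unit (U.digit u)) (V.unit (V.digit v))) odd-Q
            (unscale-mod (k′ * s′) (U.w u ℤ.* V.w v ℤ.* + toℕ (W t i)) (U.w u ℤ.* V.w v ℤ.* + toℕ (W t′ i′))
              (last N (+ k′ ℤ.* x t i u v t′ i′ u v) (+ s′ ℤ.* y t i u v t′ i′ u v)
                (+ (k′ * s′) ℤ.* z t i u v t′ i′ u v) (+ (k′ * s′) ℤ.* z′ t i u v t′ i′ u v)
                (≡.subst₂ (λ u′ v′ → val t i zero u v ≡[mod N ] val t′ i′ zero u′ v′) (≡.sym u≡) (≡.sym (v≡ t i u v t′ i′ u′ v′ eq)) eq)))))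
        where
        u≡ : u ≡ u′
        u≡ = p-injective (V.digit v) u u′ (≡.trans (p≡ t i u v t′ i′ u′ v′ eq)
               (cong (λ v → p u′ (V.digit v)) (≡.sym (v≡ t i u v t′ i′ u′ v′ eq))))
        glue : u ≡ u′ → v ≡ v′ → W t i ≡ W t′ i′ → (t , i , zero , u , v) ≡ (t′ , i′ , zero , u′ , v′)
        glue ≡.refl ≡.refl eq with ≡.refl , ≡.refl ← Finₚ.combine-injective i t i′ t′ eq = ≡.refl

    cyclic : M⁰S (ℤ/ N) (Whole (ℤ/ N)) (l * k′) (l * s′) (s′ * 1) (k′ * 1) c
    cyclic = design inj rows cols

-- Parts (1) and (3)

-- The contents of all arrays are added up twice: row by row they give zero, and by `appears` and
-- `once` they are a rearrangement of `Ω`. Empty cells count as `ε`.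
total-zero : ∀ {a ℓ p} (G : AbelianGroup a ℓ) (let open AbelianGroup G) {Ω : Carrier → Set p} {m n s k c} →
  M⁰S G Ω m n s k c → ∀ {K} (e : Fin K → Carrier) → (∀ i j → e i ≈ e j → i ≡ j) → (∀ i → Ω (e i)) →
  (∀ x → Ω x → ∃[ i ] e i ≈ x) → MonoidSums.sum commutativeMonoid e ≈ ε
total-zero G {Ω} {m} {n} {s} {k} {c} A {K} e e-injective e∈Ω e-exhaustive =
    trans (sym (sum-embed place place-injective on off))
  (trans (sum-combine c {m * n} entry) (sum-ε λ t → trans (sum-combine m {n} (entry ∘ combine t)) (sum-ε λ r →
    trans (sum-cong λ q → reflexive (cong (maybe id ε) (unflatten t r q)))
          (trans (sym (lineSum≈sum (arrays t r))) (rowSum t r)))))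
  where
  open AbelianGroup G
  open Lines G
  open M⁰S A
  flat : Fin c × Fin m × Fin n → Fin (c * (m * n))
  flat (t , r , q) = combine t (combine r q)
  flat-injective : ∀ x y → flat x ≡ flat y → x ≡ y
  flat-injective (t , r , q) (t′ , r′ , q′) eq
    with ≡.refl , eq₁ ← Finₚ.combine-injective t (combine r q) t′ (combine r′ q′) eq
    with ≡.refl , ≡.refl ← Finₚ.combine-injective r q r′ q′ eq₁ = ≡.refl
  unflat : Fin (c * (m * n)) → Fin c × Fin m × Fin n
  unflat x = proj₁ (remQuot {c} (m * n) x) , remQuot {m} n (proj₂ (remQuot {c} (m * n) x))
  flat-unflat : ∀ x → flat (unflat x) ≡ x
  flat-unflat x = ≡.trans (cong (combine (proj₁ (remQuot {c} (m * n) x))) (Finₚ.combine-remQuot {m} n _))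
    (Finₚ.combine-remQuot {c} (m * n) x)
  at : Fin c × Fin m × Fin n → Maybe Carrier
  at (t , r , q) = arrays t r q
  entry : Fin (c * (m * n)) → Carrier
  entry x = maybe id ε (at (unflat x))
  unflatten : ∀ t r q → at (unflat (flat (t , r , q))) ≡ arrays t r q
  unflatten t r q = cong at (flat-injective _ _ (flat-unflat (flat (t , r , q))))
  place : Fin K → Fin (c * (m * n))
  place i = flat (proj₁ (appears (e i) (e∈Ω i)))
  contents : ∀ i → Contains G arrays (proj₁ (appears (e i) (e∈Ω i))) (e i)
  contents i = proj₂ (appears (e i) (e∈Ω i))
  same : ∀ {pos} {x y} → Contains G arrays pos x → Contains G arrays pos y → x ≈ y
  same (u , eq , p) (v , eq′ , q) with ≡.refl ← ≡.trans (≡.sym eq) eq′ = trans (sym p) q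
  place-injective : ∀ i j → place i ≡ place j → i ≡ j
  place-injective i j eq with flat-injective _ _ eq | contents i | contents j
  ... | eq′ | ci | cj rewrite eq′ = e-injective i j (same ci cj)
  on : ∀ i → entry (place i) ≈ e i
  on i with contents i
  ... | y , eq , y≈ = trans (reflexive (≡.trans (cong (maybe id ε) (unflatten _ _ _)) (cong (maybe id ε) eq)))
      y≈
  off : ∀ x → (∀ i → place i ≢ x) → entry x ≈ ε
  off x miss = vacant (unflat x) (flat-unflat x)
    where
    vacant : ∀ pos → flat pos ≡ x → maybe id ε (at pos) ≈ ε
    vacant pos@(t , r , q) x≡ with arrays t r q in eq
    ... | nothing = refl
    ... | just y with i , e≈y ← e-exhaustive y (entries∈Ω t r q y eq) = ⊥-elim (miss i
          (≡.trans (cong flat (once (e i) _ pos (contents i) (y , eq , sym e≈y))) x≡))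

gauss : ∀ n → + 2 ℤ.* ℤΣ.sum {n} (λ i → + toℕ i) ≡ + n ℤ.* (+ n ℤ.- + 1)
gauss zero = ≡.refl
gauss (suc n) = begin
  + 2 ℤ.* ℤΣ.sum {suc n} (λ i → + toℕ i)
    ≡⟨ cong (+ 2 ℤ.*_) (ℤΣ.sum-init-last {n} (λ i → + toℕ i)) ⟩
  + 2 ℤ.* (ℤΣ.sum {n} (λ i → + toℕ (inject₁ i)) ℤ.+ + toℕ (fromℕ n))
    ≡⟨ cong₂ (λ x y → + 2 ℤ.* (x ℤ.+ + y)) (ℤΣ.sum-cong {n} (λ i → cong +_ (Finₚ.toℕ-inject₁ i))) (toℕ-last n) ⟩
  + 2 ℤ.* (S ℤ.+ + n)            ≡⟨ lemma₁ S (+ n) ⟩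
  + 2 ℤ.* S ℤ.+ + 2 ℤ.* + n      ≡⟨ cong (ℤ._+ + 2 ℤ.* + n) (gauss n) ⟩
  + n ℤ.* (+ n ℤ.- + 1) ℤ.+ + 2 ℤ.* + n   ≡⟨ lemma₂ (+ n) ⟩
  (+ 1 ℤ.+ + n) ℤ.* (+ 1 ℤ.+ + n ℤ.- + 1) ∎
  where
  open ≡.≡-Reasoning
  S = ℤΣ.sum {n} (λ i → + toℕ i)
  lemma₁ : ∀ s n → + 2 ℤ.* (s ℤ.+ n) ≡ + 2 ℤ.* s ℤ.+ + 2 ℤ.* n
  lemma₁ = ℤRing.solve-∀
  lemma₂ : ∀ n → n ℤ.* (n ℤ.- + 1) ℤ.+ + 2 ℤ.* n ≡ (+ 1 ℤ.+ n) ℤ.* (+ 1 ℤ.+ n ℤ.- + 1)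
  lemma₂ = ℤRing.solve-∀

-- If the sum of the residues modulo an even M were x M, Gauss's formula would give 2x = M - 1,
-- which is odd.
sum-residues≉0 : ∀ N → 2 ℕ∣.∣ suc N → ¬ (ℤΣ.sum {suc N} (λ i → + toℕ i) ≡[mod suc N ] 0ℤ)
sum-residues≉0 N (ℕ∣.divides q N≡) eq = 2∤1 (ℤ∣.∣⇒∣ᵤ (ℤ∣.divides (+ q ℤ.- x) 1≡))
  where
  M = + suc N
  S = ℤΣ.sum {suc N} (λ i → + toℕ i)
  x = ℤ∣._∣_.quotient eq
  2∤1 : ¬ (2 ℕ∣.∣ 1)
  2∤1 2∣1 with () ← ℕ∣.∣1⇒≡1 2∣1
  M*2x : M ℤ.* (+ 2 ℤ.* x) ≡ M ℤ.* (M ℤ.- + 1)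
  M*2x = ≡.trans (lemma M x) (≡.trans (cong (+ 2 ℤ.*_) (≡.sym (≡.trans (≡.sym (ℤₚ.+-identityʳ S)) (ℤ∣._∣_.equality eq)))) (gauss (suc N)))
    where
    lemma : ∀ m x → m ℤ.* (+ 2 ℤ.* x) ≡ + 2 ℤ.* (x ℤ.* m)
    lemma = ℤRing.solve-∀
  1≡ : + 1 ≡ (+ q ℤ.- x) ℤ.* + 2
  1≡ = ≡.trans (≡.trans (lemma₁ M) (cong (λ z → M ℤ.- z) (≡.sym (ℤₚ.*-cancelˡ-≡ M (+ 2 ℤ.* x) (M ℤ.- + 1) M*2x))))
    (≡.trans (cong (ℤ._- + 2 ℤ.* x) (≡.trans (cong +_ N≡) (ℤₚ.pos-* q 2))) (lemma₂ (+ q) x))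
    where
    lemma₁ : ∀ m → + 1 ≡ m ℤ.- (m ℤ.- + 1)
    lemma₁ = ℤRing.solve-∀
    lemma₂ : ∀ q x → q ℤ.* + 2 ℤ.- + 2 ℤ.* x ≡ (q ℤ.- x) ℤ.* + 2
    lemma₂ = ℤRing.solve-∀

cyclic⇒odd : ∀ {m n s k c} N .{{_ : NonZero N}} → M⁰S (ℤ/ N) (Whole (ℤ/ N)) m n s k c → Odd N
cyclic⇒odd (suc N) A 2∣N = sum-residues≉0 N 2∣N
  (total-zero (ℤ/ (suc N)) A (λ i → + toℕ i) Fin-residue-injective (λ _ → tt) (λ x _ → residue x (suc N)))

odd⇒width : ∀ {n} → Odd n → ∃[ h ] n ≡ width h
odd⇒width odd with h , eq ← odd⇒1+2* odd = h , ≡.trans eq (≡.sym (width≡ h))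

odd⇒nonZero : ∀ {n} → Odd n → NonZero n
odd⇒nonZero {zero} odd = ⊥-elim (odd (2 ℕ∣.∣0))
odd⇒nonZero {suc n} odd = _

record Shape (m n s k d : ℕ) : Set where
  field
    {s′ k′ l} : ℕ
    s≡ : s ≡ s′ * d
    k≡ : k ≡ k′ * d
    m≡ : m ≡ l * k′
    n≡ : n ≡ l * s′
    coprime : Coprime s′ k′
    d≤l : d ≤ l

-- Cancelling d from `m * s ≡ n * k` leaves m s′ = n k′. Coprimality makes s′ divide n, the quotient
-- l then fits m as well, and d ≤ l is s ≤ n divided by s′.
shape : ∀ {m n s k} → 2 ≤ s → s ≤ n → m * s ≡ n * k → Shape m n s k (gcd s k)
shape {m} {n} {s} {k} 2≤s s≤n ms≡nk
  with ℕ∣.divides s′ s≡ ← GCD.gcd[m,n]∣m s k | ℕ∣.divides k′ k≡ ← GCD.gcd[m,n]∣n s k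
  = record { s≡ = s≡ ; k≡ = k≡ ; m≡ = m≡ ; n≡ = n≡ ; coprime = coprime ; d≤l = d≤l }
  where
  d = gcd s k
  s≢0 : NonZero s
  s≢0 = ℕ.>-nonZero (ℕₚ.<-≤-trans (s≤s z≤n) 2≤s)
  s′d≢0 : NonZero (s′ * d)
  s′d≢0 = subst NonZero s≡ s≢0
  instance
    d≢0 : NonZero d
    d≢0 = ℕₚ.m*n≢0⇒n≢0 s′ {{s′d≢0}}
    s′≢0 : NonZero s′
    s′≢0 = ℕₚ.m*n≢0⇒m≢0 s′ {{s′d≢0}}
  coprime : Coprime s′ k′
  coprime {i} (i∣s′ , i∣k′) = ℕ∣.∣1⇒≡1 (ℕ∣.*-cancelʳ-∣ d (subst (i * d ℕ∣.∣_) (≡.sym (ℕₚ.*-identityˡ d))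
    (GCD.gcd-greatest (subst (i * d ℕ∣.∣_) (≡.sym s≡) (ℕ∣.*-monoˡ-∣ d i∣s′))
                      (subst (i * d ℕ∣.∣_) (≡.sym k≡) (ℕ∣.*-monoˡ-∣ d i∣k′)))))
  ms′≡nk′ : m * s′ ≡ n * k′
  ms′≡nk′ = ℕₚ.*-cancelʳ-≡ _ _ d (begin
    m * s′ * d    ≡⟨ ℕₚ.*-assoc m s′ d ⟩
    m * (s′ * d)  ≡⟨ cong (m *_) s≡ ⟨
    m * s         ≡⟨ ms≡nk ⟩
    n * k         ≡⟨ cong (n *_) k≡ ⟩
    n * (k′ * d)  ≡⟨ ℕₚ.*-assoc n k′ d ⟨
    n * k′ * d    ∎)
    where open ≡.≡-Reasoning
  s′∣n : s′ ℕ∣.∣ n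
  s′∣n = Coprimality.coprime-divisor coprime (ℕ∣.divides m (≡.trans (ℕₚ.*-comm k′ n) (≡.sym ms′≡nk′)))
  l = ℕ∣._∣_.quotient s′∣n
  n≡ : n ≡ l * s′
  n≡ = ℕ∣._∣_.equality s′∣n
  m≡ : m ≡ l * k′
  m≡ = ℕₚ.*-cancelʳ-≡ _ _ s′ (≡.trans ms′≡nk′ (≡.trans (cong (_* k′) n≡) (lemma l s′ k′)))
    where
    lemma : ∀ l s k → l * s * k ≡ l * k * s
    lemma = solve-∀
  d≤l : d ≤ l
  d≤l = ℕₚ.*-cancelʳ-≤ d l s′ (ℕₚ.≤-trans (ℕₚ.≤-reflexive (≡.trans (ℕₚ.*-comm d s′) (≡.sym s≡)))
          (ℕₚ.≤-trans s≤n (ℕₚ.≤-reflexive n≡)))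

-- An odd d is 1 or at least 3, and in the second case weights for d exist. If d = 1, then s′ = s
-- and k′ = k are odd and at least 2, hence at least 3, and weights exist for both sides of a block.
cyclic-exists : ∀ {m n s k d c} → Shape m n s k d → 2 ≤ s → 2 ≤ k → Odd (n * k * c) →
                M⁰S (ℤ/ (n * k * c)) (Whole (ℤ/ (n * k * c))) m n s k c
cyclic-exists {c = c}
  record { s′ = s′ ; k′ = k′ ; l = l ; s≡ = ≡.refl ; k≡ = ≡.refl ; m≡ = ≡.refl ; n≡ = ≡.refl ; coprime = coprime ; d≤l = d≤l }
  2≤s 2≤k odd
  with odd⇒width (odd-∣ (ℕ∣.∣-trans (ℕ∣.n∣m*n k′) (ℕ∣.∣-trans (ℕ∣.n∣m*n (l * s′)) (ℕ∣.m∣m*n c))) odd)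
... | suc h , ≡.refl = subst (λ N → M⁰S (ℤ/ N) (Whole (ℤ/ N)) (l * k′) (l * s′) (s′ * width (suc h)) (k′ * width (suc h)) c)
        (lemma l k′ s′ c (width (suc h)))
        (OddDiagonals.cyclic l _ k′ s′ c (weights h) d≤l odd-Q {{odd⇒nonZero odd-Q}})
  where
  lemma : ∀ l k s c d → d * (l * (c * (k * s))) ≡ l * s * (k * d) * c
  lemma = solve-∀
  odd-Q : Odd (l * (c * (k′ * s′)))
  odd-Q = odd-∣ (ℕ∣.∣-trans (ℕ∣.n∣m*n (width (suc h))) (ℕ∣.∣-reflexive (lemma l k′ s′ c (width (suc h))))) odd
... | zero , ≡.refl
  with odd⇒width {s′} (odd-∣ (ℕ∣.∣-trans (ℕ∣.n∣m*n l) (ℕ∣.∣-trans (ℕ∣.m∣m*n (k′ * 1)) (ℕ∣.m∣m*n c))) odd)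
     | odd⇒width {k′} (odd-∣ (ℕ∣.∣-trans (ℕ∣.m∣m*n 1) (ℕ∣.∣-trans (ℕ∣.n∣m*n (l * s′)) (ℕ∣.m∣m*n c))) odd)
... | zero , ≡.refl | _ = ⊥-elim (ℕₚ.1+n≰n 2≤s)
... | suc b , ≡.refl | zero , ≡.refl = ⊥-elim (ℕₚ.1+n≰n 2≤k)
... | suc b , ≡.refl | suc a , ≡.refl =
  subst (λ N → M⁰S (ℤ/ N) (Whole (ℤ/ N)) (l * κ) (l * σ) (σ * 1) (κ * 1) c) (lemma l κ σ c)
    (CoprimeBlocks.cyclic l _ _ c (weights a) (weights b) (Coprimality.sym coprime) d≤l
      (subst Odd (≡.sym (lemma l κ σ c)) odd) {{odd⇒nonZero odd-Q}})
  where
  κ = width (suc a)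
  σ = width (suc b)
  lemma : ∀ l k s c → k * s * (l * c) ≡ l * s * (k * 1) * c
  lemma = solve-∀
  odd-Q : Odd (l * c)
  odd-Q = odd-∣ (ℕ∣.∣-trans (ℕ∣.n∣m*n (κ * σ)) (ℕ∣.∣-reflexive (lemma l κ σ c))) odd

direct-sum-exists : ∀ {m n s k d} → Shape m n s k d → Odd (n * k) → d ≢ 1 →
                    ∀ q → d * q ≡ n * k → M⁰ (ℤ/ d ⊕ ℤ/ q) (Whole (ℤ/ d ⊕ ℤ/ q)) m n s k
direct-sum-exists record { s′ = s′ ; k′ = k′ ; l = l ; s≡ = ≡.refl ; k≡ = ≡.refl ; m≡ = ≡.refl ; n≡ = ≡.refl ; d≤l = d≤l }
  odd d≢1 q dq≡nk
  with odd⇒width (odd-∣ (ℕ∣.∣-trans (ℕ∣.n∣m*n k′) (ℕ∣.n∣m*n (l * s′))) odd)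
... | zero , ≡.refl = ⊥-elim (d≢1 ≡.refl)
... | suc h , ≡.refl = subst (λ q → M⁰ (ℤ/ w ⊕ ℤ/ q) (Whole (ℤ/ w ⊕ ℤ/ q)) (l * k′) (l * s′) (s′ * w) (k′ * w)) Q≡q
        (OddDiagonals.direct-sum l _ k′ s′ 1 (weights h) d≤l odd-Q {{odd⇒nonZero odd-Q}})
  where
  w = width (suc h)
  lemma : ∀ l k s d → d * (l * (1 * (k * s))) ≡ l * s * (k * d)
  lemma = solve-∀
  Q≡q : l * (1 * (k′ * s′)) ≡ q
  Q≡q = ℕₚ.*-cancelˡ-≡ _ _ w (≡.trans (lemma l k′ s′ w) (≡.sym dq≡nk))
  odd-Q : Odd (l * (1 * (k′ * s′)))
  odd-Q = odd-∣ (ℕ∣.∣-trans (ℕ∣.n∣m*n w) (ℕ∣.∣-reflexive (lemma l k′ s′ w))) odd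

-- Finite abelian groups with several involutions

infixl 6 _:+_
infix 7 :-_

data GroupExpr (n : ℕ) : Set where
  var  : Fin n → GroupExpr n
  :0   : GroupExpr n
  _:+_ : GroupExpr n → GroupExpr n → GroupExpr n
  :-_  : GroupExpr n → GroupExpr n

pattern v₀ = var 0F
pattern v₁ = var 1F
pattern v₂ = var 2F
pattern v₃ = var 3F
pattern v₄ = var 4F
pattern v₅ = var 5F

module GroupSolver {a ℓ} (G : AbelianGroup a ℓ) where
  open AbelianGroup G
  open import Algebra.Properties.Group group using (∙-cancelʳ)
  open import Algebra.Properties.CommutativeSemigroup commutativeSemigroup using (interchange)
  private module S = CommutativeMonoidNormal commutativeMonoid

  ⟦_⟧ : ∀ {n} → GroupExpr n → Vec Carrier n → Carrier
  ⟦ var i ⟧ ρ  = Vec.lookup ρ i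
  ⟦ :0 ⟧ ρ     = ε
  ⟦ e :+ f ⟧ ρ = ⟦ e ⟧ ρ ∙ ⟦ f ⟧ ρ
  ⟦ :- e ⟧ ρ   = ⟦ e ⟧ ρ ⁻¹

  private
    positive negative : ∀ {n} → GroupExpr n → S.Expr n
    positive (var i)  = S.var i
    positive :0       = S.id
    positive (e :+ f) = positive e S.⊕ positive f
    positive (:- e)   = negative e
    negative (var i)  = S.id
    negative :0       = S.id
    negative (e :+ f) = negative e S.⊕ negative f
    negative (:- e)   = positive e

    split : ∀ {n} (e : GroupExpr n) ρ → ⟦ e ⟧ ρ ∙ S.⟦ negative e ⟧ ρ ≈ S.⟦ positive e ⟧ ρ
    split (var i) ρ  = identityʳ _
    split :0 ρ       = identityʳ _
    split (e :+ f) ρ = trans (interchange _ _ _ _) (∙-cong (split e ρ) (split f ρ))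
    split (:- e) ρ   = trans (∙-congˡ (sym (split e ρ)))
      (trans (sym (assoc _ _ _)) (trans (∙-congʳ (inverseˡ _)) (identityˡ _)))

  -- By `split` an expression plus its negative part equals its positive part. Moving the negative
  -- parts across turns a group identity into one of commutative monoids, which normal forms decide.
  solve : ∀ {n} (ρ : Vec Carrier n) (e f : GroupExpr n) →
          {True (S.normalise (positive e S.⊕ negative f) S.≟ S.normalise (positive f S.⊕ negative e))} →
          ⟦ e ⟧ ρ ≈ ⟦ f ⟧ ρ
  solve ρ e f {eq} = ∙-cancelʳ (S.⟦ negative e ⟧ ρ ∙ S.⟦ negative f ⟧ ρ) _ _ (begin
    ⟦ e ⟧ ρ ∙ (S.⟦ negative e ⟧ ρ ∙ S.⟦ negative f ⟧ ρ)  ≈⟨ assoc _ _ _ ⟨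
    ⟦ e ⟧ ρ ∙ S.⟦ negative e ⟧ ρ ∙ S.⟦ negative f ⟧ ρ    ≈⟨ ∙-congʳ (split e ρ) ⟩
    S.⟦ positive e S.⊕ negative f ⟧ ρ                      ≈⟨ S.correct (positive e S.⊕ negative f) ρ ⟨
    S.⟦ S.normalise (positive e S.⊕ negative f) ⟧⇓ ρ       ≡⟨ cong (λ N → S.⟦ N ⟧⇓ ρ) (toWitness eq) ⟩
    S.⟦ S.normalise (positive f S.⊕ negative e) ⟧⇓ ρ       ≈⟨ S.correct (positive f S.⊕ negative e) ρ ⟩
    S.⟦ positive f ⟧ ρ ∙ S.⟦ negative e ⟧ ρ              ≈⟨ ∙-congʳ (split f ρ) ⟨
    ⟦ f ⟧ ρ ∙ S.⟦ negative f ⟧ ρ ∙ S.⟦ negative e ⟧ ρ    ≈⟨ assoc _ _ _ ⟩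
    ⟦ f ⟧ ρ ∙ (S.⟦ negative f ⟧ ρ ∙ S.⟦ negative e ⟧ ρ)  ≈⟨ ∙-congˡ (comm _ _) ⟩
    ⟦ f ⟧ ρ ∙ (S.⟦ negative e ⟧ ρ ∙ S.⟦ negative f ⟧ ρ)  ∎)
    where open SetoidReasoning setoid

  -- Derives e ≈ f from a hypothesis p ≈ q with e - f = p - q.
  linear : ∀ {n} (ρ : Vec Carrier n) (e f p q : GroupExpr n) →
           {True (S.normalise (positive (e :+ q) S.⊕ negative (f :+ p)) S.≟ S.normalise (positive (f :+ p) S.⊕ negative (e :+ q)))} →
           ⟦ p ⟧ ρ ≈ ⟦ q ⟧ ρ → ⟦ e ⟧ ρ ≈ ⟦ f ⟧ ρ
  linear ρ e f p q {eq} p≈q = ∙-cancelʳ (⟦ q ⟧ ρ) _ _ (trans (solve ρ (e :+ q) (f :+ p) {eq}) (∙-congˡ p≈q))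

record Enumeration {N p} (P : Fin N → Set p) : Set p where
  field
    {size} : ℕ
    at : Fin size → Fin N
    at-injective : ∀ i j → at i ≡ at j → i ≡ j
    holds : ∀ i → P (at i)
    complete : ∀ j → P j → ∃[ i ] at i ≡ j

enumerate : ∀ {N p} {P : Fin N → Set p} → (∀ i → Dec (P i)) → Enumeration P
enumerate {zero} P? = record { size = 0 ; at = λ () ; at-injective = λ () ; holds = λ () ; complete = λ () }
enumerate {suc N} {P = P} P? with P? zero | enumerate (P? ∘ suc)
... | no ¬p | rest = record
  { at = suc ∘ R.at
  ; at-injective = λ i j eq → R.at-injective i j (Finₚ.suc-injective eq)
  ; holds = R.holds
  ; complete = λ { zero p → ⊥-elim (¬p p) ; (suc j) p → let i , eq = R.complete j p in i , cong suc eq } }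
  where module R = Enumeration rest
... | yes p | rest = record
  { at = at ; at-injective = at-injective ; holds = λ { zero → p ; (suc i) → R.holds i } ; complete = complete }
  where
  module R = Enumeration rest
  at : Fin (suc R.size) → Fin (suc N)
  at zero = zero
  at (suc i) = suc (R.at i)
  at-injective : ∀ i j → at i ≡ at j → i ≡ j
  at-injective zero zero _ = ≡.refl
  at-injective (suc i) (suc j) eq = cong suc (R.at-injective i j (Finₚ.suc-injective eq))
  complete : ∀ j → P j → ∃[ i ] at i ≡ j
  complete zero _ = zero , ≡.refl
  complete (suc j) p = let i , eq = R.complete j p in suc i , cong suc eq

firstTrue : ∀ {n} → (Fin n → Bool) → ℕ
firstTrue {zero} p = 0
firstTrue {suc n} p = if p zero then 0 else suc (firstTrue (p ∘ suc))

firstTrue-cong : ∀ {n} {p q : Fin n → Bool} → (∀ i → p i ≡ q i) → firstTrue p ≡ firstTrue q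
firstTrue-cong {zero} eq = ≡.refl
firstTrue-cong {suc n} eq = cong₂ (if_then 0 else_) (eq zero) (cong suc (firstTrue-cong (eq ∘ suc)))

firstTrue-holds : ∀ {n} (p : Fin n → Bool) i → p i ≡ true → ∃[ j ] (toℕ j ≡ firstTrue p × p j ≡ true)
firstTrue-holds {suc n} p i pi with p zero in eq
... | true = zero , ≡.refl , eq
firstTrue-holds {suc n} p zero pi | false with () ← ≡.trans (≡.sym eq) pi
firstTrue-holds {suc n} p (suc i) pi | false with j , j≡ , pj ← firstTrue-holds (p ∘ suc) i pi =
  suc j , cong suc j≡ , pj

Least : (m p q r : ℕ) → Set
Least m p q r = m < p × m < q × m < r

-- The order of arguments in each alternative is that of the cosets of z, z + a, z + c, z + a + c
-- after translation by 0, a, c, a + c: modulo 2G each translation swaps them in pairs.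
least-of-four : ∀ {m p q r} → m ≢ p → m ≢ q → m ≢ r → p ≢ q → p ≢ r → q ≢ r →
                Least m p q r ⊎ Least p m r q ⊎ Least q r m p ⊎ Least r q p m
least-of-four {m} {p} {q} {r} mp mq mr pq pr qr with ℕₚ.<-cmp m p | ℕₚ.<-cmp q r
... | tri≈ _ eq _ | _ = ⊥-elim (mp eq)
... | tri< _ _ _ | tri≈ _ eq _ = ⊥-elim (qr eq)
... | tri> _ _ _ | tri≈ _ eq _ = ⊥-elim (qr eq)
... | tri< m<p _ _ | tri< q<r _ _ with ℕₚ.<-cmp m q
...   | tri≈ _ eq _ = ⊥-elim (mq eq)
...   | tri< m<q _ _ = inj₁ (m<p , m<q , ℕₚ.<-trans m<q q<r)
...   | tri> _ _ q<m = inj₂ (inj₂ (inj₁ (q<r , q<m , ℕₚ.<-trans q<m m<p)))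
least-of-four {m} {p} {q} {r} mp mq mr pq pr qr | tri< m<p _ _ | tri> _ _ r<q with ℕₚ.<-cmp m r
...   | tri≈ _ eq _ = ⊥-elim (mr eq)
...   | tri< m<r _ _ = inj₁ (m<p , ℕₚ.<-trans m<r r<q , m<r)
...   | tri> _ _ r<m = inj₂ (inj₂ (inj₂ (r<q , ℕₚ.<-trans r<m m<p , r<m)))
least-of-four {m} {p} {q} {r} mp mq mr pq pr qr | tri> _ _ p<m | tri< q<r _ _ with ℕₚ.<-cmp p q
...   | tri≈ _ eq _ = ⊥-elim (pq eq)
...   | tri< p<q _ _ = inj₂ (inj₁ (p<m , ℕₚ.<-trans p<q q<r , p<q))
...   | tri> _ _ q<p = inj₂ (inj₂ (inj₁ (q<r , ℕₚ.<-trans q<p p<m , q<p)))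
least-of-four {m} {p} {q} {r} mp mq mr pq pr qr | tri> _ _ p<m | tri> _ _ r<q with ℕₚ.<-cmp p r
...   | tri≈ _ eq _ = ⊥-elim (pr eq)
...   | tri< p<r _ _ = inj₂ (inj₁ (p<m , p<r , ℕₚ.<-trans p<r r<q))
...   | tri> _ _ r<p = inj₂ (inj₂ (inj₂ (r<q , r<p , ℕₚ.<-trans r<p p<m)))

turn : ∀ {g ℓ} (G : AbelianGroup g ℓ) (let open AbelianGroup G) → Carrier → Carrier → Fin 4 → Carrier → Carrier
turn G a c 0F z = z
turn G a c 1F z = let open AbelianGroup G in a ∙ z ⁻¹
turn G a c 2F z = let open AbelianGroup G in c ∙ z ⁻¹
turn G a c 3F z = let open AbelianGroup G in z ∙ (a ∙ c) ⁻¹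

-- G is the disjoint union of X, a - X, c - X and X - a - c, where X is a
-- union of cosets of 2G and a, c are independent modulo 2G.
module Quartering {g₀ ℓ} (G : AbelianGroup g₀ ℓ) {N : ℕ} (order : HasOrder G N) where
  open AbelianGroup G
  open FiniteGroup G order
  open GroupSolver G using (solve; linear)

  Double : Carrier → Set _
  Double y = ∃[ x ] x ∙ x ≈ y

  Double-resp : ∀ {x y} → x ≈ y → Double x → Double y
  Double-resp eq (z , p) = z , trans p eq

  Double? : ∀ y → Dec (Double y)
  Double? y = exists? (λ x → x ∙ x ≈? y) (λ eq p → trans (∙-cong (sym eq) (sym eq)) p)

  infix 4 _~_
  _~_ : Carrier → Carrier → Set _
  x ~ y = Double (x ∙ y ⁻¹)

  ~-refl : ∀ {x y} → x ≈ y → x ~ y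
  ~-refl {x} {y} eq = ε , linear (x ∷ y ∷ []) (:0 :+ :0) (v₀ :+ :- v₁) v₁ v₀ (sym eq)

  ~-sym : ∀ {x y} → x ~ y → y ~ x
  ~-sym {x} {y} (z , p) = z ⁻¹ , linear (x ∷ y ∷ z ∷ []) (:- v₂ :+ :- v₂) (v₁ :+ :- v₀) (v₀ :+ :- v₁)
      (v₂ :+ v₂) (sym p)

  ~-trans : ∀ {x y z} → x ~ y → y ~ z → x ~ z
  ~-trans {x} {y} {z} (u , p) (w , q) = u ∙ w , linear (x ∷ y ∷ z ∷ u ∷ w ∷ [])
    (v₃ :+ v₄ :+ (v₃ :+ v₄)) (v₀ :+ :- v₂) ((v₃ :+ v₃) :+ (v₄ :+ v₄)) ((v₀ :+ :- v₁) :+ (v₁ :+ :- v₂))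
        (∙-cong p q)

  abstract
    -- Names the coset y + 2G by the place of its first listed element, which makes cosets
    -- comparable as numbers.
    classIndex : Carrier → ℕ
    classIndex y = firstTrue (λ i → does (Double? (elem i ∙ y ⁻¹)))

    classIndex-cong : ∀ {x y} → x ~ y → classIndex x ≡ classIndex y
    classIndex-cong {x} {y} x~y = firstTrue-cong
      {p = λ i → does (Double? (elem i ∙ x ⁻¹))} {q = λ i → does (Double? (elem i ∙ y ⁻¹))} λ i →
          does-⇔ (mk⇔ (λ p → ~-trans p x~y) (λ p → ~-trans p (~-sym x~y)))
        (Double? (elem i ∙ x ⁻¹)) (Double? (elem i ∙ y ⁻¹))

    representative : ∀ x → ∃[ i ] (toℕ i ≡ classIndex x × elem i ~ x)
    representative x = let i , i≡ , p = firstTrue-holds (λ i → does (Double? (elem i ∙ x ⁻¹))) (index x)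
                                          (dec-true (Double? _) (~-refl (elem-index x)))
                       in i , i≡ , does-true (Double? _) p
      where
      does-true : ∀ {p} {P : Set p} (P? : Dec P) → does P? ≡ true → P
      does-true (yes p) _ = p

  classIndex-injective : ∀ {x y} → classIndex x ≡ classIndex y → x ~ y
  classIndex-injective {x} {y} eq =
    let i , i≡ , p = representative x
        j , j≡ , q = representative y
    in ~-trans (~-sym p) (subst (λ i → elem i ~ y) (Finₚ.toℕ-injective (≡.trans j≡ (≡.trans (≡.sym eq) (≡.sym i≡)))) q)

  N≢0 : NonZero N
  N≢0 = Finₚ.nonZeroIndex (index ε)

  module _ (x y : Carrier) (x-order2 : OfOrder2 G x) (y-order2 : OfOrder2 G y) (x≉y : ¬ (x ≈ y)) where

    -- Otherwise every g has some h with 2h = g or 2h = g + a. Translating h by the four elements 0,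
    -- x, y, x + y does not change 2h, so pairs of a g and such a translate embed into G times two
    -- sides, and 4N ≤ 2N.
    escape : ∀ a → ∃[ c ] (¬ Double c × ¬ Double (c ∙ a))
    escape a with exists? (λ c → ¬? (Double? c) ×-dec ¬? (Double? (c ∙ a)))
                    (λ eq (p , q) → (λ d → p (Double-resp (sym eq) d)) , λ d → q (Double-resp (∙-congʳ (sym eq)) d))
    ... | yes found = found
    ... | no none = ⊥-elim (ℕₚ.<⇒≱ (ℕₚ.*-monoʳ-< N {{N≢0}} {2} {4} (s≤s (s≤s (s≤s z≤n))))
            (Finₚ.injective⇒≤ {f = code ∘ remQuot {N} 4} λ {p} {q} eq →
              combine-injective′ {N} (code-injective _ _ eq)))
      where
      half : ∀ g → ∃[ h ] (h ∙ h ≈ g ⊎ h ∙ h ≈ g ∙ a)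
      half g with Double? g | Double? (g ∙ a)
      ... | yes (h , p) | _ = h , inj₁ p
      ... | no _ | yes (h , p) = h , inj₂ p
      ... | no ¬p | no ¬q = ⊥-elim (none (g , ¬p , ¬q))
      side : ∀ {g} → (∃[ h ] (h ∙ h ≈ g ⊎ h ∙ h ≈ g ∙ a)) → Fin 2
      side (_ , inj₁ _) = 0F
      side (_ , inj₂ _) = 1F
      recover : ∀ {g g′} (h : ∃[ h ] (h ∙ h ≈ g ⊎ h ∙ h ≈ g ∙ a)) (h′ : ∃[ h ] (h ∙ h ≈ g′ ⊎ h ∙ h ≈ g′ ∙ a)) →
                side h ≡ side h′ → proj₁ h ∙ proj₁ h ≈ proj₁ h′ ∙ proj₁ h′ → g ≈ g′
      recover (h , inj₁ p) (h′ , inj₁ q) _ eq = trans (sym p) (trans eq q)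
      recover {g} {g′} (h , inj₂ p) (h′ , inj₂ q) _ eq =
        linear (g ∷ g′ ∷ a ∷ []) v₀ v₁ (v₀ :+ v₂) (v₁ :+ v₂) (trans (sym p) (trans eq q))
      torsion : Fin 4 → Carrier
      torsion 0F = ε
      torsion 1F = x
      torsion 2F = y
      torsion 3F = x ∙ y
      xx = proj₂ x-order2
      yy = proj₂ y-order2
      torsion-order : ∀ i → torsion i ∙ torsion i ≈ ε
      torsion-order 0F = identityˡ ε
      torsion-order 1F = xx
      torsion-order 2F = yy
      torsion-order 3F = linear (x ∷ y ∷ []) (v₀ :+ v₁ :+ (v₀ :+ v₁)) :0 (v₀ :+ v₀ :+ (v₁ :+ v₁)) (:0 :+ :0)
          (∙-cong xx yy)
      torsion-injective : ∀ i j → torsion i ≈ torsion j → i ≡ j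
      torsion-injective 0F 0F _ = ≡.refl
      torsion-injective 1F 1F _ = ≡.refl
      torsion-injective 2F 2F _ = ≡.refl
      torsion-injective 3F 3F _ = ≡.refl
      torsion-injective 0F 1F eq = ⊥-elim (proj₁ x-order2 (sym eq))
      torsion-injective 1F 0F eq = ⊥-elim (proj₁ x-order2 eq)
      torsion-injective 0F 2F eq = ⊥-elim (proj₁ y-order2 (sym eq))
      torsion-injective 2F 0F eq = ⊥-elim (proj₁ y-order2 eq)
      torsion-injective 1F 2F eq = ⊥-elim (x≉y eq)
      torsion-injective 2F 1F eq = ⊥-elim (x≉y (sym eq))
      torsion-injective 0F 3F eq = ⊥-elim
          (x≉y (linear (x ∷ y ∷ []) v₀ v₁ (v₀ :+ v₁ :+ :0) (:0 :+ (v₁ :+ v₁)) (∙-cong (sym eq) (sym yy))))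
      torsion-injective 3F 0F eq = ⊥-elim
          (x≉y (linear (x ∷ y ∷ []) v₀ v₁ (v₀ :+ v₁ :+ :0) (:0 :+ (v₁ :+ v₁)) (∙-cong eq (sym yy))))
      torsion-injective 1F 3F eq = ⊥-elim (proj₁ y-order2 (linear (x ∷ y ∷ []) v₁ :0 (v₀ :+ v₁) v₀ (sym eq)))
      torsion-injective 3F 1F eq = ⊥-elim (proj₁ y-order2 (linear (x ∷ y ∷ []) v₁ :0 (v₀ :+ v₁) v₀ eq))
      torsion-injective 2F 3F eq = ⊥-elim (proj₁ x-order2 (linear (x ∷ y ∷ []) v₀ :0 (v₀ :+ v₁) v₁ (sym eq)))
      torsion-injective 3F 2F eq = ⊥-elim (proj₁ x-order2 (linear (x ∷ y ∷ []) v₀ :0 (v₀ :+ v₁) v₁ eq))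
      h : Fin N → Carrier
      h i = proj₁ (half (elem i))
      code : Fin N × Fin 4 → Fin (N * 2)
      code (i , j) = combine (index (h i ∙ torsion j)) (side (half (elem i)))
      code-injective : ∀ p q → code p ≡ code q → p ≡ q
      code-injective (i , j) (i′ , j′) eq
        with e₁ , e₂ ← Finₚ.combine-injective (index (h i ∙ torsion j)) _ (index (h i′ ∙ torsion j′)) _ eq =
            finish i≡
        where
        h≈ : h i ∙ torsion j ≈ h i′ ∙ torsion j′
        h≈ = index-injective e₁
        i≡ : i ≡ i′
        i≡ = elem-injective i i′ (recover (half (elem i)) (half (elem i′)) e₂
          (linear (h i ∷ h i′ ∷ torsion j ∷ torsion j′ ∷ []) (v₀ :+ v₀) (v₁ :+ v₁)
            (v₀ :+ v₂ :+ (v₀ :+ v₂) :+ (:0 :+ (v₃ :+ v₃))) (v₁ :+ v₃ :+ (v₁ :+ v₃) :+ ((v₂ :+ v₂) :+ :0))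
            (∙-cong (∙-cong h≈ h≈) (∙-cong (sym (torsion-order j)) (torsion-order j′)))))
        finish : i ≡ i′ → (i , j) ≡ (i′ , j′)
        finish ≡.refl = cong (i ,_) (torsion-injective j j′
          (linear (h i ∷ torsion j ∷ torsion j′ ∷ []) v₁ v₂ (v₀ :+ v₁) (v₀ :+ v₂) h≈))

  module Partition (a c : Carrier) (a-odd : ¬ Double a) (c-odd : ¬ Double c) (a∙c-odd : ¬ Double (a ∙ c)) where

    -- Of the four cosets reached by adding 0, a, c, a + c, the one of least index is chosen. As -z
    -- and z agree modulo 2G, the set a - X consists of the chosen cosets shifted by a, and
    -- similarly for c - X and X - a - c.
    X : Carrier → Set
    X z = Least (classIndex z) (classIndex (z ∙ a)) (classIndex (z ∙ c)) (classIndex (z ∙ (a ∙ c)))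

    X-resp : ∀ {z w} → z ~ w → X z → X w
    X-resp {z} {w} z~w (p , q , r) =
      ≡.subst₂ _<_ (classIndex-cong z~w) (shift a) p ,
      ≡.subst₂ _<_ (classIndex-cong z~w) (shift c) q ,
      ≡.subst₂ _<_ (classIndex-cong z~w) (shift (a ∙ c)) r
      where
      shift : ∀ s → classIndex (z ∙ s) ≡ classIndex (w ∙ s)
      shift s = classIndex-cong (Double-resp (solve (z ∷ w ∷ s ∷ []) (v₀ :+ :- v₁) (v₀ :+ v₂ :+ :- (v₁ :+ v₂))) z~w)

    X? : ∀ z → Dec (X z)
    X? z = (classIndex z ℕ.<? _) ×-dec (classIndex z ℕ.<? _) ×-dec (classIndex z ℕ.<? _)

    distinct : ∀ {s} → ¬ Double s → ∀ {z w} → z ~ w ∙ s → classIndex z ≢ classIndex w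
    distinct {s} s-odd {z} {w} p eq = s-odd (proj₁ r ∙ proj₁ p ⁻¹ , linear (z ∷ w ∷ s ∷ proj₁ p ∷ proj₁ r ∷ [])
        (v₄ :+ :- v₃ :+ (v₄ :+ :- v₃)) v₂
        ((v₄ :+ v₄) :+ (v₀ :+ :- (v₁ :+ v₂))) ((v₀ :+ :- v₁) :+ (v₃ :+ v₃)) (∙-cong (proj₂ r) (sym (proj₂ p))))
      where
      r : z ~ w
      r = classIndex-injective eq

    covered : ∀ z → ∃[ g ] ∃[ w ] (X w × turn G a c g w ≈ z)
    covered z = [ at₀ , [ at₁ , [ at₂ , at₃ ]′ ]′ ]′
      (least-of-four {m₀} {m₁} {m₂} {m₃}
        (λ eq → distinct a-odd (~-refl refl) (≡.sym eq)) (λ eq → distinct c-odd (~-refl refl) (≡.sym eq))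
        (λ eq → distinct a∙c-odd (~-refl refl) (≡.sym eq))
        (λ eq → distinct a∙c-odd (c ⁻¹ , solve (z ∷ a ∷ c ∷ []) (:- v₂ :+ :- v₂) (v₀ :+ v₁ :+ :- (v₀ :+ v₂ :+ (v₁ :+ v₂)))) eq)
        (λ eq → distinct c-odd (~-refl (solve (z ∷ a ∷ c ∷ []) (v₀ :+ (v₁ :+ v₂)) (v₀ :+ v₁ :+ v₂))) (≡.sym eq))
        (λ eq → distinct a-odd (~-refl (solve (z ∷ a ∷ c ∷ []) (v₀ :+ (v₁ :+ v₂)) (v₀ :+ v₂ :+ v₁))) (≡.sym eq)))
      where
      m₀ = classIndex z
      m₁ = classIndex (z ∙ a)
      m₂ = classIndex (z ∙ c)
      m₃ = classIndex (z ∙ (a ∙ c))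
      Covered : Set _
      Covered = ∃[ g ] ∃[ w ] (X w × turn G a c g w ≈ z)
      least-cong : ∀ {m p q r p′ q′ r′} → p ≡ p′ → q ≡ q′ → r ≡ r′ → Least m p q r → Least m p′ q′ r′
      least-cong ≡.refl ≡.refl ≡.refl l = l
      at₀ : Least m₀ m₁ m₂ m₃ → Covered
      at₀ l = 0F , z , l , refl
      at₁ : Least m₁ m₀ m₃ m₂ → Covered
      at₁ l = 1F , a ∙ z ⁻¹ ,
        X-resp (z , solve (z ∷ a ∷ []) (v₀ :+ v₀) (v₀ :+ v₁ :+ :- (v₁ :+ :- v₀)))
          (least-cong
            (classIndex-cong (a ⁻¹ , solve (z ∷ a ∷ []) (:- v₁ :+ :- v₁) (v₀ :+ :- (v₀ :+ v₁ :+ v₁))))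
            (classIndex-cong (~-refl (solve (z ∷ a ∷ c ∷ []) (v₀ :+ (v₁ :+ v₂)) (v₀ :+ v₁ :+ v₂))))
            (classIndex-cong (a ⁻¹ , solve (z ∷ a ∷ c ∷ []) (:- v₁ :+ :- v₁) (v₀ :+ v₂ :+ :- (v₀ :+ v₁ :+ (v₁ :+ v₂)))))
            l) ,
        solve (z ∷ a ∷ []) (v₁ :+ :- (v₁ :+ :- v₀)) v₀
      at₂ : Least m₂ m₃ m₀ m₁ → Covered
      at₂ l = 2F , c ∙ z ⁻¹ ,
        X-resp (z , solve (z ∷ c ∷ []) (v₀ :+ v₀) (v₀ :+ v₁ :+ :- (v₁ :+ :- v₀)))
          (least-cong
            (classIndex-cong (~-refl (solve (z ∷ a ∷ c ∷ []) (v₀ :+ (v₁ :+ v₂)) (v₀ :+ v₂ :+ v₁))))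
            (classIndex-cong (c ⁻¹ , solve (z ∷ c ∷ []) (:- v₁ :+ :- v₁) (v₀ :+ :- (v₀ :+ v₁ :+ v₁))))
            (classIndex-cong (c ⁻¹ , solve (z ∷ a ∷ c ∷ []) (:- v₂ :+ :- v₂) (v₀ :+ v₁ :+ :- (v₀ :+ v₂ :+ (v₁ :+ v₂)))))
            l) ,
        solve (z ∷ c ∷ []) (v₁ :+ :- (v₁ :+ :- v₀)) v₀
      at₃ : Least m₃ m₂ m₁ m₀ → Covered
      at₃ l = 3F , z ∙ (a ∙ c) ,
        least-cong
          (classIndex-cong (a ⁻¹ , solve (z ∷ a ∷ c ∷ []) (:- v₁ :+ :- v₁) (v₀ :+ v₂ :+ :- (v₀ :+ (v₁ :+ v₂) :+ v₁))))
          (classIndex-cong (c ⁻¹ , solve (z ∷ a ∷ c ∷ []) (:- v₂ :+ :- v₂) (v₀ :+ v₁ :+ :- (v₀ :+ (v₁ :+ v₂) :+ v₂))))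
          (classIndex-cong ((a ∙ c) ⁻¹ , solve (z ∷ a ∷ c ∷ []) (:- (v₁ :+ v₂) :+ :- (v₁ :+ v₂)) (v₀ :+ :- (v₀ :+ (v₁ :+ v₂) :+ (v₁ :+ v₂)))))
          l ,
        solve (z ∷ a ∷ c ∷ []) (v₀ :+ (v₁ :+ v₂) :+ :- (v₁ :+ v₂)) v₀

    -- Two chosen cosets differing by s would each precede the other: the index of w is below that
    -- of w + s, which is that of z, and this is below that of z + s, which is that of w again since
    -- 2s is in 2G.
    clash : ∀ s → (∀ {z} → X z → classIndex z < classIndex (z ∙ s)) → ∀ {z w} → X z → X w → ¬ (z ~ w ∙ s)
    clash s below {z} {w} Xz Xw (u , p) = ℕₚ.<-asym
      (ℕₚ.<-≤-trans (below Xw) (ℕₚ.≤-reflexive (≡.sym (classIndex-cong {z} {w ∙ s} (u , p)))))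
      (ℕₚ.<-≤-trans (below Xz) (ℕₚ.≤-reflexive (classIndex-cong {z ∙ s} {w} (u ∙ s ,
        linear (z ∷ w ∷ s ∷ u ∷ []) (v₃ :+ v₂ :+ (v₃ :+ v₂)) (v₀ :+ v₂ :+ :- v₁) (v₃ :+ v₃)
            (v₀ :+ :- (v₁ :+ v₂)) p))))

    module _ {z w} (Xz : X z) (Xw : X w) where
      clash₀₁ : ¬ (z ≈ a ∙ w ⁻¹)
      clash₀₁ eq = clash a proj₁ Xz Xw
          (w ⁻¹ , linear (z ∷ w ∷ a ∷ []) (:- v₁ :+ :- v₁) (v₀ :+ :- (v₁ :+ v₂)) (v₂ :+ :- v₁) v₀ (sym eq))
      clash₀₂ : ¬ (z ≈ c ∙ w ⁻¹)
      clash₀₂ eq = clash c (proj₁ ∘ proj₂) Xz Xw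
          (w ⁻¹ , linear (z ∷ w ∷ c ∷ []) (:- v₁ :+ :- v₁) (v₀ :+ :- (v₁ :+ v₂)) (v₂ :+ :- v₁) v₀ (sym eq))
      clash₀₃ : ¬ (z ≈ w ∙ (a ∙ c) ⁻¹)
      clash₀₃ eq = clash (a ∙ c) (proj₂ ∘ proj₂) Xz Xw ((a ∙ c) ⁻¹ ,
        linear (z ∷ w ∷ a ∷ c ∷ []) (:- (v₂ :+ v₃) :+ :- (v₂ :+ v₃)) (v₀ :+ :- (v₁ :+ (v₂ :+ v₃)))
            (v₁ :+ :- (v₂ :+ v₃)) v₀ (sym eq))
      clash₁₂ : ¬ (a ∙ z ⁻¹ ≈ c ∙ w ⁻¹)
      clash₁₂ eq = clash (a ∙ c) (proj₂ ∘ proj₂) Xz Xw (c ⁻¹ ,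
        linear (z ∷ w ∷ a ∷ c ∷ []) (:- v₃ :+ :- v₃) (v₀ :+ :- (v₁ :+ (v₂ :+ v₃))) (v₂ :+ :- v₀) (v₃ :+ :- v₁)
            eq)
      clash₁₃ : ¬ (a ∙ z ⁻¹ ≈ w ∙ (a ∙ c) ⁻¹)
      clash₁₃ eq = clash c (proj₁ ∘ proj₂) Xz Xw (a ∙ w ⁻¹ ,
        linear (z ∷ w ∷ a ∷ c ∷ []) (v₂ :+ :- v₁ :+ (v₂ :+ :- v₁)) (v₀ :+ :- (v₁ :+ v₃)) (v₂ :+ :- v₀)
            (v₁ :+ :- (v₂ :+ v₃)) eq)
      clash₂₃ : ¬ (c ∙ z ⁻¹ ≈ w ∙ (a ∙ c) ⁻¹)
      clash₂₃ eq = clash a proj₁ Xz Xw (c ∙ w ⁻¹ ,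
        linear (z ∷ w ∷ a ∷ c ∷ []) (v₃ :+ :- v₁ :+ (v₃ :+ :- v₁)) (v₀ :+ :- (v₁ :+ v₂)) (v₃ :+ :- v₀)
            (v₁ :+ :- (v₂ :+ v₃)) eq)

    turn-injective : ∀ g g′ {z w} → X z → X w → turn G a c g z ≈ turn G a c g′ w → g ≡ g′ × z ≈ w
    turn-injective 0F 0F Xz Xw eq = ≡.refl , eq
    turn-injective 1F 1F {z} {w} Xz Xw eq = ≡.refl , linear (z ∷ w ∷ a ∷ []) v₀ v₁ (v₂ :+ :- v₁) (v₂ :+ :- v₀)
        (sym eq)
    turn-injective 2F 2F {z} {w} Xz Xw eq = ≡.refl , linear (z ∷ w ∷ c ∷ []) v₀ v₁ (v₂ :+ :- v₁) (v₂ :+ :- v₀)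
        (sym eq)
    turn-injective 3F 3F {z} {w} Xz Xw eq = ≡.refl , linear (z ∷ w ∷ a ∙ c ∷ []) v₀ v₁ (v₀ :+ :- v₂)
        (v₁ :+ :- v₂) eq
    turn-injective 0F 1F Xz Xw eq = ⊥-elim (clash₀₁ Xz Xw eq)
    turn-injective 1F 0F Xz Xw eq = ⊥-elim (clash₀₁ Xw Xz (sym eq))
    turn-injective 0F 2F Xz Xw eq = ⊥-elim (clash₀₂ Xz Xw eq)
    turn-injective 2F 0F Xz Xw eq = ⊥-elim (clash₀₂ Xw Xz (sym eq))
    turn-injective 0F 3F Xz Xw eq = ⊥-elim (clash₀₃ Xz Xw eq)
    turn-injective 3F 0F Xz Xw eq = ⊥-elim (clash₀₃ Xw Xz (sym eq))
    turn-injective 1F 2F Xz Xw eq = ⊥-elim (clash₁₂ Xz Xw eq)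
    turn-injective 2F 1F Xz Xw eq = ⊥-elim (clash₁₂ Xw Xz (sym eq))
    turn-injective 1F 3F Xz Xw eq = ⊥-elim (clash₁₃ Xz Xw eq)
    turn-injective 3F 1F Xz Xw eq = ⊥-elim (clash₁₃ Xw Xz (sym eq))
    turn-injective 2F 3F Xz Xw eq = ⊥-elim (clash₂₃ Xz Xw eq)
    turn-injective 3F 2F Xz Xw eq = ⊥-elim (clash₂₃ Xw Xz (sym eq))

    turn-cong : ∀ g {z w} → z ≈ w → turn G a c g z ≈ turn G a c g w
    turn-cong 0F eq = eq
    turn-cong 1F eq = ∙-congˡ (⁻¹-cong eq)
    turn-cong 2F eq = ∙-congˡ (⁻¹-cong eq)
    turn-cong 3F eq = ∙-congʳ eq

    private
      module E = Enumeration (enumerate (X? ∘ elem))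

    size : ℕ
    size = E.size

    member : Fin E.size → Carrier
    member = elem ∘ E.at

    piece : Fin 4 × Fin E.size → Carrier
    piece (g , w) = turn G a c g (member w)

    piece-injective : ∀ p q → piece p ≈ piece q → p ≡ q
    piece-injective (g , w) (g′ , w′) eq =
      let g≡ , w≈ = turn-injective g g′ (E.holds w) (E.holds w′) eq
      in cong₂ _,_ g≡ (E.at-injective w w′ (elem-injective _ _ w≈))

    piece-exhaustive : ∀ z → ∃[ p ] piece p ≈ z
    piece-exhaustive z =
      let g , w , Xw , eq = covered z
          i , i≡ = E.complete (index w) (X-resp (~-refl (sym (elem-index w))) Xw)
      in (g , i) , trans (turn-cong g (trans (reflexive (cong elem i≡)) (elem-index w))) eq

    4*size≡N : 4 * E.size ≡ N
    4*size≡N = bijection⇒size≡ (piece ∘ remQuot {4} E.size)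
      (λ p q eq → combine-injective′ {4} (piece-injective (remQuot {4} E.size p) (remQuot {4} E.size q) eq))
      (λ z → let (g , w) , eq = piece-exhaustive z
             in combine g w , trans (reflexive (cong piece (Finₚ.remQuot-combine g w))) eq)

-- Part (2)

⊟-⊞-merge : ∀ {l} (j : Fin l) x y → x + y ≤ l → j ⊟ (x + y) ⊞ y ≡ j ⊟ x
⊟-⊞-merge {l} j x y x+y≤l = ≡.trans (⊞-⊞ j (l ∸ (x + y)) y) (cong (j ⊞_)
  (≡.trans (cong (_+ y) (≡.sym (ℕₚ.∸-+-assoc l x y))) (ℕₚ.m∸n+n≡m (ℕₚ.m+n≤o⇒m≤o∸n y (subst (_≤ l) (ℕₚ.+-comm x y) x+y≤l)))))

⊞-cancelʳ : ∀ {l} (i j : Fin l) {x} → x ≤ l → i ⊞ x ≡ j ⊞ x → i ≡ j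
⊞-cancelʳ {l} i j {x} x≤l eq = ≡.trans (≡.sym (back i)) (≡.trans (cong (_⊟ x) eq) (back j))
  where
  back : ∀ i → i ⊞ x ⊟ x ≡ i
  back i = ≡.trans (⊞-⊞ i x (l ∸ x)) (≡.trans (cong (i ⊞_) (ℕₚ.m+[n∸m]≡n x≤l)) (⊞-period i))

-- The diagonals come in groups of four consecutive ones. Along a row they read
-- x i, a - x i, b - x (i + 2), x (i + 2) - a - b; down a column, since each
-- diagonal shifts by one row, x j, a - x (j - 1), b - x j, x (j - 1) - a - b.
module FourDiagonals {g ℓ} (G : AbelianGroup g ℓ) {N : ℕ} (order : HasOrder G N)
  (l f k′ s′ c : ℕ) (d≤l : f * 4 ≤ l) (count : c * (l * (f * 4 * (k′ * s′))) ≡ N)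
  (a b : AbelianGroup.Carrier G) (x : Fin (c * (l * (f * (k′ * s′)))) → AbelianGroup.Carrier G) where

  open AbelianGroup G
  open Lines G
  open GroupSolver G using (solve)

  cell : Fin c → Fin l → Fin f → Fin k′ → Fin s′ → Fin (c * (l * (f * (k′ * s′))))
  cell t i h u v = combine t (combine i (combine h (combine u v)))

  cell-injective : ∀ t i h u v t′ i′ h′ u′ v′ → cell t i h u v ≡ cell t′ i′ h′ u′ v′ →
                   t ≡ t′ × i ≡ i′ × h ≡ h′ × u ≡ u′ × v ≡ v′
  cell-injective t i h u v t′ i′ h′ u′ v′ eq =
    let p , eq = Finₚ.combine-injective t _ t′ _ eq
        q , eq = Finₚ.combine-injective i _ i′ _ eq
        r , eq = Finₚ.combine-injective h _ h′ _ eq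
        p′ , q′ = Finₚ.combine-injective u v u′ v′ eq
    in p , q , r , p′ , q′

  source : Fin 4 → Fin l → Fin l
  source 0F i = i
  source 1F i = i
  source 2F i = i ⊞ 2
  source 3F i = i ⊞ 2

  part : Fin c → Fin l → Fin f × Fin 4 → Fin k′ → Fin s′ → Carrier
  part t i (h , g) u v = turn G a b g (x (cell t (source g i) h u v))

  val : Fin c → Fin l → Fin (f * 4) → Fin k′ → Fin s′ → Carrier
  val t i e = part t i (remQuot {f} 4 e)

  open CyclicDesign G l (f * 4) k′ s′ c d≤l order count val

  module _ (x-injective : ∀ g w g′ w′ → turn G a b g (x w) ≈ turn G a b g′ (x w′) → g ≡ g′ × w ≡ w′) where
    private
      bound : ∀ (h : Fin f) (g : Fin 4) → 4 * toℕ h + toℕ g < l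
      bound h g = ℕₚ.<-≤-trans (subst (_< f * 4) (Finₚ.toℕ-combine h g) (Finₚ.toℕ<n (combine h g))) d≤l

      -- Undoing the shift by 2 needs 2 ≤ l; the group of four diagonals numbered h supplies it.
      source-injective : ∀ g i j → Fin f → source g i ≡ source g j → i ≡ j
      source-injective 0F i j _ eq = eq
      source-injective 1F i j _ eq = eq
      source-injective 2F i j h eq = ⊞-cancelʳ i j (ℕₚ.≤-trans (ℕₚ.m≤n+m 2 (4 * toℕ h)) (ℕₚ.<⇒≤ (bound h 2F)))
          eq
      source-injective 3F i j h eq = ⊞-cancelʳ i j (ℕₚ.≤-trans (ℕₚ.m≤n+m 2 (4 * toℕ h)) (ℕₚ.<⇒≤ (bound h 2F)))
          eq

      glue : ∀ {t i h g} {u : Fin k′} {v : Fin s′} {t′ i′ h′ g′ u′ v′} → t ≡ t′ → g ≡ g′ →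
          source g i ≡ source g′ i′ → h ≡ h′ → u ≡ u′ → v ≡ v′ →
             _≡_ {A = Position} (t , i , combine h g , u , v) (t′ , i′ , combine h′ g′ , u′ , v′)
      glue {i = i} {h} {g} {i′ = i′} ≡.refl ≡.refl i≡ ≡.refl ≡.refl ≡.refl with ≡.refl ← source-injective g i
          i′ h i≡ = ≡.refl

      part-injective : ∀ t i h g u v t′ i′ h′ g′ u′ v′ → part t i (h , g) u v ≈ part t′ i′ (h′ , g′) u′ v′ →
                       _≡_ {A = Position} (t , i , combine h g , u , v) (t′ , i′ , combine h′ g′ , u′ , v′)
      part-injective t i h g u v t′ i′ h′ g′ u′ v′ eq =
        let g≡ , w≡ = x-injective g (cell t (source g i) h u v) g′ (cell t′ (source g′ i′) h′ u′ v′) eq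
            t≡ , i≡ , h≡ , u≡ , v≡ = cell-injective t (source g i) h u v t′ (source g′ i′) h′ u′ v′ w≡
        in glue t≡ g≡ i≡ h≡ u≡ v≡

      val-injective : ∀ p q → valAt p ≈ valAt q → p ≡ q
      val-injective (t , i , e , u , v) (t′ , i′ , e′ , u′ , v′) eq =
        ≡.subst₂ (λ e e′ → _≡_ {A = Position} (t , i , e , u , v) (t′ , i′ , e′ , u′ , v′))
          (Finₚ.combine-remQuot {f} 4 e) (Finₚ.combine-remQuot {f} 4 e′)
          (part-injective t i (proj₁ (remQuot {f} 4 e)) (proj₂ (remQuot {f} 4 e)) u v
                          t′ i′ (proj₁ (remQuot {f} 4 e′)) (proj₂ (remQuot {f} 4 e′)) u′ v′ eq)

      val-combine : ∀ t i h g u v → val t i (combine h g) u v ≈ part t i (h , g) u v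
      val-combine t i h g u v = reflexive (cong (λ e → part t i e u v) (Finₚ.remQuot-combine h g))

      sum₄ : ∀ {H : Fin 4 → Carrier} {p q r s} → H 0F ≈ p → H 1F ≈ a ∙ q ⁻¹ → H 2F ≈ b ∙ r ⁻¹ →
          H 3F ≈ s ∙ (a ∙ b) ⁻¹ →
             p ∙ s ≈ q ∙ r → sum H ≈ ε
      sum₄ {H} {p} {q} {r} {s} e₀ e₁ e₂ e₃ eq = trans (∙-cong e₀ (∙-cong e₁ (∙-cong e₂ (∙-cong e₃ refl))))
        (linear (p ∷ q ∷ r ∷ s ∷ a ∷ b ∷ [])
          (v₀ :+ (v₄ :+ :- v₁ :+ (v₅ :+ :- v₂ :+ (v₃ :+ :- (v₄ :+ v₅) :+ :0)))) :0 (v₀ :+ v₃) (v₁ :+ v₂) eq)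
        where open GroupSolver G using (linear)

      rows : ∀ t i u → sum (λ v → sum (λ e → val t i e u v)) ≈ ε
      rows t i u = sum-ε λ v → trans (sum-combine f (λ e → val t i e u v)) (sum-ε λ h →
        let X = x (cell t i h u v)
            Y = x (cell t (i ⊞ 2) h u v)
        in sum₄ {λ g → val t i (combine h g) u v} {X} {X} {Y} {Y} (val-combine t i h 0F u v) (val-combine t i h 1F u v) (val-combine t i h 2F u v)
             (val-combine t i h 3F u v) refl)

      cols : ∀ t j v → sum (λ u → sum (λ e → val t (j ⊟ toℕ e) e u v)) ≈ ε
      cols t j v = sum-ε λ u → trans (sum-combine f (λ e → val t (j ⊟ toℕ e) e u v)) (sum-ε λ h →
        let X = x (cell t (j ⊟ (4 * toℕ h + 0)) h u v)
            Y = x (cell t (j ⊟ (4 * toℕ h + 1)) h u v)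
        in sum₄ {λ g → val t (j ⊟ toℕ (combine h g)) (combine h g) u v} {X} {Y} {X} {Y} (at h 0F u) (at h 1F u)
             (trans (at h 2F u) (moved h u 2F 0 (ℕₚ.+-assoc (4 * toℕ h) 0 2)))
             (trans (at h 3F u) (moved h u 3F 1 (ℕₚ.+-assoc (4 * toℕ h) 1 2)))
             (comm X Y))
        where
        at : ∀ h g u → val t (j ⊟ toℕ (combine h g)) (combine h g) u v ≈ part t (j ⊟ (4 * toℕ h + toℕ g))
            (h , g) u v
        at h g u = trans (val-combine t (j ⊟ toℕ (combine h g)) h g u v)
          (reflexive (cong (λ y → part t (j ⊟ y) (h , g) u v) (Finₚ.toℕ-combine h g)))
        moved : ∀ h u g y → 4 * toℕ h + y + 2 ≡ 4 * toℕ h + toℕ g →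
          turn G a b g (x (cell t (j ⊟ (4 * toℕ h + toℕ g) ⊞ 2) h u v)) ≈ turn G a b g
              (x (cell t (j ⊟ (4 * toℕ h + y)) h u v))
        moved h u g y eq = reflexive (cong (λ z → turn G a b g (x (cell t z h u v)))
          (≡.trans (cong (λ z → j ⊟ z ⊞ 2) (≡.sym eq))
            (⊟-⊞-merge j (4 * toℕ h + y) 2 (ℕₚ.≤-trans (ℕₚ.≤-reflexive eq) (ℕₚ.<⇒≤ (bound h g))))))

    arrays : M⁰S G (Whole G) (l * k′) (l * s′) (s′ * (f * 4)) (k′ * (f * 4)) c
    arrays = design val-injective rows cols

module _ {g ℓ} (G : AbelianGroup g ℓ) where
  open AbelianGroup G

  four-diagonals-exist : ∀ {m n s k d c} → Shape m n s k d → 4 ℕ∣.∣ d → HasOrder G (n * k * c) →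
    ∀ x y → OfOrder2 G x → OfOrder2 G y → ¬ (x ≈ y) → M⁰S G (Whole G) m n s k c
  four-diagonals-exist {c = c}
    record { s′ = s′ ; k′ = k′ ; l = l ; s≡ = ≡.refl ; k≡ = ≡.refl ; m≡ = ≡.refl ; n≡ = ≡.refl ; d≤l = d≤l }
    (ℕ∣.divides f ≡.refl) order x y x² y² x≉y = build _ size≡ P.member P.piece-injective
    where
    open Quartering G order
    -- Applied to 0 and then to a, `escape` puts a, b and a + b outside 2G.
    a b : Carrier
    a = proj₁ (escape x y x² y² x≉y ε)
    b = proj₁ (escape x y x² y² x≉y a)
    module P = Partition a b (proj₁ (proj₂ (escape x y x² y² x≉y ε))) (proj₁ (proj₂ (escape x y x² y² x≉y a)))
      (λ p → proj₂ (proj₂ (escape x y x² y² x≉y a)) (Double-resp (comm a b) p))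
    M : ℕ
    M = c * (l * (f * (k′ * s′)))
    lemma : ∀ c l f k s → c * (l * (f * 4 * (k * s))) ≡ l * s * (k * (f * 4)) * c
    lemma = solve-∀
    lemma₄ : ∀ c l f k s → l * s * (k * (f * 4)) * c ≡ 4 * (c * (l * (f * (k * s))))
    lemma₄ = solve-∀
    size≡ : P.size ≡ M
    size≡ = ℕₚ.*-cancelˡ-≡ _ _ 4 (≡.trans P.4*size≡N (lemma₄ c l f k′ s′))
    build : ∀ L → L ≡ M → (member : Fin L → Carrier) →
      (∀ p q → turn G a b (proj₁ p) (member (proj₂ p)) ≈ turn G a b (proj₁ q) (member (proj₂ q)) → p ≡ q) →
      M⁰S G (Whole G) (l * k′) (l * s′) (s′ * (f * 4)) (k′ * (f * 4)) c
    build L ≡.refl member inj = FourDiagonals.arrays G order l f k′ s′ c d≤l (lemma c l f k′ s′) a b member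
      λ g w g′ w′ eq → let p = inj (g , w) (g′ , w′) eq in cong proj₁ p , cong proj₂ p

-- Arrays without empty cells

module FullArrays {g ℓ} (G : AbelianGroup g ℓ) where
  open AbelianGroup G
  open Lines G
  open GroupSolver G using (solve; linear)

  filled≤ : ∀ {n} (f : Fin n → Maybe Carrier) → filled G f ≤ n
  filled≤ {zero} f = z≤n
  filled≤ {suc n} f with f zero
  ... | just _  = s≤s (filled≤ (f ∘ suc))
  ... | nothing = ℕₚ.m≤n⇒m≤1+n (filled≤ (f ∘ suc))

  all-filled : ∀ {n} (f : Fin n → Maybe Carrier) → filled G f ≡ n → ∀ j → ∃[ x ] f j ≡ just x
  all-filled {suc n} f full j with f zero in eq
  all-filled {suc n} f full j       | nothing = ⊥-elim (ℕₚ.1+n≰n (subst (_≤ n) full (filled≤ (f ∘ suc))))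
  all-filled {suc n} f full zero    | just x = x , eq
  all-filled {suc n} f full (suc j) | just x = all-filled (f ∘ suc) (ℕₚ.suc-injective full) j

  full-sum : ∀ {n} (f : Fin n → Maybe Carrier) (h : Fin n → Carrier) → (∀ j → f j ≡ just (h j)) →
      lineSum G f ≈ sum h
  full-sum f h eq = lineSum-enum f id h (λ _ _ → id) eq (λ j miss → ⊥-elim (miss j ≡.refl))

  full-count : ∀ {n} (f : Fin n → Maybe Carrier) (h : Fin n → Carrier) → (∀ j → f j ≡ just (h j)) →
      filled G f ≡ n
  full-count f h eq = filled-enum f id h (λ _ _ → id) eq (λ j miss → ⊥-elim (miss j ≡.refl))

  two-rows : ∀ {n c} (top : Fin c → Fin n → Carrier) →
    (∀ t q t′ q′ → top t q ≈ top t′ q′ → (t , q) ≡ (t′ , q′)) →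
    (∀ t q t′ q′ → ¬ (top t q ≈ top t′ q′ ⁻¹)) →
    (∀ x → ¬ (x ≈ ε) → ∃[ t ] ∃[ q ] (top t q ≈ x ⊎ top t q ⁻¹ ≈ x)) →
    (∀ t → sum (top t) ≈ ε) → M⁰S G (Nonzero G) 2 n n 2 c
  two-rows {n} {c} top injective antipodal exhaustive zero-sum = record
    { arrays = λ t r q → just (entry t r q)
    ; entries∈Ω = λ { t r q x ≡.refl x≈ε → nonzero t r q x≈ε }
    ; appears = λ x x≉ε → locate x (exhaustive x x≉ε)
    ; once = λ { x (t , r , q) (t′ , r′ , q′) (y , ≡.refl , y≈x) (z , ≡.refl , z≈x) →
        entry-injective t r q t′ r′ q′ (trans y≈x (sym z≈x)) }
    ; rowFilled = λ t r → full-count _ (entry t r) (λ _ → ≡.refl)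
    ; colFilled = λ _ _ → ≡.refl
    ; rowSum = λ t r → trans (full-sum _ (entry t r) (λ _ → ≡.refl)) (row-sum t r)
    ; colSum = λ t q → solve (top t q ∷ []) (v₀ :+ (:- v₀ :+ :0)) :0
    }
    where
    entry : Fin c → Fin 2 → Fin n → Carrier
    entry t 0F q = top t q
    entry t 1F q = top t q ⁻¹
    nonzero : ∀ t r q → ¬ (entry t r q ≈ ε)
    nonzero t 0F q eq = antipodal t q t q
        (linear (top t q ∷ []) v₀ (:- v₀) (v₀ :+ v₀) (:0 :+ :0) (∙-cong eq eq))
    nonzero t 1F q eq = antipodal t q t q
        (linear (top t q ∷ []) v₀ (:- v₀) (:0 :+ :0) (:- v₀ :+ :- v₀) (∙-cong (sym eq) (sym eq)))
    locate : ∀ x → ∃[ t ] ∃[ q ] (top t q ≈ x ⊎ top t q ⁻¹ ≈ x) →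
        ∃[ pos ] Contains G (λ t r q → just (entry t r q)) pos x
    locate x (t , q , inj₁ eq) = (t , 0F , q) , _ , ≡.refl , eq
    locate x (t , q , inj₂ eq) = (t , 1F , q) , _ , ≡.refl , eq
    spread : ∀ {t q t′ q′} r → (t , q) ≡ (t′ , q′) → (t , r , q) ≡ (t′ , r , q′)
    spread r ≡.refl = ≡.refl
    entry-injective : ∀ t r q t′ r′ q′ → entry t r q ≈ entry t′ r′ q′ → (t , r , q) ≡ (t′ , r′ , q′)
    entry-injective t 0F q t′ 0F q′ eq = spread 0F (injective t q t′ q′ eq)
    entry-injective t 1F q t′ 1F q′ eq = spread 1F (injective t q t′ q′
      (linear (top t q ∷ top t′ q′ ∷ []) v₀ v₁ (:- v₁) (:- v₀) (sym eq)))
    entry-injective t 0F q t′ 1F q′ eq = ⊥-elim (antipodal t q t′ q′ eq)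
    entry-injective t 1F q t′ 0F q′ eq = ⊥-elim (antipodal t′ q′ t q (sym eq))
    row-sum : ∀ t r → sum (entry t r) ≈ ε
    row-sum t 0F = zero-sum t
    row-sum t 1F = trans (neg-sum (top t)) (trans (⁻¹-cong (zero-sum t)) (solve [] (:- :0) :0))
      where
      neg-sum : ∀ {n} (f : Fin n → Carrier) → sum (λ j → f j ⁻¹) ≈ sum f ⁻¹
      neg-sum {zero} f = solve [] :0 (:- :0)
      neg-sum {suc n} f = trans (∙-congˡ (neg-sum (f ∘ suc)))
        (solve (f zero ∷ sum (f ∘ suc) ∷ []) (:- v₀ :+ :- v₁) (:- (v₀ :+ v₁)))

  module FullArray {p m n c} {Ω : Carrier → Set p} (A : M⁰S G Ω m n n m c) where
    open M⁰S A

    filledAt : ∀ t r q → ∃[ x ] arrays t r q ≡ just x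
    filledAt t r = all-filled (arrays t r) (rowFilled t r)

    at : Fin c → Fin m → Fin n → Carrier
    at t r q = proj₁ (filledAt t r q)

    at-injective : ∀ t r q t′ r′ q′ → at t r q ≈ at t′ r′ q′ → (t , r , q) ≡ (t′ , r′ , q′)
    at-injective t r q t′ r′ q′ eq = once (at t r q) (t , r , q) (t′ , r′ , q′)
      (at t r q , proj₂ (filledAt t r q) , refl) (at t′ r′ q′ , proj₂ (filledAt t′ r′ q′) , sym eq)

    at∈Ω : ∀ t r q → Ω (at t r q)
    at∈Ω t r q = entries∈Ω t r q (at t r q) (proj₂ (filledAt t r q))

    at-exhaustive : ∀ x → Ω x → ∃[ t ] ∃[ r ] ∃[ q ] at t r q ≈ x
    at-exhaustive x x∈Ω = let (t , r , q) , y , eq , y≈x = appears x x∈Ω in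
      t , r , q , trans (reflexive (just-injective (≡.trans (≡.sym (proj₂ (filledAt t r q))) eq))) y≈x

    at-row : ∀ t r → sum (at t r) ≈ ε
    at-row t r = trans (sym (full-sum (arrays t r) (at t r) (λ q → proj₂ (filledAt t r q)))) (rowSum t r)

    at-col : ∀ t q → sum (λ r → at t r q) ≈ ε
    at-col t q = trans (sym (full-sum (λ r → arrays t r q) (λ r → at t r q) (λ r → proj₂ (filledAt t r q))))
        (colSum t q)

  -- The first row and the first column share a corner and both sum to zero, so their other cells
  -- are equal.
  no-2×2 : ∀ {p c} {Ω : Carrier → Set p} → Fin c → ¬ M⁰S G Ω 2 2 2 2 c
  no-2×2 t A = apart (at-injective t 0F 1F t 1F 0F
      (linear (at t 0F 0F ∷ at t 0F 1F ∷ at t 1F 0F ∷ []) v₁ v₂ (v₀ :+ (v₁ :+ :0)) (v₀ :+ (v₂ :+ :0))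
        (trans (at-row t 0F) (sym (at-col t 0F)))))
    where
    open FullArray A
    apart : _≢_ {A = _ × Fin 2 × Fin 2} (t , 0F , 1F) (t , 1F , 0F)
    apart ()

  -- The sum of the first two top entries is nonzero, so it is one of the eight entries. With the
  -- zero row total and 3x = 0, each possibility makes an entry vanish or two top entries coincide.
  no-2×4-of-exponent-3 : (∀ x → x ∙ (x ∙ x) ≈ ε) → ¬ M⁰S G (Nonzero G) 2 4 4 2 1
  no-2×4-of-exponent-3 3x≈0 A = let t , r , q , eq = at-exhaustive (x 0F ∙ x 1F) x₀+x₁≉ε in absurd t r q eq
    where
    open FullArray A
    x : Fin 4 → Carrier
    x = at 0F 0F
    bottom : ∀ q → at 0F 1F q ≈ x q ⁻¹
    bottom q = linear (x q ∷ at 0F 1F q ∷ []) v₁ (:- v₀) (v₀ :+ (v₁ :+ :0)) :0 (at-col 0F q)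
    distinct : ∀ {q q′} → q ≢ q′ → ¬ (x q ≈ x q′)
    distinct {q} {q′} q≢q′ eq = q≢q′ (cong (λ (_ , _ , q) → q) (at-injective 0F 0F q 0F 0F q′ eq))
    total : x 0F ∙ (x 1F ∙ (x 2F ∙ (x 3F ∙ ε))) ≈ ε
    total = at-row 0F 0F
    x₀+x₁≉ε : ¬ (x 0F ∙ x 1F ≈ ε)
    x₀+x₁≉ε eq = apart (at-injective 0F 0F 0F 0F 1F 1F
      (trans (linear (x 0F ∷ x 1F ∷ []) v₀ (:- v₁) (v₀ :+ v₁) :0 eq) (sym (bottom 1F))))
      where
      apart : _≢_ {A = Fin 1 × Fin 2 × Fin 4} (0F , 0F , 0F) (0F , 1F , 1F)
      apart ()
    ρ : Vec Carrier 4
    ρ = x 0F ∷ x 1F ∷ x 2F ∷ x 3F ∷ []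
    absurd : ∀ t r q → ¬ (at t r q ≈ x 0F ∙ x 1F)
    absurd 0F 0F 0F eq = at∈Ω 0F 0F 1F (linear ρ v₁ :0 (v₀ :+ v₁) v₀ (sym eq))
    absurd 0F 0F 1F eq = at∈Ω 0F 0F 0F (linear ρ v₀ :0 (v₀ :+ v₁) v₁ (sym eq))
    absurd 0F 0F 2F eq = distinct {2F} {3F} (λ ()) (linear ρ v₂ v₃
      (v₂ :+ (v₂ :+ v₂) :+ (:0 :+ (v₀ :+ v₁))) (:0 :+ (v₀ :+ (v₁ :+ (v₂ :+ (v₃ :+ :0))) :+ v₂))
      (∙-cong (3x≈0 (x 2F)) (∙-cong (sym total) (sym eq))))
    absurd 0F 0F 3F eq = distinct {3F} {2F} (λ ()) (linear ρ v₃ v₂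
      (v₃ :+ (v₃ :+ v₃) :+ (:0 :+ (v₀ :+ v₁))) (:0 :+ (v₀ :+ (v₁ :+ (v₂ :+ (v₃ :+ :0))) :+ v₃))
      (∙-cong (3x≈0 (x 3F)) (∙-cong (sym total) (sym eq))))
    absurd 0F 1F 0F eq = distinct {0F} {1F} (λ ())
        (linear ρ v₀ v₁ (v₀ :+ (v₀ :+ v₀) :+ :- v₀) (:0 :+ (v₀ :+ v₁))
      (∙-cong (3x≈0 (x 0F)) (trans (sym (bottom 0F)) eq)))
    absurd 0F 1F 1F eq = distinct {1F} {0F} (λ ())
        (linear ρ v₁ v₀ (v₁ :+ (v₁ :+ v₁) :+ :- v₁) (:0 :+ (v₀ :+ v₁))
      (∙-cong (3x≈0 (x 1F)) (trans (sym (bottom 1F)) eq)))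
    absurd 0F 1F 2F eq = at∈Ω 0F 0F 3F
        (linear ρ v₃ :0 (v₀ :+ (v₁ :+ (v₂ :+ (v₃ :+ :0))) :+ :- v₂) (:0 :+ (v₀ :+ v₁))
      (∙-cong total (trans (sym (bottom 2F)) eq)))
    absurd 0F 1F 3F eq = at∈Ω 0F 0F 2F
        (linear ρ v₂ :0 (v₀ :+ (v₁ :+ (v₂ :+ (v₃ :+ :0))) :+ :- v₃) (:0 :+ (v₀ :+ v₁))
      (∙-cong total (trans (sym (bottom 3F)) eq)))

-- Half-sets of an abelian group of odd order

module _ {g₁ ℓ₁ g₂ ℓ₂} (G : AbelianGroup g₁ ℓ₁) (H : AbelianGroup g₂ ℓ₂) where
  private
    module G = AbelianGroup G
    module H = AbelianGroup H

  -- In the applications ψ is an explicit formula while φ merely picks coordinates, so every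
  -- property of φ is deduced from ψ.
  inverse⇒≅ : (ψ : H.Carrier → G.Carrier) → (∀ {x y} → x H.≈ y → ψ x G.≈ ψ y) →
    (∀ x y → ψ (x H.∙ y) G.≈ ψ x G.∙ ψ y) → (∀ {x y} → ψ x G.≈ ψ y → x H.≈ y) →
    (φ : G.Carrier → H.Carrier) → (∀ x → ψ (φ x) G.≈ x) → G ≅ H
  inverse⇒≅ ψ ψ-cong ψ-homo ψ-injective φ ψφ = φ , record
    { isGroupMonomorphism = record
      { isGroupHomomorphism = record
        { isMonoidHomomorphism = record
          { isMagmaHomomorphism = record
            { isRelHomomorphism = record { cong = λ eq → ψ-injective (G.trans (ψφ _) (G.trans eq (G.sym (ψφ _)))) }
            ; homo = λ x y → ψ-injective (G.trans (ψφ _) (G.sym (G.trans (ψ-homo _ _) (G.∙-cong (ψφ x) (ψφ y)))))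
            }
          ; ε-homo = ψ-injective (G.trans (ψφ _) (G.sym ψε))
          }
        ; ⁻¹-homo = λ x → ψ-injective (G.trans (ψφ _) (G.sym (G.trans (ψ⁻¹ (φ x)) (G.⁻¹-cong (ψφ x)))))
        }
      ; injective = λ eq → G.trans (G.sym (ψφ _)) (G.trans (ψ-cong eq) (ψφ _))
      }
    ; surjective = λ y → ψ y , λ eq → ψ-injective (G.trans (ψφ _) eq)
    }
    where
    open GroupSolver G using (linear)
    ψε : ψ H.ε G.≈ G.ε
    ψε = linear (ψ H.ε ∷ []) v₀ :0 (v₀ :+ v₀) v₀ (G.trans (G.sym (ψ-homo H.ε H.ε)) (ψ-cong (H.identityˡ H.ε)))
    ψ⁻¹ : ∀ x → ψ (x H.⁻¹) G.≈ ψ x G.⁻¹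
    ψ⁻¹ x = linear (ψ x ∷ ψ (x H.⁻¹) ∷ []) v₁ (:- v₀) (v₀ :+ v₁) :0
      (G.trans (G.sym (ψ-homo x (x H.⁻¹))) (G.trans (ψ-cong (H.inverseʳ x)) ψε))

  ≅⇒order≡ : ∀ {M N} → HasOrder G M → HasOrder H N → G ≅ H → M ≡ N
  ≅⇒order≡ orderG orderH (φ , iso) = FiniteGroup.bijection⇒size≡ H orderH (φ ∘ FG.elem)
    (λ i j eq → FG.elem-injective i j (Iso.injective eq))
    (λ y → let x , eq = Iso.surjective y in FG.index x , eq (FG.elem-index x))
    where
    module FG = FiniteGroup G orderG
    open import Algebra.Morphism.Structures using (module GroupMorphisms)
    module Iso = GroupMorphisms.IsGroupIsomorphism iso

-- Multiples of an element, cyclic and bicyclic groups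

module Multiples {g ℓ} (G : AbelianGroup g ℓ) where
  open AbelianGroup G
  open Lines G
  open GroupSolver G using (solve; linear)
  open import Algebra.Properties.Monoid.Mult monoid public
    using () renaming (_×_ to _·_; ×-homo-+ to ·-homo-+; ×-assocˡ to ·-assocˡ; ×-congʳ to ·-congʳ; ×-congˡ to ·-congˡ)

  sum-const : ∀ k x → sum {k} (λ _ → x) ≈ k · x
  sum-const zero x = refl
  sum-const (suc k) x = ∙-congˡ (sum-const k x)

  ·-ε : ∀ k → k · ε ≈ ε
  ·-ε zero = refl
  ·-ε (suc k) = trans (identityˡ _) (·-ε k)

  ·-double : ∀ k {x} → x ∙ x ≈ ε → k · x ∙ k · x ≈ ε
  ·-double zero _ = identityˡ ε
  ·-double (suc k) {x} eq = linear (x ∷ k · x ∷ []) (v₀ :+ v₁ :+ (v₀ :+ v₁)) :0 (v₀ :+ v₀ :+ (v₁ :+ v₁))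
      (:0 :+ :0)
    (∙-cong eq (·-double k eq))

  ·-reduce : ∀ p .{{_ : NonZero p}} {x} → p · x ≈ ε → ∀ j → j · x ≈ (j % p) · x
  ·-reduce p {x} px≈ε j = begin
    j · x                               ≡⟨ cong (_· x) (DivMod.m≡m%n+[m/n]*n j p) ⟩
    (j % p + j / p * p) · x             ≈⟨ ·-homo-+ x (j % p) (j / p * p) ⟩
    (j % p) · x ∙ (j / p * p) · x       ≈⟨ ∙-congˡ (·-assocˡ x (j / p) p) ⟨
    (j % p) · x ∙ (j / p) · (p · x)     ≈⟨ ∙-congˡ (trans (·-congʳ (j / p) px≈ε) (·-ε (j / p))) ⟩
    (j % p) · x ∙ ε                     ≈⟨ identityʳ _ ⟩
    (j % p) · x                         ∎
    where open import Relation.Binary.Reasoning.Setoid setoid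

  ·-mod : ∀ p .{{_ : NonZero p}} {x} → p · x ≈ ε → ∀ i j → (+ i) ≡[mod p ] (+ j) → i · x ≈ j · x
  ·-mod p {x} px≈ε i j eq = trans (·-reduce p px≈ε i)
      (trans (·-congˡ (residue-injective (DivMod.m%n<n i p) (DivMod.m%n<n j p)
    (ℤ/.trans p {+ (i % p)} {+ i} {+ (j % p)} (%≈ i) (ℤ/.trans p {+ i} {+ j} {+ (j % p)} eq (ℤ/.sym p {+ (j % p)} {+ j} (%≈ j))))))
    (sym (·-reduce p px≈ε j)))
    where
    lemma : ∀ r q p → r ℤ.- (r ℤ.+ q ℤ.* p) ≡ (- q) ℤ.* p
    lemma = ℤRing.solve-∀
    %≈ : ∀ i → (+ (i % p)) ≡[mod p ] (+ i)
    %≈ i = ℤ∣.divides (- (+ (i / p))) (≡.trans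
      (cong (λ z → + (i % p) ℤ.- z) (≡.trans (cong +_ (DivMod.m≡m%n+[m/n]*n i p)) (cong (λ z → + (i % p) ℤ.+ z) (ℤₚ.pos-* (i / p) p))))
      (lemma (+ (i % p)) (+ (i / p)) (+ p)))

  record ExactOrder (p : ℕ) (x : Carrier) : Set ℓ where
    field
      vanishes : p · x ≈ ε
      minimal : ∀ r → 0 < r → r < p → ¬ (r · x ≈ ε)

    distinct : ∀ {i j} → i < j → j < p → ¬ (i · x ≈ j · x)
    distinct {i} {j} i<j j<p eq = minimal (j ∸ i) (ℕₚ.m<n⇒0<n∸m i<j) (ℕₚ.≤-<-trans (ℕₚ.m∸n≤m j i) j<p)
      (linear (i · x ∷ (j ∸ i) · x ∷ []) v₁ :0 (v₀ :+ v₁) v₀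
        (trans (sym (·-homo-+ x i (j ∸ i))) (trans (·-congˡ (ℕₚ.m+[n∸m]≡n (ℕₚ.<⇒≤ i<j))) (sym eq))))

    ·-injective : ∀ (i j : Fin p) → toℕ i · x ≈ toℕ j · x → i ≡ j
    ·-injective i j eq with ℕₚ.<-cmp (toℕ i) (toℕ j)
    ... | tri< i<j _ _ = ⊥-elim (distinct i<j (Finₚ.toℕ<n j) eq)
    ... | tri≈ _ i≡j _ = Finₚ.toℕ-injective i≡j
    ... | tri> _ _ j<i = ⊥-elim (distinct j<i (Finₚ.toℕ<n i) (sym eq))

  module Power (p : ℕ) .{{_ : NonZero p}} (x : Carrier) (vanishes : p · x ≈ ε) where
    rem : ℤ → ℕ
    rem z = toℕ (proj₁ (residue z p))

    -- Multiples are defined for naturals only, so an integer is first replaced by its residue.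
    power : ℤ → Carrier
    power z = rem z · x

    rem≈ : ∀ z → (+ rem z) ≡[mod p ] z
    rem≈ z = proj₂ (residue z p)

    power-cong : ∀ y z → y ≡[mod p ] z → power y ≈ power z
    power-cong y z eq = ·-mod p vanishes (rem y) (rem z) (begin
      + rem y  ≈⟨ rem≈ y ⟩
      y        ≈⟨ eq ⟩
      z        ≈⟨ rem≈ z ⟨
      + rem z  ∎)
      where open ≈-Reasoning p

    power-+ : ∀ j → power (+ j) ≈ j · x
    power-+ j = ·-mod p vanishes (rem (+ j)) j (rem≈ (+ j))

    power-homo : ∀ y z → power (y ℤ.+ z) ≈ power y ∙ power z
    power-homo y z = trans (power-cong (y ℤ.+ z) (+ (rem y + rem z))
        (ℤ/.sym p {+ (rem y + rem z)} {y ℤ.+ z} (ℤ/.∙-cong p {+ rem y} {y} {+ rem z} {z} (rem≈ y) (rem≈ z))))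
      (trans (power-+ (rem y + rem z)) (·-homo-+ x (rem y) (rem z)))

    same-residue : ∀ y z → proj₁ (residue y p) ≡ proj₁ (residue z p) → y ≡[mod p ] z
    same-residue y z eq = begin
      y        ≈⟨ rem≈ y ⟨
      + rem y  ≡⟨ cong (λ i → + toℕ i) eq ⟩
      + rem z  ≈⟨ rem≈ z ⟩
      z        ∎
      where open ≈-Reasoning p

  cyclic≅ : ∀ {p} .{{_ : NonZero p}} {t} → ExactOrder p t → (∀ x → ∃[ j ] x ≈ j · t) → G ≅ ℤ/ p
  cyclic≅ {p} {t} exact generates = inverse⇒≅ G (ℤ/ p) power (λ {y} {z} → power-cong y z) power-homo
    (λ {y} {z} eq → same-residue y z (·-injective (proj₁ (residue y p)) (proj₁ (residue z p)) eq))
    (λ x → + proj₁ (generates x)) (λ x → trans (power-+ (proj₁ (generates x))) (sym (proj₂ (generates x))))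
    where
    open ExactOrder exact
    open Power p t vanishes

  bicyclic≅ : ∀ {p} .{{_ : NonZero p}} {t x} → p · t ≈ ε → p · x ≈ ε →
    (∀ i j i′ j′ → toℕ {p} i · t ∙ toℕ {p} j · x ≈ toℕ {p} i′ · t ∙ toℕ {p} j′ · x → i ≡ i′ × j ≡ j′) →
    (∀ y → ∃[ i ] ∃[ j ] y ≈ i · t ∙ j · x) → G ≅ (ℤ/ p ⊕ ℤ/ p)
  bicyclic≅ {p} {t} {x} pt≈ε px≈ε independent generates = inverse⇒≅ G (ℤ/ p ⊕ ℤ/ p)
      (λ (y , z) → T.power y ∙ X.power z)
    (λ { {y , z} {y′ , z′} (p , q) → ∙-cong (T.power-cong y y′ p) (X.power-cong z z′ q) })
    (λ (y , z) (y′ , z′) → trans (∙-cong (T.power-homo y y′) (X.power-homo z z′))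
      (solve (T.power y ∷ T.power y′ ∷ X.power z ∷ X.power z′ ∷ []) (v₀ :+ v₁ :+ (v₂ :+ v₃)) (v₀ :+ v₂ :+ (v₁ :+ v₃))))
    (λ { {y , z} {y′ , z′} eq → let p , q = independent _ _ _ _ eq in T.same-residue y y′ p , X.same-residue z z′ q })
    (λ y → let i , j , _ = generates y in + i , + j)
    (λ y → let i , j , eq = generates y in trans (∙-cong (T.power-+ i) (X.power-+ j)) (sym eq))
    where
    module T = Power p t pt≈ε
    module X = Power p x px≈ε

module OddOrder {g ℓ} (G : AbelianGroup g ℓ) {n : ℕ} (order : HasOrder G (suc (n + n))) where
  open AbelianGroup G
  open Lines G
  open FiniteGroup G order
  open GroupSolver G using (solve; linear)
  open Multiples G

  private
    N : ℕ
    N = suc (n + n)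

  -- Translation by x permutes the group, so the sum of all elements equals itself plus N x.
  order·≈ε : ∀ x → N · x ≈ ε
  order·≈ε x = linear (sum elem ∷ N · x ∷ []) v₁ :0 (v₀ :+ v₁) v₀ (begin
    sum elem ∙ N · x                    ≈⟨ ∙-congˡ (sum-const N x) ⟨
    sum elem ∙ sum {N} (λ _ → x)        ≈⟨ ∑-distrib-+ elem (λ _ → x) ⟨
    sum (λ i → elem i ∙ x)              ≈⟨ sum-embed (λ i → index (elem i ∙ x)) translate-injective
                                             {elem} {λ i → elem i ∙ x} (λ i → elem-index (elem i ∙ x))
                                             (λ j miss → ⊥-elim (let i , eq = injective⇒surjective _ translate-injective j in miss i eq)) ⟨
    sum elem                            ∎)
    where
    open import Relation.Binary.Reasoning.Setoid setoid
    translate-injective : ∀ i j → index (elem i ∙ x) ≡ index (elem j ∙ x) → i ≡ j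
    translate-injective i j eq = elem-injective i j
      (linear (elem i ∷ elem j ∷ x ∷ []) v₀ v₁ (v₀ :+ v₂) (v₁ :+ v₂) (index-injective eq))

  pred·≈⁻¹ : ∀ x → (n + n) · x ≈ x ⁻¹
  pred·≈⁻¹ x = linear (x ∷ (n + n) · x ∷ []) v₁ (:- v₀) (v₀ :+ v₁) :0 (order·≈ε x)

  double≈ε : ∀ {x} → x ∙ x ≈ ε → x ≈ ε
  double≈ε {x} eq = linear (x ∷ n · x ∷ []) v₀ :0 (v₀ :+ (v₁ :+ v₁) :+ :0) (:0 :+ (v₁ :+ v₁))
    (∙-cong (trans (∙-congˡ (sym (·-homo-+ x n n))) (order·≈ε x)) (sym (·-double n eq)))

  double-injective : ∀ {x y} → x ∙ x ≈ y ∙ y → x ≈ y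
  double-injective {x} {y} eq = linear (x ∷ y ∷ []) v₀ v₁ (v₀ :+ :- v₁) :0
    (double≈ε (linear (x ∷ y ∷ []) (v₀ :+ :- v₁ :+ (v₀ :+ :- v₁)) :0 (v₀ :+ v₀) (v₁ :+ v₁) eq))

  half : Carrier → Carrier
  half x = suc n · x

  half∙half : ∀ x → half x ∙ half x ≈ x
  half∙half x = linear (x ∷ n · x ∷ []) (v₀ :+ v₁ :+ (v₀ :+ v₁)) v₀ (v₀ :+ (v₁ :+ v₁)) :0
    (trans (∙-congˡ (sym (·-homo-+ x n n))) (order·≈ε x))

  -- Subtracting g is adding it N - 1 times.
  closed-under-difference : ∀ {p} {P : Carrier → Set p} → (∀ {x y} → x ≈ y → P x → P y) →
    ∀ g → (∀ {x} → P x → P (x ∙ g)) → ∀ {x} → P x → P (x ∙ g ⁻¹)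
  closed-under-difference {P = P} resp g step {x} Px = resp (∙-congˡ (pred·≈⁻¹ g)) (iterate (n + n) Px)
    where
    iterate : ∀ k {x} → P x → P (x ∙ k · g)
    iterate zero {x} Px = resp (sym (identityʳ x)) Px
    iterate (suc k) {x} Px = resp (assoc x g (k · g)) (iterate k (step Px))

  pick : Bool → Carrier → Carrier
  pick true x = x
  pick false _ = ε

  -- Membership is Boolean so that `total` is a sum over the whole group, of which a flip changes
  -- two terms.
  record HalfSet : Set (g ⊔ ℓ) where
    field
      χ : Carrier → Bool
      χ-cong : ∀ {x y} → x ≈ y → χ x ≡ χ y
      χ-ε : χ ε ≡ false
      χ-antipodal : ∀ {x} → ¬ (x ≈ ε) → χ (x ⁻¹) ≡ not (χ x)

    infix 4 _∈
    _∈ : Carrier → Set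
    x ∈ = χ x ≡ true

    total : Carrier
    total = sum (λ i → pick (χ (elem i)) (elem i))

    ∈? : ∀ x → Dec (x ∈)
    ∈? x = χ x Bool.≟ true

    ∈-resp : ∀ {x y} → x ≈ y → x ∈ → y ∈
    ∈-resp eq p = ≡.trans (≡.sym (χ-cong eq)) p

    ∈⇒≉ε : ∀ {x} → x ∈ → ¬ (x ≈ ε)
    ∈⇒≉ε p eq with () ← ≡.trans (≡.sym (∈-resp eq p)) χ-ε

    ∈⇒⁻¹∉ : ∀ {x} → x ∈ → ¬ (x ⁻¹ ∈)
    ∈⇒⁻¹∉ p q with () ← ≡.trans (≡.sym q) (≡.trans (χ-antipodal (∈⇒≉ε p)) (cong not p))

    ∉⇒⁻¹∈ : ∀ {x} → ¬ (x ≈ ε) → ¬ (x ∈) → x ⁻¹ ∈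
    ∉⇒⁻¹∈ {x} x≉ε x∉ = ≡.trans (χ-antipodal x≉ε) (negate (χ x) x∉)
      where
      negate : ∀ b → b ≢ true → not b ≡ true
      negate false _ = ≡.refl
      negate true b≢ = ⊥-elim (b≢ ≡.refl)

  -- Of each pair ±x the element listed first is taken; odd order keeps x and -x apart.
  initial : HalfSet
  initial = record
    { χ = λ x → before (index x) (index (x ⁻¹))
    ; χ-cong = λ eq → cong₂ before (index-cong eq) (index-cong (⁻¹-cong eq))
    ; χ-ε = before-irrefl (index-cong (solve [] :0 (:- :0)))
    ; χ-antipodal = λ {x} x≉ε → ≡.trans
        (cong (before (index (x ⁻¹))) (index-cong (solve (x ∷ []) (:- :- v₀) v₀)))
        (before-asym _ _ λ eq → x≉ε (double≈ε (linear (x ∷ []) (v₀ :+ v₀) :0 v₀ (:- v₀) (index-injective eq))))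
    }
    where
    before : Fin N → Fin N → Bool
    before i j = does (i Fin.<? j)
    before-irrefl : ∀ {i j} → i ≡ j → before i j ≡ false
    before-irrefl {i} ≡.refl = dec-false (i Fin.<? i) (ℕₚ.<-irrefl ≡.refl)
    before-asym : ∀ i j → i ≢ j → before j i ≡ not (before i j)
    before-asym i j i≢j with Finₚ.<-cmp i j
    ... | tri≈ _ eq _ = ⊥-elim (i≢j eq)
    ... | tri< i<j _ ¬j<i = ≡.trans (dec-false (j Fin.<? i) ¬j<i) (cong not (≡.sym (dec-true (i Fin.<? j) i<j)))
    ... | tri> ¬i<j _ j<i = ≡.trans (dec-true (j Fin.<? i) j<i) (cong not (≡.sym (dec-false (i Fin.<? j) ¬i<j)))

  module Flip (H : HalfSet) (y : Carrier) (y∈ : HalfSet._∈ H y) where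
    open HalfSet H

    private
      y≉y⁻¹ : ¬ (y ≈ y ⁻¹)
      y≉y⁻¹ eq = ∈⇒⁻¹∉ y∈ (∈-resp eq y∈)

      flipped : ∀ {p q} {P : Set p} {Q : Set q} → Dec P → Dec Q → Bool → Bool
      flipped (yes _) _ _ = false
      flipped (no _) (yes _) _ = true
      flipped (no _) (no _) b = b

      χ′ : Carrier → Bool
      χ′ x = flipped (x ≈? y) (x ≈? y ⁻¹) (χ x)

      χ′-cong : ∀ {x x′} → x ≈ x′ → (p : Dec (x ≈ y)) (q : Dec (x ≈ y ⁻¹)) (p′ : Dec (x′ ≈ y))
          (q′ : Dec (x′ ≈ y ⁻¹)) →
                flipped p q (χ x) ≡ flipped p′ q′ (χ x′)
      χ′-cong eq (yes _) _ (yes _) _ = ≡.refl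
      χ′-cong eq (yes p) _ (no ¬p′) _ = ⊥-elim (¬p′ (trans (sym eq) p))
      χ′-cong eq (no ¬p) _ (yes p′) _ = ⊥-elim (¬p (trans eq p′))
      χ′-cong eq (no _) (yes _) (no _) (yes _) = ≡.refl
      χ′-cong eq (no _) (yes q) (no _) (no ¬q′) = ⊥-elim (¬q′ (trans (sym eq) q))
      χ′-cong eq (no _) (no ¬q) (no _) (yes q′) = ⊥-elim (¬q (trans eq q′))
      χ′-cong eq (no _) (no _) (no _) (no _) = χ-cong eq

      χ′-ε : (p : Dec (ε ≈ y)) (q : Dec (ε ≈ y ⁻¹)) → flipped p q (χ ε) ≡ false
      χ′-ε (yes _) _ = ≡.refl
      χ′-ε (no _) (yes q) = ⊥-elim (∈⇒≉ε y∈ (linear (y ∷ []) v₀ :0 :0 (:- v₀) q))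
      χ′-ε (no _) (no _) = χ-ε

      χ′-antipodal : ∀ {x} → ¬ (x ≈ ε) → (p : Dec (x ≈ y)) (q : Dec (x ≈ y ⁻¹)) (p′ : Dec (x ⁻¹ ≈ y))
          (q′ : Dec (x ⁻¹ ≈ y ⁻¹)) →
                     flipped p′ q′ (χ (x ⁻¹)) ≡ not (flipped p q (χ x))
      χ′-antipodal {x} _ (yes p) _ (yes p′) _ = ⊥-elim (y≉y⁻¹ (trans (sym p′) (⁻¹-cong p)))
      χ′-antipodal _ (yes p) _ (no _) (yes _) = ≡.refl
      χ′-antipodal _ (yes p) _ (no _) (no ¬q′) = ⊥-elim (¬q′ (⁻¹-cong p))
      χ′-antipodal _ (no _) (yes q) (yes _) _ = ≡.refl
      χ′-antipodal {x} _ (no _) (yes q) (no ¬p′) _ =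
          ⊥-elim (¬p′ (linear (x ∷ y ∷ []) (:- v₀) v₁ (:- v₁) v₀ (sym q)))
      χ′-antipodal {x} _ (no _) (no ¬q) (yes p′) _ =
          ⊥-elim (¬q (linear (x ∷ y ∷ []) v₀ (:- v₁) v₁ (:- v₀) (sym p′)))
      χ′-antipodal {x} _ (no ¬p) (no _) (no _) (yes q′) =
          ⊥-elim (¬p (linear (x ∷ y ∷ []) v₀ v₁ (:- v₁) (:- v₀) (sym q′)))
      χ′-antipodal x≉ε (no _) (no _) (no _) (no _) = χ-antipodal x≉ε

    flip : HalfSet
    flip = record
      { χ = χ′
      ; χ-cong = λ {x} {x′} eq → χ′-cong eq (x ≈? y) (x ≈? y ⁻¹) (x′ ≈? y) (x′ ≈? y ⁻¹)
      ; χ-ε = χ′-ε (ε ≈? y) (ε ≈? y ⁻¹)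
      ; χ-antipodal = λ {x} x≉ε → χ′-antipodal x≉ε (x ≈? y) (x ≈? y ⁻¹) (x ⁻¹ ≈? y) (x ⁻¹ ≈? y ⁻¹)
      }

    flip-∈ : ∀ {z} → z ∈ → ¬ (z ≈ y) → HalfSet._∈ flip z
    flip-∈ {z} z∈ z≉y = kept (z ≈? y) (z ≈? y ⁻¹)
      where
      kept : (p : Dec (z ≈ y)) (q : Dec (z ≈ y ⁻¹)) → flipped p q (χ z) ≡ true
      kept (yes p) _ = ⊥-elim (z≉y p)
      kept (no _) (yes _) = ≡.refl
      kept (no _) (no _) = z∈

    -- A term-by-term comparison: the new sum with y added at the place of y agrees with the old sum
    -- with -y added at the place of -y.
    flip-total : HalfSet.total flip ∙ (y ∙ y) ≈ total
    flip-total = linear (HalfSet.total flip ∷ total ∷ y ∷ []) (v₀ :+ (v₂ :+ v₂)) v₁ (v₀ :+ v₂) (v₁ :+ :- v₂)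
        (begin
      HalfSet.total flip ∙ y
        ≈⟨ ∙-congˡ (spike y) ⟨
      HalfSet.total flip ∙ sum (λ i → point (elem i ≈? y) y)
        ≈⟨ ∑-distrib-+ (λ i → pick (χ′ (elem i)) (elem i)) (λ i → point (elem i ≈? y) y) ⟨
      sum (λ i → pick (χ′ (elem i)) (elem i) ∙ point (elem i ≈? y) y)
        ≈⟨ sum-cong (λ i → exchange (elem i ≈? y) (elem i ≈? y ⁻¹)) ⟩
      sum (λ i → pick (χ (elem i)) (elem i) ∙ point (elem i ≈? y ⁻¹) (y ⁻¹))
        ≈⟨ ∑-distrib-+ (λ i → pick (χ (elem i)) (elem i)) (λ i → point (elem i ≈? y ⁻¹) (y ⁻¹)) ⟩
      total ∙ sum (λ i → point (elem i ≈? y ⁻¹) (y ⁻¹))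
        ≈⟨ ∙-congˡ (spike (y ⁻¹)) ⟩
      total ∙ y ⁻¹ ∎)
      where
      open import Relation.Binary.Reasoning.Setoid setoid
      point : ∀ {p} {P : Set p} → Dec P → Carrier → Carrier
      point (yes _) x = x
      point (no _) _ = ε
      spike : ∀ x → sum (λ i → point (elem i ≈? x) x) ≈ x
      spike x = trans (sum-single (λ i → point (elem i ≈? x) x) (index x) (λ j j≢ → off j j≢ (elem j ≈? x)))
          (on (elem (index x) ≈? x))
        where
        on : (p : Dec (elem (index x) ≈ x)) → point p x ≈ x
        on (yes _) = refl
        on (no ¬p) = ⊥-elim (¬p (elem-index x))
        off : ∀ j → j ≢ index x → (p : Dec (elem j ≈ x)) → point p x ≈ ε
        off j j≢ (yes p) = ⊥-elim (j≢ (≡.trans (≡.sym (index-elem j)) (index-cong p)))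
        off j j≢ (no _) = refl
      exchange : ∀ {x} (p : Dec (x ≈ y)) (q : Dec (x ≈ y ⁻¹)) →
                 pick (flipped p q (χ x)) x ∙ point p y ≈ pick (χ x) x ∙ point q (y ⁻¹)
      exchange (yes p) (yes q) = ⊥-elim (y≉y⁻¹ (trans (sym p) q))
      exchange {x} (yes p) (no _) rewrite ∈-resp (sym p) y∈ =
          trans (identityˡ y) (trans (sym p) (sym (identityʳ x)))
      exchange {x} (no _) (yes q) with χ x in eq
      ... | true = ⊥-elim (∈⇒⁻¹∉ y∈ (∈-resp q eq))
      ... | false = trans (identityʳ x) (trans q (sym (identityˡ (y ⁻¹))))
      exchange (no _) (no _) = refl

  module _ (H : HalfSet) (zero-total : HalfSet.total H ≈ ε) where
    open HalfSet H
    private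
      module E = Enumeration (enumerate (λ i → ∈? (elem i)))

      member : Fin E.size → Carrier
      member = elem ∘ E.at

      signed : Fin E.size ⊎ Fin E.size → Carrier
      signed (inj₁ i) = member i
      signed (inj₂ i) = member i ⁻¹

      find : ∀ {x} → x ∈ → ∃[ i ] member i ≈ x
      find {x} x∈ = let i , eq = E.complete (index x) (∈-resp (sym (elem-index x)) x∈) in
        i , trans (reflexive (cong elem eq)) (elem-index x)

      member-injective : ∀ i j → member i ≈ member j → i ≡ j
      member-injective i j eq = E.at-injective i j (elem-injective _ _ eq)

      antipodal : ∀ i j → ¬ (member i ≈ member j ⁻¹)
      antipodal i j eq = ∈⇒⁻¹∉ (E.holds j) (∈-resp eq (E.holds i))

      signed-injective : ∀ p q → signed p ≈ signed q → p ≡ q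
      signed-injective (inj₁ i) (inj₁ j) eq = cong inj₁ (member-injective i j eq)
      signed-injective (inj₁ i) (inj₂ j) eq = ⊥-elim (antipodal i j eq)
      signed-injective (inj₂ i) (inj₁ j) eq = ⊥-elim (antipodal j i (sym eq))
      signed-injective (inj₂ i) (inj₂ j) eq = cong inj₂ (member-injective i j
        (linear (member i ∷ member j ∷ []) v₀ v₁ (:- v₁) (:- v₀) (sym eq)))

      exhaustive : ∀ x → ¬ (x ≈ ε) → ∃[ p ] signed p ≈ x
      exhaustive x x≉ε with ∈? x
      ... | yes x∈ = let i , eq = find x∈ in inj₁ i , eq
      ... | no x∉ = let i , eq = find (∉⇒⁻¹∈ x≉ε x∉) in inj₂ i , trans (⁻¹-cong eq) (solve (x ∷ []) (:- :- v₀) v₀)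

      list : Fin (suc (E.size + E.size)) → Carrier
      list zero = ε
      list (suc i) = signed (splitAt E.size i)

      signed≉ε : ∀ p → ¬ (signed p ≈ ε)
      signed≉ε (inj₁ i) eq = ∈⇒≉ε (E.holds i) eq
      signed≉ε (inj₂ i) eq = ∈⇒≉ε (E.holds i) (linear (member i ∷ []) v₀ :0 :0 (:- v₀) (sym eq))

      list-injective : ∀ i j → list i ≈ list j → i ≡ j
      list-injective zero zero _ = ≡.refl
      list-injective zero (suc j) eq = ⊥-elim (signed≉ε (splitAt E.size j) (sym eq))
      list-injective (suc i) zero eq = ⊥-elim (signed≉ε (splitAt E.size i) eq)
      list-injective (suc i) (suc j) eq = cong suc (≡.trans (≡.sym (Finₚ.join-splitAt E.size E.size i))
        (≡.trans (cong (join E.size E.size) (signed-injective (splitAt E.size i) (splitAt E.size j) eq)) (Finₚ.join-splitAt E.size E.size j)))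

      list-exhaustive : ∀ x → ∃[ i ] list i ≈ x
      list-exhaustive x with x ≈? ε
      ... | yes eq = zero , sym eq
      ... | no x≉ε = let p , eq = exhaustive x x≉ε in
        suc (join E.size E.size p) , trans (reflexive (cong signed (Finₚ.splitAt-join E.size E.size p))) eq

      halve : ∀ {m n} → suc (m + m) ≡ suc (n + n) → m ≡ n
      halve {m} {n} eq = ℕₚ.*-cancelˡ-≡ m n 2
          (≡.trans (lemma m) (≡.trans (ℕₚ.suc-injective eq) (≡.sym (lemma n))))
        where
        lemma : ∀ m → 2 * m ≡ m + m
        lemma = solve-∀

      size≡n : E.size ≡ n
      size≡n = halve (bijection⇒size≡ list list-injective list-exhaustive)

      member-sum : sum member ≈ ε
      member-sum = trans (sym (sum-embed E.at E.at-injective {λ i → pick (χ (elem i)) (elem i)}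
          (λ i → reflexive (cong (λ b → pick b (member i)) (E.holds i)))
          (λ j miss → missed j miss (χ (elem j)) ≡.refl))) zero-total
        where
        missed : ∀ j → (∀ i → E.at i ≢ j) → ∀ b → χ (elem j) ≡ b → pick b (elem j) ≈ ε
        missed j miss true eq = ⊥-elim (let i , at≡ = E.complete j eq in miss i at≡)
        missed j miss false _ = refl

    zero-total⇒two-rows : M⁰S G (Nonzero G) 2 n n 2 1
    zero-total⇒two-rows = subst (λ n → M⁰S G (Nonzero G) 2 n n 2 1) size≡n (FullArrays.two-rows G (λ _ → member)
      (λ { 0F q 0F q′ eq → cong (0F ,_) (member-injective q q′ eq) })
      (λ _ q _ q′ → antipodal q q′)
      (λ x x≉ε → let p , eq = exhaustive x x≉ε in 0F , locate p eq)
      (λ _ → member-sum))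
      where
      locate : ∀ {x} p → signed p ≈ x → ∃[ q ] (member q ≈ x ⊎ member q ⁻¹ ≈ x)
      locate (inj₁ i) eq = i , inj₁ eq
      locate (inj₂ i) eq = i , inj₂ eq

-- Part (6)

module NoFlip {g ℓ} (G : AbelianGroup g ℓ) {n : ℕ} (2≤n : 2 ≤ n) (order : HasOrder G (suc (n + n))) where
  open AbelianGroup G
  open Lines G
  open FiniteGroup G order
  open GroupSolver G using (solve; linear)
  open Multiples G
  open OddOrder G {n} order

  module _ (H : HalfSet) where
    open HalfSet H

    -- No set of at most three elements of the half-set sums to t ⁻¹, half of its total,
    -- so no choice of at most three flips makes the total vanish.
    module Stuck (t : Carrier) (total≈ : total ≈ (t ∙ t) ⁻¹) (t∈ : t ∈)
      (pairs : ∀ {x y} → x ∈ → y ∈ → x ∙ y ≈ t ⁻¹ → x ≈ y)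
      (triples : ∀ {x y z} → x ∈ → y ∈ → z ∈ → ¬ (x ≈ y) → ¬ (x ≈ z) → ¬ (y ≈ z) → ¬ (x ∙ (y ∙ z) ≈ t ⁻¹)) where

      t≉ε : ¬ (t ≈ ε)
      t≉ε = ∈⇒≉ε t∈

      -- If x + t were no member, -(x + t) would be one and would form with x a pair of sum -t. By
      -- `pairs` the two are equal, which means 2x = -t.
      translate : ∀ {x} → x ∈ → ¬ (x ∙ x ≈ t ⁻¹) → x ∙ t ∈
      translate {x} x∈ 2x≉ = decidable-stable (∈? (x ∙ t)) λ xt∉ → 2x≉
        (let x≈ = pairs x∈ (∉⇒⁻¹∈ (λ xt≈ε → ∈⇒⁻¹∉ t∈ (∈-resp (linear (x ∷ t ∷ []) v₀ (:- v₁) (v₀ :+ v₁) :0 xt≈ε) x∈)) xt∉)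
                    (solve (x ∷ t ∷ []) (v₀ :+ :- (v₀ :+ v₁)) (:- v₁))
         in linear (x ∷ t ∷ []) (v₀ :+ v₀) (:- v₁) v₀ (:- (v₀ :+ v₁)) x≈)

      -- Otherwise t, 2t and 3t are members. For a member x other than t, the triple t, x, -(x + 2t)
      -- has sum -t and no repetition, so x + 2t is a member; for x = t it is 3t. Closure under
      -- adding 2t then yields t - 2t = -t, which is no member.
      ExactOrder-3or5 : ¬ (¬ (t ∙ (t ∙ t) ≈ ε) × ¬ (t ∙ (t ∙ (t ∙ (t ∙ t))) ≈ ε))
      ExactOrder-3or5 (3t≉ε , 5t≉ε) = ∈⇒⁻¹∉ t∈ (∈-resp (solve (t ∷ []) (v₀ :+ :- (v₀ :+ v₀)) (:- v₀))
          (closed-under-difference ∈-resp (t ∙ t) step t∈))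
        where
        2t∈ : t ∙ t ∈
        2t∈ = translate t∈ λ eq → 3t≉ε (linear (t ∷ []) (v₀ :+ (v₀ :+ v₀)) :0 (v₀ :+ v₀) (:- v₀) eq)
        3t∈ : t ∙ t ∙ t ∈
        3t∈ = translate 2t∈ λ eq → 5t≉ε
            (linear (t ∷ []) (v₀ :+ (v₀ :+ (v₀ :+ (v₀ :+ v₀)))) :0 (v₀ :+ v₀ :+ (v₀ :+ v₀)) (:- v₀) eq)
        step : ∀ {x} → x ∈ → x ∙ (t ∙ t) ∈
        step {x} x∈ with x ≈? t
        ... | yes x≈t = ∈-resp (linear (x ∷ t ∷ []) (v₁ :+ v₁ :+ v₁) (v₀ :+ (v₁ :+ v₁)) v₁ v₀ (sym x≈t)) 3t∈
        ... | no x≉t = decidable-stable (∈? (x ∙ (t ∙ t))) λ ∉ → triples t∈ x∈ (∉⇒⁻¹∈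
                (λ eq → ∈⇒⁻¹∉ 2t∈ (∈-resp (linear (x ∷ t ∷ []) v₀ (:- (v₁ :+ v₁)) (v₀ :+ (v₁ :+ v₁)) :0 eq) x∈)) ∉)
              (λ eq → x≉t (sym eq))
              (λ eq → ∈⇒⁻¹∉ 3t∈ (∈-resp (linear (x ∷ t ∷ []) v₀ (:- (v₁ :+ v₁ :+ v₁)) v₁ (:- (v₀ :+ (v₁ :+ v₁))) eq) x∈))
              (λ eq → ∈⇒⁻¹∉ t∈ (∈-resp (double-injective
                (linear (x ∷ t ∷ []) (v₀ :+ v₀) (:- v₁ :+ :- v₁) v₀ (:- (v₀ :+ (v₁ :+ v₁))) eq)) x∈))
              (solve (x ∷ t ∷ []) (v₁ :+ (v₀ :+ :- (v₀ :+ (v₁ :+ v₁)))) (:- v₁))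

      InSpan : Carrier → Set ℓ
      InSpan x = ∃[ j ] x ≈ j · t

      span-resp : ∀ {x y} → x ≈ y → InSpan x → InSpan y
      span-resp eq (j , p) = j , trans (sym eq) p

      span-∙ : ∀ {x y} → InSpan x → InSpan y → InSpan (x ∙ y)
      span-∙ (i , p) (j , q) = i + j , trans (∙-cong p q) (sym (·-homo-+ t i j))

      span-⁻¹ : ∀ {x} → InSpan x → InSpan (x ⁻¹)
      span-⁻¹ {x} (j , p) = (n + n) * j , trans (sym (pred·≈⁻¹ x))
          (trans (·-congʳ (n + n) p) (·-assocˡ t (n + n) j))

      span-ε : InSpan ε
      span-ε = 0 , refl

      span-t : InSpan t
      span-t = 1 , sym (identityʳ t)

      InSpan? : ∀ x → Dec (InSpan x)
      InSpan? x = map′ (λ (i , eq) → toℕ i , sym eq)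
        (λ (j , eq) → let r<N = DivMod.m%n<n j (suc (n + n)) in fromℕ< r<N ,
          trans (·-congˡ (Finₚ.toℕ-fromℕ< r<N)) (trans (sym (·-reduce (suc (n + n)) (order·≈ε t) j)) (sym eq)))
        (Finₚ.any? {n = suc (n + n)} (λ i → toℕ i · t ≈? x))

      Outer : Carrier → Set ℓ
      Outer x = x ∈ × ¬ InSpan x

      Outer-resp : ∀ {x y} → x ≈ y → Outer x → Outer y
      Outer-resp eq (x∈ , x∉) = ∈-resp eq x∈ , λ s → x∉ (span-resp (sym eq) s)

      -- The only exception to `translate` is 2x = -t, and then x is half of -t and lies in the
      -- span. So the outer members form whole cosets of the span.
      Outer-t : ∀ {x} → Outer x → Outer (x ∙ t)
      Outer-t {x} (x∈ , x∉) = translate x∈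
          (λ eq → x∉ (span-resp (double-injective (trans (half∙half (t ⁻¹)) (sym eq)))
          (let j , p = span-⁻¹ span-t in suc n * j , trans (·-congʳ (suc n) p) (·-assocˡ t (suc n) j)))) ,
        λ s → x∉ (span-resp (solve (x ∷ t ∷ []) (v₀ :+ v₁ :+ :- v₁) v₀) (span-∙ s (span-⁻¹ span-t)))

      Outer-multiple : ∀ j {x} → Outer x → Outer (x ∙ j · t)
      Outer-multiple zero {x} o = Outer-resp (sym (identityʳ x)) o
      Outer-multiple (suc j) {x} o = Outer-resp (assoc x t (j · t)) (Outer-multiple j (Outer-t o))

      Outer-span : ∀ {x s} → InSpan s → Outer x → Outer (x ∙ s)
      Outer-span (j , eq) o = Outer-resp (∙-congˡ (sym eq)) (Outer-multiple j o)

      Outer-⁻¹ : ∀ {x} → Outer x → ¬ Outer (x ⁻¹)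
      Outer-⁻¹ (x∈ , _) (x⁻¹∈ , _) = ∈⇒⁻¹∉ x∈ x⁻¹∈

      -- Closure under adding x gives closure under subtracting it, and x - x = 0 lies in the span.
      closed⇒empty : ∀ {x} → Outer x → ¬ (∀ {y} → Outer y → Outer (y ∙ x))
      closed⇒empty {x} o closed = proj₂
          (Outer-resp (inverseʳ x) (closed-under-difference Outer-resp x closed o)) span-ε

      -- Completes x + s and y to a triple of sum -t.
      third : Carrier → Carrier → Carrier → Carrier
      third x y s = (x ∙ y) ⁻¹ ∙ (s ∙ t) ⁻¹

      module _ {x y} (x-outer : Outer x) (y-outer : Outer y) where
        ∙∉span : ¬ InSpan (x ∙ y)
        ∙∉span s = Outer-⁻¹ x-outer (Outer-resp (solve (x ∷ y ∷ []) (v₁ :+ :- (v₀ :+ v₁)) (:- v₀)) (Outer-span (span-⁻¹ s) y-outer))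

        module _ (xy∉ : ¬ (x ∙ y ∈)) where
          xy⁻¹-outer : Outer ((x ∙ y) ⁻¹)
          xy⁻¹-outer = ∉⇒⁻¹∈ (λ eq → ∙∉span (span-resp (sym eq) span-ε)) xy∉ ,
            λ s → ∙∉span (span-resp (solve (x ∷ y ∷ []) (:- :- (v₀ :+ v₁)) (v₀ :+ v₁)) (span-⁻¹ s))

          third-outer : ∀ {s} → InSpan s → Outer (third x y s)
          third-outer s = Outer-span (span-⁻¹ (span-∙ s span-t)) xy⁻¹-outer

          Clash : Carrier → Set ℓ
          Clash s = x ∙ s ≈ y ⊎ x ∙ s ≈ third x y s ⊎ y ≈ third x y s

          -- The elements x + s, y and `third x y s` are all outer and sum to -t, so by `triples`
          -- two of them coincide. Each of the three coincidences determines s (`same-colour`),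
          -- which leaves room for at most three elements in the span.
          clash : ∀ {s} → InSpan s → Clash s
          clash {s} s∈ with x ∙ s ≈? y | x ∙ s ≈? third x y s | y ≈? third x y s
          ... | yes p | _ | _ = inj₁ p
          ... | no _ | yes p | _ = inj₂ (inj₁ p)
          ... | no _ | no _ | yes p = inj₂ (inj₂ p)
          ... | no ¬p | no ¬q | no ¬r = ⊥-elim
              (triples (proj₁ (Outer-span s∈ x-outer)) (proj₁ y-outer) (proj₁ (third-outer s∈)) ¬p ¬q ¬r
                  (solve (x ∷ y ∷ s ∷ t ∷ []) (v₀ :+ v₂ :+ (v₁ :+ (:- (v₀ :+ v₁) :+ :- (v₂ :+ v₃)))) (:- v₃)))

          clash₂ : ∀ {s s′} → x ∙ s ≈ third x y s → x ∙ s′ ≈ third x y s′ → s ≈ s′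
          clash₂ {s} {s′} p q = double-injective (linear (x ∷ y ∷ s ∷ s′ ∷ t ∷ []) (v₂ :+ v₂) (v₃ :+ v₃)
            (v₀ :+ v₂ :+ (:- (v₀ :+ v₁) :+ :- (v₃ :+ v₄))) (:- (v₀ :+ v₁) :+ :- (v₂ :+ v₄) :+ (v₀ :+ v₃))
                (∙-cong p (sym q)))

          clash₃ : ∀ {s s′} → y ≈ third x y s → y ≈ third x y s′ → s ≈ s′
          clash₃ {s} {s′} p q = linear (x ∷ y ∷ s ∷ s′ ∷ t ∷ []) v₂ v₃
            (v₁ :+ (:- (v₀ :+ v₁) :+ :- (v₃ :+ v₄))) (:- (v₀ :+ v₁) :+ :- (v₂ :+ v₄) :+ v₁) (∙-cong p (sym q))

          colour : ∀ {s} → Clash s → Fin 3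
          colour (inj₁ _) = 0F
          colour (inj₂ (inj₁ _)) = 1F
          colour (inj₂ (inj₂ _)) = 2F

          same-colour : ∀ {s s′} (c : Clash s) (c′ : Clash s′) → colour c ≡ colour c′ → s ≈ s′
          same-colour {s} {s′} (inj₁ p) (inj₁ q) _ = linear (x ∷ s ∷ s′ ∷ []) v₁ v₂ (v₀ :+ v₁) (v₀ :+ v₂)
              (trans p (sym q))
          same-colour (inj₁ _) (inj₂ (inj₁ _)) ()
          same-colour (inj₁ _) (inj₂ (inj₂ _)) ()
          same-colour (inj₂ (inj₁ p)) (inj₂ (inj₁ q)) _ = clash₂ p q
          same-colour (inj₂ (inj₂ p)) (inj₂ (inj₂ q)) _ = clash₃ p q

          multiple∈span : ∀ j → InSpan (j · t)
          multiple∈span j = j , refl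

          impossible₅ : ¬ ExactOrder 5 t
          impossible₅ exact =
            let c = λ (i : Fin 4) → clash (multiple∈span (toℕ i))
                i , j , i<j , eq = Finₚ.pigeonhole (s≤s (s≤s (s≤s (s≤s z≤n)))) (colour ∘ c)
            in ExactOrder.distinct exact i<j (ℕₚ.m<n⇒m<1+n (Finₚ.toℕ<n j)) (same-colour (c i) (c j) eq)

          -- For x and y in different cosets of the span, x + s = y is excluded, so the three
          -- multiples of t have to share two colours.
          impossible₃ : ExactOrder 3 t → ¬ InSpan (y ∙ x ⁻¹) → ⊥
          impossible₃ exact y-x∉ =
            let i , j , i<j , eq = Finₚ.pigeonhole {2} {3} (s≤s (s≤s (s≤s z≤n))) (λ i → colour′ (clash (multiple∈span (toℕ i))))
            in ExactOrder.distinct exact i<j (Finₚ.toℕ<n j) (same-colour′ (multiple∈span (toℕ i)) (multiple∈span (toℕ j)) (clash _) (clash _) eq)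
            where
            not-first : ∀ {s} → InSpan s → ¬ (x ∙ s ≈ y)
            not-first {s} s∈ eq = y-x∉ (span-resp (linear (x ∷ y ∷ s ∷ []) v₂ (v₁ :+ :- v₀) (v₀ :+ v₂) v₁ eq) s∈)
            colour′ : ∀ {s} → Clash s → Fin 2
            colour′ (inj₁ _) = 0F
            colour′ (inj₂ (inj₁ _)) = 0F
            colour′ (inj₂ (inj₂ _)) = 1F
            same-colour′ : ∀ {s s′} → InSpan s → InSpan s′ → (c : Clash s) (c′ : Clash s′) →
                colour′ c ≡ colour′ c′ → s ≈ s′
            same-colour′ s∈ s′∈ (inj₁ p) _ _ = ⊥-elim (not-first s∈ p)
            same-colour′ s∈ s′∈ (inj₂ _) (inj₁ p) _ = ⊥-elim (not-first s′∈ p)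
            same-colour′ _ _ (inj₂ (inj₁ p)) (inj₂ (inj₁ q)) _ = clash₂ p q
            same-colour′ _ _ (inj₂ (inj₂ p)) (inj₂ (inj₂ q)) _ = clash₃ p q

          -- Here -2x lies in the same coset as -(x + y), so x, x + t and -2x - 2t are outer with
          -- sum -t. As 3x is outside the span, they are distinct.
          impossible₃′ : InSpan (y ∙ x ⁻¹) → ¬ InSpan (x ∙ (x ∙ x)) → ⊥
          impossible₃′ y-x∈ 3x∉ = triples (proj₁ x-outer) (proj₁ (Outer-t x-outer)) (proj₁ z-outer)
            (λ eq → t≉ε (linear (x ∷ t ∷ []) v₁ :0 (v₀ :+ v₁) v₀ (sym eq)))
            (λ eq → 3x∉ (span-resp (linear (x ∷ t ∷ []) (:- (v₁ :+ v₁)) (v₀ :+ (v₀ :+ v₀)) (:- (v₀ :+ v₀) :+ :- (v₁ :+ v₁)) v₀ (sym eq))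
                            (span-⁻¹ (span-∙ span-t span-t))))
            (λ eq → 3x∉ (span-resp (linear (x ∷ t ∷ []) (:- (v₁ :+ (v₁ :+ v₁))) (v₀ :+ (v₀ :+ v₀)) (:- (v₀ :+ v₀) :+ :- (v₁ :+ v₁)) (v₀ :+ v₁) (sym eq))
                            (span-⁻¹ (span-∙ span-t (span-∙ span-t span-t)))))
            (solve (x ∷ t ∷ []) (v₀ :+ (v₀ :+ v₁ :+ (:- (v₀ :+ v₀) :+ :- (v₁ :+ v₁)))) (:- v₁))
            where
            z-outer : Outer ((x ∙ x) ⁻¹ ∙ (t ∙ t) ⁻¹)
            z-outer = Outer-resp (solve (x ∷ y ∷ t ∷ []) (:- (v₀ :+ v₁) :+ (v₁ :+ :- v₀ :+ :- (v₂ :+ v₂))) (:- (v₀ :+ v₀) :+ :- (v₂ :+ v₂)))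
              (Outer-span (span-∙ y-x∈ (span-⁻¹ (span-∙ span-t span-t))) xy⁻¹-outer)

      Outer-∙ : ∀ {x y} (x-outer : Outer x) (y-outer : Outer y) → ¬ ¬ (x ∙ y ∈) → Outer (x ∙ y)
      Outer-∙ {x} {y} x-outer y-outer ¬¬∈ = decidable-stable (∈? (x ∙ y)) ¬¬∈ , ∙∉span x-outer y-outer

      generated : (∀ x → ¬ Outer x) → ∀ x → InSpan x
      generated no-outer x with x ≈? ε | ∈? x
      ... | yes eq | _ = span-resp (sym eq) span-ε
      ... | no _ | yes x∈ = decidable-stable (InSpan? x) λ x∉ → no-outer x (x∈ , x∉)
      ... | no x≉ε | no x∉ = span-resp (solve (x ∷ []) (:- :- v₀) v₀)
              (span-⁻¹ (decidable-stable (InSpan? (x ⁻¹)) λ s → no-outer (x ⁻¹) (∉⇒⁻¹∈ x≉ε x∉ , s)))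

      -- By `impossible₅` the outer members are closed under addition, hence there are none and t
      -- generates G.
      order-5 : t ∙ (t ∙ (t ∙ (t ∙ t))) ≈ ε → G ≅ ℤ/ 5
      order-5 5t≈ε = cyclic≅ exact (generated λ x o → closed⇒empty o λ o′ → Outer-∙ o′ o λ ∉ → impossible₅ o′ o ∉ exact)
        where
        exact : ExactOrder 5 t
        exact = record { vanishes = linear (t ∷ []) (v₀ :+ (v₀ :+ (v₀ :+ (v₀ :+ (v₀ :+ :0))))) :0 (v₀ :+ (v₀ :+ (v₀ :+ (v₀ :+ v₀)))) :0 5t≈ε
                       ; minimal = minimal }
          where
          minimal : ∀ r → 0 < r → r < 5 → ¬ (r · t ≈ ε)
          minimal 1 _ _ eq = t≉ε (trans (sym (identityʳ t)) eq)
          minimal 2 _ _ eq = t≉ε (double≈ε (linear (t ∷ []) (v₀ :+ v₀) :0 (v₀ :+ (v₀ :+ :0)) :0 eq))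
          minimal 3 _ _ eq = t≉ε (linear (t ∷ []) v₀ :0 (v₀ :+ (v₀ :+ (v₀ :+ :0)) :+ (v₀ :+ (v₀ :+ (v₀ :+ :0))) :+ :0)
            (:0 :+ :0 :+ (v₀ :+ (v₀ :+ (v₀ :+ (v₀ :+ v₀))))) (∙-cong (∙-cong eq eq) (sym 5t≈ε)))
          minimal 4 _ _ eq = t≉ε (linear (t ∷ []) v₀ :0 ((v₀ :+ (v₀ :+ (v₀ :+ (v₀ :+ v₀)))) :+ :0) (:0 :+ (v₀ :+ (v₀ :+ (v₀ :+ (v₀ :+ :0)))))
            (∙-cong 5t≈ε (sym eq)))
          minimal (suc (suc (suc (suc (suc r))))) _ (s≤s (s≤s (s≤s (s≤s (s≤s ()))))) eq

      module Order3 (3t≈ε : t ∙ (t ∙ t) ≈ ε) where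
        exact : ExactOrder 3 t
        exact = record { vanishes = linear (t ∷ []) (v₀ :+ (v₀ :+ (v₀ :+ :0))) :0 (v₀ :+ (v₀ :+ v₀)) :0 3t≈ε ; minimal = minimal }
          where
          minimal : ∀ r → 0 < r → r < 3 → ¬ (r · t ≈ ε)
          minimal 1 _ _ eq = t≉ε (trans (sym (identityʳ t)) eq)
          minimal 2 _ _ eq = t≉ε (double≈ε (linear (t ∷ []) (v₀ :+ v₀) :0 (v₀ :+ (v₀ :+ :0)) :0 eq))
          minimal (suc (suc (suc r))) _ (s≤s (s≤s (s≤s ()))) eq
        open ExactOrder exact using (vanishes; distinct)

        span₃ : ∀ {x} → InSpan x → ∃[ i ] x ≈ toℕ {3} i · t
        span₃ (j , eq) = fromℕ< (DivMod.m%n<n j 3) , trans eq (trans (·-reduce 3 vanishes j)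
          (·-congˡ (≡.sym (Finₚ.toℕ-fromℕ< (DivMod.m%n<n j 3)))))

        -- Without outer members G would be the span, of order 3, whereas 2 ≤ n makes the order at
        -- least 5.
        outer-exists : ¬ (∀ x → ¬ Outer x)
        outer-exists no-outer = ℕₚ.<⇒≱ (s≤s (s≤s (s≤s z≤n))) (ℕₚ.≤-trans (ℕₚ.+-mono-≤ 2≤n 2≤n)
          (ℕₚ.≤-reflexive (≡.sym (ℕₚ.suc-injective (bijection⇒size≡ (λ (i : Fin 3) → toℕ i · t)
            (ExactOrder.·-injective exact) (λ x → let i , eq = span₃ (generated no-outer x) in i , sym eq))))))

        outer-∙ : ∀ {x y} → Outer x → Outer y → ¬ InSpan (y ∙ x ⁻¹) → Outer (x ∙ y)
        outer-∙ o o′ ∉span = Outer-∙ o o′ λ ∉ → impossible₃ o o′ ∉ exact ∉span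

        -- If 3x were outside the span, `impossible₃` and `impossible₃′` together would close the
        -- outer members under adding x.
        triple∈span : ∀ {x} → Outer x → InSpan (x ∙ (x ∙ x))
        triple∈span {x} o = decidable-stable (InSpan? (x ∙ (x ∙ x))) λ 3x∉ → closed⇒empty o λ {y} o′ →
          Outer-resp (comm x y) (Outer-∙ o o′ λ ∉ → absurd o′ ∉ 3x∉ (InSpan? (y ∙ x ⁻¹)))
          where
          absurd : ∀ {y} → Outer y → ¬ (x ∙ y ∈) → ¬ InSpan (x ∙ (x ∙ x)) → Dec (InSpan (y ∙ x ⁻¹)) → ⊥
          absurd o′ ∉ 3x∉ (yes s) = impossible₃′ o o′ ∉ s 3x∉
          absurd o′ ∉ 3x∉ (no s) = impossible₃ o o′ ∉ exact s

        -- Two different cosets would make x + y, then 2x + y and x + 2y, and finally 3x + 3y outer,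
        -- although 3x and 3y lie in the span.
        one-coset : ∀ {x y} → Outer x → Outer y → InSpan (y ∙ x ⁻¹)
        one-coset {x} {y} o o′ = decidable-stable (InSpan? (y ∙ x ⁻¹)) λ y-x∉ →
          let xy  = outer-∙ o o′ y-x∉
              2xy = outer-∙ xy o (λ s → proj₂ o′ (span-resp (solve (x ∷ y ∷ []) (:- (v₀ :+ :- (v₀ :+ v₁))) v₁) (span-⁻¹ s)))
              x2y = outer-∙ xy o′ (λ s → proj₂ o (span-resp (solve (x ∷ y ∷ []) (:- (v₁ :+ :- (v₀ :+ v₁))) v₀) (span-⁻¹ s)))
              sum = outer-∙ 2xy x2y (λ s → y-x∉ (span-resp (solve (x ∷ y ∷ []) (v₀ :+ v₁ :+ v₁ :+ :- (v₀ :+ v₁ :+ v₀)) (v₁ :+ :- v₀)) s))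
          in proj₂ sum (span-resp (solve (x ∷ y ∷ []) (v₀ :+ (v₀ :+ v₀) :+ (v₁ :+ (v₁ :+ v₁))) (v₀ :+ v₁ :+ v₀ :+ (v₀ :+ v₁ :+ v₁)))
               (span-∙ (triple∈span o) (triple∈span o′)))

        module _ {x} (o : Outer x) where
          list : Fin 4 → Carrier
          list 0F = t
          list 1F = x
          list 2F = x ∙ t
          list 3F = x ∙ (t ∙ t)

          2t≉ε : ¬ (t ∙ t ≈ ε)
          2t≉ε eq = t≉ε (double≈ε eq)

          span-diff : ∀ {s} → InSpan s → ¬ (t ≈ x ∙ s)
          span-diff {s} s∈ eq = proj₂ o (span-resp (linear (x ∷ s ∷ t ∷ []) (v₂ :+ :- v₁) v₀ v₂ (v₀ :+ v₁) eq) (span-∙ span-t (span-⁻¹ s∈)))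

          t≉x : ¬ (t ≈ x)
          t≉x eq = span-diff span-ε (trans eq (sym (identityʳ x)))

          list-injective : ∀ i j → list i ≈ list j → i ≡ j
          list-injective 0F 0F _ = ≡.refl
          list-injective 1F 1F _ = ≡.refl
          list-injective 2F 2F _ = ≡.refl
          list-injective 3F 3F _ = ≡.refl
          list-injective 0F 1F eq = ⊥-elim (t≉x eq)
          list-injective 1F 0F eq = ⊥-elim (t≉x (sym eq))
          list-injective 0F 2F eq = ⊥-elim (span-diff span-t eq)
          list-injective 2F 0F eq = ⊥-elim (span-diff span-t (sym eq))
          list-injective 0F 3F eq = ⊥-elim (span-diff (span-∙ span-t span-t) eq)
          list-injective 3F 0F eq = ⊥-elim (span-diff (span-∙ span-t span-t) (sym eq))
          list-injective 1F 2F eq = ⊥-elim (t≉ε (linear (x ∷ t ∷ []) v₁ :0 (v₀ :+ v₁) v₀ (sym eq)))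
          list-injective 2F 1F eq = ⊥-elim (t≉ε (linear (x ∷ t ∷ []) v₁ :0 (v₀ :+ v₁) v₀ eq))
          list-injective 1F 3F eq = ⊥-elim
              (2t≉ε (linear (x ∷ t ∷ []) (v₁ :+ v₁) :0 (v₀ :+ (v₁ :+ v₁)) v₀ (sym eq)))
          list-injective 3F 1F eq = ⊥-elim (2t≉ε (linear (x ∷ t ∷ []) (v₁ :+ v₁) :0 (v₀ :+ (v₁ :+ v₁)) v₀ eq))
          list-injective 2F 3F eq = ⊥-elim
              (t≉ε (linear (x ∷ t ∷ []) v₁ :0 (v₀ :+ (v₁ :+ v₁)) (v₀ :+ v₁) (sym eq)))
          list-injective 3F 2F eq = ⊥-elim (t≉ε (linear (x ∷ t ∷ []) v₁ :0 (v₀ :+ (v₁ :+ v₁)) (v₀ :+ v₁) eq))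

          list-∈ : ∀ i → list i ∈
          list-∈ 0F = t∈
          list-∈ 1F = proj₁ o
          list-∈ 2F = proj₁ (Outer-t o)
          list-∈ 3F = proj₁ (Outer-span (span-∙ span-t span-t) o)

          listed : ∀ {y} → y ∈ → ∃[ i ] list i ≈ y
          listed {y} y∈ = decide (InSpan? y)
            where
            inner : (∃[ i ] y ≈ toℕ {3} i · t) → ∃[ i ] list i ≈ y
            inner (0F , eq) = ⊥-elim (∈⇒≉ε y∈ eq)
            inner (1F , eq) = 0F , sym (trans eq (identityʳ t))
            inner (2F , eq) = ⊥-elim (∈⇒⁻¹∉ t∈ (∈-resp
              (linear (t ∷ y ∷ []) v₁ (:- v₀) (v₁ :+ (v₀ :+ (v₀ :+ v₀))) (v₀ :+ (v₀ :+ :0) :+ :0) (∙-cong eq 3t≈ε)) y∈))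
            outer : (∃[ i ] y ∙ x ⁻¹ ≈ toℕ {3} i · t) → ∃[ i ] list i ≈ y
            outer (0F , eq) = 1F , linear (x ∷ y ∷ []) v₀ v₁ :0 (v₁ :+ :- v₀) (sym eq)
            outer (1F , eq) = 2F , linear (x ∷ y ∷ t ∷ []) (v₀ :+ v₂) v₁ (v₂ :+ :0) (v₁ :+ :- v₀) (sym eq)
            outer (2F , eq) = 3F , linear (x ∷ y ∷ t ∷ []) (v₀ :+ (v₂ :+ v₂)) v₁ (v₂ :+ (v₂ :+ :0))
                (v₁ :+ :- v₀) (sym eq)
            decide : Dec (InSpan y) → ∃[ i ] list i ≈ y
            decide (yes s) = inner (span₃ s)
            decide (no y∉) = outer (span₃ (one-coset o (y∈ , y∉)))

          total≈sum-list : total ≈ sum list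
          total≈sum-list = sum-embed (index ∘ list) (λ i j eq → list-injective i j (index-injective eq))
            {λ i → pick (χ (elem i)) (elem i)}
            (λ i → trans (reflexive (cong (λ b → pick b (elem (index (list i)))) (∈-resp (sym (elem-index (list i))) (list-∈ i))))
                         (elem-index (list i)))
            (λ j miss → unlisted j miss (χ (elem j)) ≡.refl)
            where
            unlisted : ∀ j → (∀ i → index (list i) ≢ j) → ∀ b → χ (elem j) ≡ b → pick b (elem j) ≈ ε
            unlisted j miss true eq = ⊥-elim (let i , p = listed eq in miss i (≡.trans (index-cong p) (index-elem j)))
            unlisted j miss false _ = refl

          -- The half-set consists of t, x, x + t, x + 2t, so its total -2t equals 3x + 4t; hence 3x
          -- = -6t = 0.
          3x≈ε : x ∙ (x ∙ x) ≈ ε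
          3x≈ε = linear (x ∷ t ∷ []) (v₀ :+ (v₀ :+ v₀)) :0
            (v₁ :+ (v₀ :+ (v₀ :+ v₁ :+ (v₀ :+ (v₁ :+ v₁) :+ :0))) :+ (:0 :+ :0))
            (:- (v₁ :+ v₁) :+ (v₁ :+ (v₁ :+ v₁) :+ (v₁ :+ (v₁ :+ v₁))))
            (∙-cong (trans (sym total≈sum-list) total≈) (∙-cong (sym 3t≈ε) (sym 3t≈ε)))

          Generated : Carrier → Set ℓ
          Generated y = ∃[ i ] ∃[ j ] y ≈ i · t ∙ j · x

          generated-⁻¹ : ∀ {y} → Generated y → Generated (y ⁻¹)
          generated-⁻¹ {y} (i , j , eq) = (n + n) * i , (n + n) * j , trans (⁻¹-cong eq)
              (trans (solve (i · t ∷ j · x ∷ []) (:- (v₀ :+ v₁)) (:- v₀ :+ :- v₁))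
            (∙-cong (trans (sym (pred·≈⁻¹ (i · t))) (·-assocˡ t (n + n) i)) (trans (sym (pred·≈⁻¹ (j · x))) (·-assocˡ x (n + n) j))))

          member-generated : ∀ {y} → y ∈ → Generated y
          member-generated {y} y∈ = let i , eq = listed y∈ in coordinates i eq
            where
            coordinates : ∀ i → list i ≈ y → Generated y
            coordinates 0F eq = 1 , 0 , trans (sym eq) (solve (t ∷ []) v₀ (v₀ :+ :0 :+ :0))
            coordinates 1F eq = 0 , 1 , trans (sym eq) (solve (x ∷ []) v₀ (:0 :+ (v₀ :+ :0)))
            coordinates 2F eq = 1 , 1 , trans (sym eq) (solve (x ∷ t ∷ []) (v₀ :+ v₁) (v₁ :+ :0 :+ (v₀ :+ :0)))
            coordinates 3F eq = 2 , 1 , trans (sym eq)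
                (solve (x ∷ t ∷ []) (v₀ :+ (v₁ :+ v₁)) (v₁ :+ (v₁ :+ :0) :+ (v₀ :+ :0)))

          all-generated : ∀ y → Generated y
          all-generated y with y ≈? ε | ∈? y
          ... | yes eq | _ = 0 , 0 , trans eq (sym (identityˡ ε))
          ... | no _ | yes y∈ = member-generated y∈
          ... | no y≉ε | no y∉ = let i , j , eq = generated-⁻¹ (member-generated (∉⇒⁻¹∈ y≉ε y∉))
                                 in i , j , trans (solve (y ∷ []) v₀ (:- :- v₀)) eq

          x-part : ∀ i j i′ j′ → toℕ {3} i · t ∙ toℕ {3} j · x ≈ toℕ {3} i′ · t ∙ toℕ {3} j′ · x →
              InSpan (toℕ j · x ∙ (toℕ j′ · x) ⁻¹)
          x-part i j i′ j′ eq = span-resp (linear (toℕ i · t ∷ toℕ j · x ∷ toℕ i′ · t ∷ toℕ j′ · x ∷ [])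
              (v₂ :+ :- v₀) (v₁ :+ :- v₃) (v₂ :+ v₃) (v₀ :+ v₁) (sym eq))
            (span-∙ (toℕ i′ , refl) (span-⁻¹ (toℕ i , refl)))

          x-distinct : ∀ j j′ → InSpan (toℕ {3} j · x ∙ (toℕ {3} j′ · x) ⁻¹) → j ≡ j′
          x-distinct 0F 0F _ = ≡.refl
          x-distinct 1F 1F _ = ≡.refl
          x-distinct 2F 2F _ = ≡.refl
          x-distinct 0F 1F s = ⊥-elim (proj₂ o (span-resp (solve (x ∷ []) (:- (:0 :+ :- (v₀ :+ :0))) v₀) (span-⁻¹ s)))
          x-distinct 1F 0F s = ⊥-elim (proj₂ o (span-resp (solve (x ∷ []) (v₀ :+ :0 :+ :- :0) v₀) s))
          x-distinct 1F 2F s = ⊥-elim (proj₂ o (span-resp (solve (x ∷ []) (:- (v₀ :+ :0 :+ :- (v₀ :+ (v₀ :+ :0)))) v₀) (span-⁻¹ s)))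
          x-distinct 2F 1F s = ⊥-elim (proj₂ o (span-resp (solve (x ∷ []) (v₀ :+ (v₀ :+ :0) :+ :- (v₀ :+ :0)) v₀) s))
          x-distinct 0F 2F s = ⊥-elim (proj₂ o (span-resp (linear (x ∷ []) (:0 :+ :- (v₀ :+ (v₀ :+ :0))) v₀ :0 (v₀ :+ (v₀ :+ v₀)) (sym 3x≈ε)) s))
          x-distinct 2F 0F s = ⊥-elim (proj₂ o (span-resp
            (linear (x ∷ []) (:- (v₀ :+ (v₀ :+ :0) :+ :- :0)) v₀ :0 (v₀ :+ (v₀ :+ v₀)) (sym 3x≈ε)) (span-⁻¹ s)))

          independent : ∀ i j i′ j′ → toℕ {3} i · t ∙ toℕ {3} j · x ≈ toℕ {3} i′ · t ∙ toℕ {3} j′ · x →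
              i ≡ i′ × j ≡ j′
          independent i j i′ j′ eq = ExactOrder.·-injective exact i i′
              (linear (toℕ i · t ∷ toℕ i′ · t ∷ toℕ j · x ∷ []) v₀ v₁ (v₀ :+ v₂) (v₁ :+ v₂)
                (trans eq (∙-congˡ (·-congˡ (cong toℕ (≡.sym j≡)))))) ,
            j≡
            where
            j≡ : j ≡ j′
            j≡ = x-distinct j j′ (x-part i j i′ j′ eq)

          bicyclic : G ≅ (ℤ/ 3 ⊕ ℤ/ 3)
          bicyclic = bicyclic≅ vanishes (linear (x ∷ []) (v₀ :+ (v₀ :+ (v₀ :+ :0))) :0 (v₀ :+ (v₀ :+ v₀)) :0 3x≈ε) independent all-generated

      exceptional : (G ≅ ℤ/ 5) ⊎ (G ≅ (ℤ/ 3 ⊕ ℤ/ 3))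
      exceptional = decide (t ∙ (t ∙ t) ≈? ε) (t ∙ (t ∙ (t ∙ (t ∙ t))) ≈? ε)
          (exists? {P = Outer} (λ x → ∈? x ×-dec ¬? (InSpan? x)) Outer-resp)
        where
        decide : Dec (t ∙ (t ∙ t) ≈ ε) → Dec (t ∙ (t ∙ (t ∙ (t ∙ t))) ≈ ε) → Dec (∃ Outer) →
            (G ≅ ℤ/ 5) ⊎ (G ≅ (ℤ/ 3 ⊕ ℤ/ 3))
        decide (no ¬3) (no ¬5) _ = ⊥-elim (ExactOrder-3or5 (¬3 , ¬5))
        decide (no _) (yes 5t≈ε) _ = inj₁ (order-5 5t≈ε)
        decide (yes 3t≈ε) _ (yes (x , o)) = inj₂ (Order3.bicyclic 3t≈ε o)
        decide (yes 3t≈ε) _ (no none) = ⊥-elim (Order3.outer-exists 3t≈ε λ x o → none (x , o))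

  exists : ¬ (G ≅ ℤ/ 5) → ¬ (G ≅ (ℤ/ 3 ⊕ ℤ/ 3)) → M⁰S G (Nonzero G) 2 n n 2 1
  exists ≇5 ≇9 = search (total ≈? ε) (∈? τ) one? two?
    where
    open HalfSet initial
    -- Each flip lowers the total by twice the flipped element, so the flipped elements have to sum
    -- to half the total.
    τ : Carrier
    τ = half total
    One : Set _
    One = ∃[ x ] ∃[ y ] (x ∈ × y ∈ × ¬ (x ≈ y) × x ∙ y ≈ τ)
    one? : Dec One
    one? = exists? (λ x → exists? (λ y → ∈? x ×-dec ∈? y ×-dec ¬? (x ≈? y) ×-dec (x ∙ y ≈? τ))
        (λ { eq (p , q , r , s) → p , ∈-resp eq q , (λ e → r (trans e (sym eq))) , trans (∙-congˡ (sym eq)) s }))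
      (λ { eq (y , p , q , r , s) → y , ∈-resp eq p , q , (λ e → r (trans eq e)) , trans (∙-congʳ (sym eq)) s })
    Two : Set _
    Two = ∃[ x ] ∃[ y ] ∃[ z ] (x ∈ × y ∈ × z ∈ × ¬ (x ≈ y) × ¬ (x ≈ z) × ¬ (y ≈ z) × x ∙ (y ∙ z) ≈ τ)
    two? : Dec Two
    two? = exists? (λ x → exists? (λ y → exists? (λ z →
          ∈? x ×-dec ∈? y ×-dec ∈? z ×-dec ¬? (x ≈? y) ×-dec ¬? (x ≈? z) ×-dec ¬? (y ≈? z) ×-dec
              (x ∙ (y ∙ z) ≈? τ))
          (λ { eq (p , q , r , a , b , c , s) →
            p , q , ∈-resp eq r , a , (λ e → b (trans e (sym eq))) , (λ e → c (trans e (sym eq))) , trans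
                (∙-congˡ (∙-congˡ (sym eq))) s }))
        (λ { eq (z , p , q , r , a , b , c , s) →
          z , p , ∈-resp eq q , r , (λ e → a (trans e (sym eq))) , b , (λ e → c (trans eq e)) , trans
              (∙-congˡ (∙-congʳ (sym eq))) s }))
      (λ { eq (y , z , p , q , r , a , b , c , s) →
        y , z , ∈-resp eq p , q , r , (λ e → a (trans eq e)) , (λ e → b (trans eq e)) , c , trans
            (∙-congʳ (sym eq)) s })
    search : Dec (total ≈ ε) → Dec (τ ∈) → Dec One → Dec Two → M⁰S G (Nonzero G) 2 n n 2 1
    search (yes zero-total) _ _ _ = zero-total⇒two-rows initial zero-total
    search _ (yes τ∈) _ _ = zero-total⇒two-rows F.flip
        (linear (HalfSet.total F.flip ∷ total ∷ τ ∷ []) v₀ :0 (v₀ :+ (v₂ :+ v₂) :+ v₁) (v₁ :+ (v₂ :+ v₂))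
          (∙-cong F.flip-total (sym (half∙half total))))
      where module F = Flip initial τ τ∈
    search _ _ (yes (x , y , x∈ , y∈ , x≉y , eq)) _ = zero-total⇒two-rows F₂.flip
        (linear (HalfSet.total F₂.flip ∷ HalfSet.total F₁.flip ∷ total ∷ τ ∷ x ∷ y ∷ []) v₀ :0
          (v₀ :+ (v₅ :+ v₅) :+ (v₁ :+ (v₄ :+ v₄)) :+ v₂ :+ (v₃ :+ v₃))
              (v₁ :+ v₂ :+ (v₃ :+ v₃) :+ (v₄ :+ v₅ :+ (v₄ :+ v₅)))
          (∙-cong (∙-cong (∙-cong F₂.flip-total F₁.flip-total) (sym (half∙half total))) (∙-cong (sym eq) (sym eq))))
      where
      module F₁ = Flip initial x x∈
      module F₂ = Flip F₁.flip y (F₁.flip-∈ y∈ (λ e → x≉y (sym e)))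
    search _ _ _ (yes (x , y , z , x∈ , y∈ , z∈ , x≉y , x≉z , y≉z , eq)) = zero-total⇒two-rows F₃.flip
        (linear (HalfSet.total F₃.flip ∷ total ∷ τ ∷ x ∷ y ∷ z ∷ []) v₀ :0
          (v₀ :+ (v₅ :+ v₅) :+ (v₄ :+ v₄) :+ (v₃ :+ v₃) :+ v₁ :+ (v₂ :+ v₂))
              (v₁ :+ (v₂ :+ v₂) :+ (v₃ :+ (v₄ :+ v₅) :+ (v₃ :+ (v₄ :+ v₅))))
          (∙-cong (∙-cong (trans (∙-congʳ (trans (∙-congʳ F₃.flip-total) F₂.flip-total)) F₁.flip-total) (sym (half∙half total)))
             (∙-cong (sym eq) (sym eq))))
      where
      module F₁ = Flip initial x x∈
      module F₂ = Flip F₁.flip y (F₁.flip-∈ y∈ (λ e → x≉y (sym e)))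
      module F₃ = Flip F₂.flip z (F₂.flip-∈ (F₁.flip-∈ z∈ (λ e → x≉z (sym e))) (λ e → y≉z (sym e)))
    -- As τ is nonzero and no member, its inverse is a member; it plays the role of t in `Stuck`.
    search (no total≉ε) (no τ∉) (no ¬one) (no ¬two) = ⊥-elim ([ ≇5 , ≇9 ]′ S.exceptional)
      where
      τ≉ε : ¬ (τ ≈ ε)
      τ≉ε eq = total≉ε (trans (sym (half∙half total)) (trans (∙-cong eq eq) (identityˡ ε)))
      τ⁻¹⁻¹ : τ ⁻¹ ⁻¹ ≈ τ
      τ⁻¹⁻¹ = solve (τ ∷ []) (:- :- v₀) v₀
      module S = Stuck initial (τ ⁻¹)
        (trans (sym (half∙half total)) (solve (τ ∷ []) (v₀ :+ v₀) (:- (:- v₀ :+ :- v₀))))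
        (∉⇒⁻¹∈ τ≉ε τ∉)
        (λ {x} {y} x∈ y∈ eq → decidable-stable (x ≈? y) λ x≉y → ¬one (x , y , x∈ , y∈ , x≉y , trans eq τ⁻¹⁻¹))
        (λ {x} {y} {z} x∈ y∈ z∈ x≉y x≉z y≉z eq → ¬two (x , y , z , x∈ , y∈ , z∈ , x≉y , x≉z , y≉z , trans eq τ⁻¹⁻¹))

module _ {g ℓ} (G : AbelianGroup g ℓ) {n : ℕ} where
  open AbelianGroup G

  two-rows-nonzero : 2 ≤ n → HasOrder G (2 * n + 1) →
                     M⁰ G (Nonzero G) 2 n n 2 ⇔ ((¬ (G ≅ ℤ/ 5)) × (¬ (G ≅ (ℤ/ 3 ⊕ ℤ/ 3))))
  two-rows-nonzero 2≤n order = mk⇔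
    (λ A → (λ iso → not-5 A (order-of {n} (≅⇒order≡ G (ℤ/ 5) order (ℤ/-order 5) iso))) ,
           (λ iso → not-9 A iso (order-of {n} (≅⇒order≡ G (ℤ/ 3 ⊕ ℤ/ 3) order (⊕-order {G = ℤ/ 3} {ℤ/ 3} (ℤ/-order 3) (ℤ/-order 3)) iso))))
    (λ (≇5 , ≇9) → NoFlip.exists G 2≤n (subst (HasOrder G) (lemma n) order) ≇5 ≇9)
    where
    lemma : ∀ n → 2 * n + 1 ≡ suc (n + n)
    lemma = solve-∀
    order-of : ∀ {m k} → 2 * m + 1 ≡ suc (2 * k) → m ≡ k
    order-of {m} {k} eq = ℕₚ.*-cancelˡ-≡ m k 2 (ℕₚ.suc-injective (≡.trans (ℕₚ.+-comm 1 (2 * m)) eq))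
    not-5 : M⁰ G (Nonzero G) 2 n n 2 → n ≢ 2
    not-5 A ≡.refl = FullArrays.no-2×2 G 0F A
    not-9 : M⁰ G (Nonzero G) 2 n n 2 → G ≅ (ℤ/ 3 ⊕ ℤ/ 3) → n ≢ 4
    not-9 A (φ , iso) ≡.refl = FullArrays.no-2×4-of-exponent-3 G exponent A
      where
      module H = AbelianGroup (ℤ/ 3 ⊕ ℤ/ 3)
      open Morphisms.GroupMorphisms.IsGroupIsomorphism iso
      exponent : ∀ x → x ∙ (x ∙ x) ≈ ε
      exponent x = injective (begin
        φ (x ∙ (x ∙ x))            ≈⟨ ∙-homo x (x ∙ x) ⟩
        φ x H.∙ φ (x ∙ x)          ≈⟨ H.∙-congˡ {φ x} {φ (x ∙ x)} {φ x H.∙ φ x} (∙-homo x x) ⟩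
        φ x H.∙ (φ x H.∙ φ x)      ≈⟨ triple (proj₁ (φ x)) , triple (proj₂ (φ x)) ⟩
        H.ε                        ≈⟨ ε-homo ⟨
        φ ε                        ∎)
        where
        open import Relation.Binary.Reasoning.Setoid H.setoid
        thrice : ∀ y → y ℤ.+ (y ℤ.+ y) ℤ.- ℤ.0ℤ ≡ y ℤ.* ℤ.+ 3
        thrice = ℤRing.solve-∀
        triple : ∀ y → (y ℤ.+ (y ℤ.+ y)) ≡[mod 3 ] ℤ.0ℤ
        triple y = ℤ∣.divides y (thrice y)

-- Signed partitions of 1, …, N

private module ℕΣ = MonoidSums ℕₚ.+-0-commutativeMonoid

-- Finite sets of naturals are compared through the sums of an arbitrary f over
-- them, so that reordering a partition is commutativity of addition.
progression : ℕ → (ℕ → ℕ) → ℕ → ℕ → ℕ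
progression d f a zero = 0
progression d f a (suc n) = f a + progression d f (d + a) n

interval : (ℕ → ℕ) → ℕ → ℕ → ℕ
interval = progression 1

progression-+ : ∀ d f a m n {b} → a + m * d ≡ b →
                progression d f a m + progression d f b n ≡ progression d f a (m + n)
progression-+ d f a zero n {b} eq = cong (λ b → progression d f b n) (≡.trans (≡.sym eq) (ℕₚ.+-identityʳ a))
progression-+ d f a (suc m) n eq = ≡.trans (ℕₚ.+-assoc (f a) _ _)
  (cong (λ z → f a + z) (progression-+ d f (d + a) m n (≡.trans (lemma d a m) eq)))
  where
  lemma : ∀ d a m → d + a + m * d ≡ a + (d + m * d)
  lemma = solve-∀

interval-+ : ∀ f a m n {b} → a + m ≡ b → interval f a m + interval f b n ≡ interval f a (m + n)
interval-+ f a m n eq = progression-+ 1 f a m n (≡.trans (cong (λ z → a + z) (ℕₚ.*-identityʳ m)) eq)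

progression-shift : ∀ d f k a n → progression d (λ x → f (k + x)) a n ≡ progression d f (k + a) n
progression-shift d f k a zero = ≡.refl
progression-shift d f k a (suc n) = cong (λ z → f (k + a) + z) (≡.trans (progression-shift d f k (d + a) n)
  (cong (λ b → progression d f b n) (lemma k d a)))
  where
  lemma : ∀ k d a → k + (d + a) ≡ d + (k + a)
  lemma = solve-∀

progression-last : ∀ d f a n → progression d f a (suc n) ≡ f (a + n * d) + progression d f a n
progression-last d f a n = ≡.trans (cong (progression d f a) (≡.sym (ℕₚ.+-comm n 1)))
  (≡.trans (≡.sym (progression-+ d f a n 1 ≡.refl))
    (≡.trans (ℕₚ.+-comm (progression d f a n) _) (cong (_+ progression d f a n) (ℕₚ.+-identityʳ _))))

interleave : ∀ f a m → progression 2 f a m + progression 2 f (suc a) m ≡ interval f a (m + m)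
interleave f a zero = ≡.refl
interleave f a (suc m) = ≡.trans (lemma (f a) _ (f (suc a)) _)
  (cong (λ z → f a + z) (≡.trans (cong (λ z → f (suc a) + z) (interleave f (2 + a) m)) (cong (λ k → interval f (suc a) k) (≡.sym (ℕₚ.+-suc m m)))))
  where
  lemma : ∀ a b c d → a + b + (c + d) ≡ a + (c + (b + d))
  lemma = solve-∀

interleave′ : ∀ f a m → progression 2 f a (suc m) + progression 2 f (suc a) m ≡ interval f a (suc (m + m))
interleave′ f a m = ≡.trans (lemma (f a) _ _) (cong (λ z → f a + z) (interleave f (suc a) m))
  where
  lemma : ∀ a b c → a + b + c ≡ a + (c + b)
  lemma = solve-∀

-- Tiling d f a e v: the pieces summed up in v tile the d-progression from a up to e.
data Tiling (d : ℕ) (f : ℕ → ℕ) : ℕ → ℕ → ℕ → Set where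
  end : ∀ {a} → Tiling d f a a 0
  piece : ∀ {a e v b} m → a + m * d ≡ b → Tiling d f b e v → Tiling d f a e (progression d f a m + v)
  point : ∀ {a e v b} → a + d ≡ b → Tiling d f b e v → Tiling d f a e (f a + v)

tiling-sum : ∀ {d f a e v} → Tiling d f a e v → ∃[ n ] (a + n * d ≡ e × v ≡ progression d f a n)
tiling-sum {a = a} end = 0 , ℕₚ.+-identityʳ a , ≡.refl
tiling-sum {d} {f} {a} (piece {b = b} m eq t) = let n , e≡ , v≡ = tiling-sum t in
  m + n , ≡.trans (lemma a m n d) (≡.trans (cong (_+ n * d) eq) e≡) ,
  ≡.trans (cong (λ z → progression d f a m + z) v≡) (progression-+ d f a m n eq)
  where
  lemma : ∀ a m n d → a + (m + n) * d ≡ a + m * d + n * d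
  lemma = solve-∀
tiling-sum {d} {f} {a} (point {b = b} eq t) = let n , e≡ , v≡ = tiling-sum t in
  suc n , ≡.trans (lemma a n d) (≡.trans (cong (_+ n * d) eq) e≡) ,
  cong (λ z → f a + z) (≡.trans v≡ (cong (λ b → progression d f b n) (≡.trans (≡.sym eq) (ℕₚ.+-comm a d))))
  where
  lemma : ∀ a n d → a + (d + n * d) ≡ a + d + n * d
  lemma = solve-∀

tiled : ∀ {d f a e v} .{{_ : NonZero d}} n → a + n * d ≡ e → Tiling d f a e v → v ≡ progression d f a n
tiled {d} {f} {a} n end≡ t = let m , m≡ , v≡ = tiling-sum t in
  ≡.trans v≡ (cong (progression d f a) (ℕₚ.*-cancelʳ-≡ m n d (ℕₚ.+-cancelˡ-≡ a _ _ (≡.trans m≡ (≡.sym end≡)))))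

sumBlock : ∀ {n} → (ℕ → ℕ) → Vec ℤ n → ℕ
sumBlock f [] = 0
sumBlock f (x ∷ B) = f ∣ x ∣ + sumBlock f B

sumBlocks : ∀ {n} → (ℕ → ℕ) → List (Vec ℤ n) → ℕ
sumBlocks f [] = 0
sumBlocks f (B ∷ L) = sumBlock f B + sumBlocks f L

blockTotal : ∀ {n} → Vec ℤ n → ℤ
blockTotal [] = 0ℤ
blockTotal (x ∷ B) = x ℤ.+ blockTotal B

sumBlock-++ : ∀ {m n} f (A : Vec ℤ m) (B : Vec ℤ n) → sumBlock f (A Vec.++ B) ≡ sumBlock f A + sumBlock f B
sumBlock-++ f [] B = ≡.refl
sumBlock-++ f (x ∷ A) B = ≡.trans (cong (λ z → f ∣ x ∣ + z) (sumBlock-++ f A B))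
    (≡.sym (ℕₚ.+-assoc (f ∣ x ∣) _ _))

blockTotal-++ : ∀ {m n} (A : Vec ℤ m) (B : Vec ℤ n) → blockTotal (A Vec.++ B) ≡ blockTotal A ℤ.+ blockTotal B
blockTotal-++ [] B = ≡.sym (ℤₚ.+-identityˡ _)
blockTotal-++ (x ∷ A) B = ≡.trans (cong (λ z → x ℤ.+ z) (blockTotal-++ A B)) (≡.sym (ℤₚ.+-assoc x _ _))

ZeroBlocks : ∀ {n} → List (Vec ℤ n) → Set
ZeroBlocks = All (λ B → blockTotal B ≡ 0ℤ)

-- For N ≥ 1 the hooked set is 1, ..., N - 1, N + 1. Modulo 2N + 1 it agrees with 1, ..., N up to
-- sign.
exact hooked : ℕ → (ℕ → ℕ) → ℕ
exact N f = interval f 1 N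
hooked zero f = 0
hooked (suc N) f = interval f 1 N + f (2 + N)

record Signed (n : ℕ) (R : (ℕ → ℕ) → ℕ) : Set where
  field
    blocks : List (Vec ℤ n)
    zero-blocks : ZeroBlocks blocks
    covers : ∀ f → sumBlocks f blocks ≡ R f

sumBlocks-1 : ∀ {n} (L : List (Vec ℤ n)) → sumBlocks (const 1) L ≡ length L * n
sumBlocks-1 [] = ≡.refl
sumBlocks-1 (B ∷ L) = cong₂ _+_ (size B) (sumBlocks-1 L)
  where
  size : ∀ {n} (B : Vec ℤ n) → sumBlock (const 1) B ≡ n
  size [] = ≡.refl
  size (x ∷ B) = cong suc (size B)

progression-1 : ∀ d a n → progression d (const 1) a n ≡ n
progression-1 d a zero = ≡.refl
progression-1 d a (suc n) = cong suc (progression-1 d (d + a) n)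

exact-1 : ∀ N → exact N (const 1) ≡ N
exact-1 N = progression-1 1 1 N

hooked-1 : ∀ N → hooked N (const 1) ≡ N
hooked-1 zero = ≡.refl
hooked-1 (suc N) = ≡.trans (cong (_+ 1) (progression-1 1 1 N)) (ℕₚ.+-comm N 1)

zip : ∀ {m n} → List (Vec ℤ m) → List (Vec ℤ n) → List (Vec ℤ (m + n))
zip = List.zipWith Vec._++_

sumBlocks-zip : ∀ {m n} f (K : List (Vec ℤ m)) (L : List (Vec ℤ n)) → length K ≡ length L →
                sumBlocks f (zip K L) ≡ sumBlocks f K + sumBlocks f L
sumBlocks-zip f [] [] _ = ≡.refl
sumBlocks-zip f (A ∷ K) (B ∷ L) eq = ≡.trans
  (cong₂ _+_ (sumBlock-++ f A B) (sumBlocks-zip f K L (ℕₚ.suc-injective eq)))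
  (lemma (sumBlock f A) (sumBlock f B) (sumBlocks f K) (sumBlocks f L))
  where
  lemma : ∀ a b c d → a + b + (c + d) ≡ a + c + (b + d)
  lemma = solve-∀

zero-zip : ∀ {m n} {K : List (Vec ℤ m)} {L : List (Vec ℤ n)} → ZeroBlocks K → ZeroBlocks L →
    ZeroBlocks (zip K L)
zero-zip [] _ = []
zero-zip (_ ∷ _) [] = []
zero-zip {K = A ∷ _} {L = B ∷ _} (a ∷ as) (b ∷ bs) = ≡.trans (blockTotal-++ A B) (cong₂ ℤ._+_ a b) ∷ zero-zip
    as bs

quads : ℕ → ℕ → List (Vec ℤ 4)
quads a zero = []
quads a (suc m) = (+ a ∷ -[1+ a ] ∷ -[1+ suc a ] ∷ + (3 + a) ∷ []) ∷ quads (4 + a) m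

quads-zero : ∀ a m → ZeroBlocks (quads a m)
quads-zero a zero = []
quads-zero a (suc m) = lemma (+ a) ∷ quads-zero (4 + a) m
  where
  lemma : ∀ a → a ℤ.+ (- (+ 1 ℤ.+ a) ℤ.+ (- (+ 2 ℤ.+ a) ℤ.+ (+ 3 ℤ.+ a ℤ.+ 0ℤ))) ≡ 0ℤ
  lemma = ℤRing.solve-∀

quads-covers : ∀ f a m → sumBlocks f (quads a m) ≡ interval f a (m * 4)
quads-covers f a zero = ≡.refl
quads-covers f a (suc m) = ≡.trans
    (cong (λ z → f a + (f (1 + a) + (f (2 + a) + (f (3 + a) + 0))) + z) (quads-covers f (4 + a) m))
  (lemma (f a) (f (1 + a)) (f (2 + a)) (f (3 + a)) (interval f (4 + a) (m * 4)))
  where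
  lemma : ∀ a b c d e → a + (b + (c + (d + 0))) + e ≡ a + (b + (c + (d + e)))
  lemma = solve-∀

quads-length : ∀ a m → length (quads a m) ≡ m
quads-length a zero = ≡.refl
quads-length a (suc m) = cong suc (quads-length (4 + a) m)

System : ℕ → ℕ → Set
System n c = Signed n (exact (n * c)) ⊎ Signed n (hooked (n * c))

blocks-length : ∀ {n c R} .{{_ : NonZero n}} (X : Signed n R) → R (const 1) ≡ n * c →
    length (Signed.blocks X) ≡ c
blocks-length {n} {c} X R1 = ℕₚ.*-cancelʳ-≡ _ c n (≡.trans (≡.sym (sumBlocks-1 (Signed.blocks X)))
  (≡.trans (Signed.covers X (const 1)) (≡.trans R1 (ℕₚ.*-comm n c))))

attach : ∀ {n c R R′} (X : Signed n R) → length (Signed.blocks X) ≡ c → (Q : List (Vec ℤ 4)) → ZeroBlocks Q →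
    length Q ≡ c →
         (∀ f → sumBlocks f Q + R f ≡ R′ f) → Signed (4 + n) R′
attach X len Q Q-zero Q-len eq = record
  { blocks = zip Q (Signed.blocks X)
  ; zero-blocks = zero-zip Q-zero (Signed.zero-blocks X)
  ; covers = λ f → ≡.trans (sumBlocks-zip f Q (Signed.blocks X) (≡.trans Q-len (≡.sym len)))
      (≡.trans (cong (λ z → sumBlocks f Q + z) (Signed.covers X f)) (eq f))
  }

extend-exact : ∀ {n c} (X : Signed n (exact (n * c))) → length (Signed.blocks X) ≡ c →
    Signed (4 + n) (exact ((4 + n) * c))
extend-exact {n} {c} X len = attach X len (quads (1 + n * c) c) (quads-zero _ c) (quads-length _ c) λ f →
  ≡.trans (cong (_+ exact (n * c) f) (quads-covers f (1 + n * c) c))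
    (≡.trans (ℕₚ.+-comm (interval f (1 + n * c) (c * 4)) _)
      (≡.trans (interval-+ f 1 (n * c) (c * 4) ≡.refl) (cong (λ N → exact N f) (lemma n c))))
  where
  lemma : ∀ n c → n * c + c * 4 ≡ (4 + n) * c
  lemma = solve-∀

-- The numbers M + 1, M + 3, M + 4, …, M + 4c, M + 4c + 2 fill the gap of a hooked
-- system on 1, …, M, M + 2 and move the gap to the new end.
hookedQuads : ℕ → ℕ → List (Vec ℤ 4)
hookedQuads M c = (+ (1 + M) ∷ -[1+ 2 + M ] ∷ -[1+ 3 + M + c * 4 ] ∷ + (6 + M + c * 4) ∷ []) ∷ quads (4 + M) c

extend-hooked : ∀ {n c} .{{_ : NonZero n}} (X : Signed n (hooked (n * suc c))) → length (Signed.blocks X) ≡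
    suc c →
                Signed (4 + n) (hooked ((4 + n) * suc c))
extend-hooked {n@(suc n′)} {c} X len = attach X len (hookedQuads M c) (zero-first ∷ quads-zero (4 + M) c)
    (cong suc (quads-length (4 + M) c)) covers
  where
  -- Chosen so that `n * suc c` computes to `suc M` and `hooked` unfolds to 1, ..., M and M + 2.
  M = c + n′ * suc c
  zero-first : blockTotal (+ (1 + M) ∷ -[1+ 2 + M ] ∷ -[1+ 3 + M + c * 4 ] ∷ + (6 + M + c * 4) ∷ []) ≡ 0ℤ
  zero-first = lemma (+ M) (+ (c * 4))
    where
    lemma : ∀ M c → + 1 ℤ.+ M ℤ.+ (- (+ 3 ℤ.+ M) ℤ.+ (- (+ 4 ℤ.+ M ℤ.+ c) ℤ.+ (+ 6 ℤ.+ M ℤ.+ c ℤ.+ 0ℤ))) ≡ 0ℤ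
    lemma = ℤRing.solve-∀
  covers : ∀ f → sumBlocks f (hookedQuads M c) + (interval f 1 M + f (2 + M)) ≡ hooked ((4 + n) * suc c) f
  covers f = ≡.trans (cong (λ z → f (1 + M) + (f (3 + M) + (f (4 + M + c * 4) + (f (6 + M + c * 4) + 0))) + z + (interval f 1 M + f (2 + M)))
                        (quads-covers f (4 + M) c))
    (≡.trans (reorder (f (1 + M)) (f (3 + M)) (f (4 + M + c * 4)) (f (6 + M + c * 4)) (interval f (4 + M) (c * 4)) (interval f 1 M) (f (2 + M)))
      (≡.trans (cong (_+ f (6 + M + c * 4)) (tiled {1} {f} (4 + M + c * 4) (end-lemma M (c * 4)) tiling))
        (≡.trans (cong (λ x → interval f 1 (4 + M + c * 4) + f x) (size₂ M c)) (cong (λ N → hooked N f) (size c n′)))))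
    where
    reorder : ∀ a b c d e g h → a + (b + (c + (d + 0))) + e + (g + h) ≡ g + (a + (h + (b + (e + (c + 0))))) + d
    reorder = solve-∀
    end-lemma : ∀ M c → 1 + (4 + M + c) * 1 ≡ 5 + M + c
    end-lemma = solve-∀
    size : ∀ c n′ → 5 + (c + n′ * suc c) + c * 4 ≡ (5 + n′) * suc c
    size = solve-∀
    size₂ : ∀ M c → 6 + M + c * 4 ≡ 2 + (4 + M + c * 4)
    size₂ M c = ≡.refl
    i₁ : ∀ M → 1 + M * 1 ≡ 1 + M
    i₁ = solve-∀
    i₂ : ∀ M → M + 1 ≡ 1 + M
    i₂ = solve-∀
    i₃ : ∀ M c → M + c * 1 ≡ M + c
    i₃ = solve-∀
    tiling : Tiling 1 f 1 (5 + M + c * 4)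
        (interval f 1 M + (f (1 + M) + (f (2 + M) + (f (3 + M) + (interval f (4 + M) (c * 4) + (f (4 + M + c * 4) + 0))))))
    tiling = piece M (i₁ M) (point (i₂ (1 + M)) (point (i₂ (2 + M)) (point (i₂ (3 + M)) (piece (c * 4) (i₃ (4 + M) (c * 4)) (point (i₂ (4 + M + c * 4)) end)))))

extend : ∀ {n c} .{{_ : NonZero n}} → System n (suc c) → System (4 + n) (suc c)
extend {n} {c} (inj₁ X) = inj₁ (extend-exact X (blocks-length {c = suc c} X (exact-1 (n * suc c))))
extend {n} {c} (inj₂ X) = inj₂ (extend-hooked X (blocks-length {c = suc c} X (hooked-1 (n * suc c))))

system-4 : ∀ c → System 4 c
system-4 c = inj₁ (record
  { blocks = quads 1 c
  ; zero-blocks = quads-zero 1 c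
  ; covers = λ f → ≡.trans (quads-covers f 1 c) (cong (interval f 1) (ℕₚ.*-comm c 4))
  })

-- From signed partitions to arrays with two rows

surjective⇒injective : ∀ {n} (f : Fin n → Fin n) → (∀ y → ∃[ x ] f x ≡ y) → ∀ x x′ → f x ≡ f x′ → x ≡ x′
surjective⇒injective f surj x x′ eq = ≡.trans (≡.sym (proj₂ (hit x))) (≡.trans (cong section
    (≡.trans (f-hit x) (≡.trans eq (≡.sym (f-hit x′))))) (proj₂ (hit x′)))
  where
  section = proj₁ ∘ surj
  hit : ∀ x → ∃[ y ] section y ≡ x
  hit = injective⇒surjective section λ y y′ eq → ≡.trans (≡.sym (proj₂ (surj y)))
      (≡.trans (cong f eq) (proj₂ (surj y′)))
  f-hit : ∀ x → proj₁ (hit x) ≡ f x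
  f-hit x = ≡.trans (≡.sym (proj₂ (surj (proj₁ (hit x))))) (cong f (proj₂ (hit x)))

sum-nonzero : ∀ {n} (F : Fin n → ℕ) → ℕΣ.sum F ≢ 0 → ∃[ i ] F i ≢ 0
sum-nonzero {zero} F ≢0 = ⊥-elim (≢0 ≡.refl)
sum-nonzero {suc n} F ≢0 with F zero in eq
... | suc _ = zero , λ F0≡0 → ℕₚ.1+n≢0 (≡.trans (≡.sym eq) F0≡0)
... | zero = let i , Fi≢0 = sum-nonzero (F ∘ suc) ≢0 in suc i , Fi≢0

indicator : ℕ → ℕ → ℕ
indicator v x = if does (x ℕ.≟ v) then 1 else 0

indicator-self : ∀ v → indicator v v ≡ 1
indicator-self v rewrite dec-true (v ℕ.≟ v) ≡.refl = ≡.refl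

indicator-nonzero : ∀ v x → indicator v x ≢ 0 → x ≡ v
indicator-nonzero v x ≢0 with x ℕ.≟ v
... | yes eq = eq
... | no x≢v = ⊥-elim (≢0 (cong (if_then 1 else 0) (dec-false (x ℕ.≟ v) x≢v)))

interval-nonzero : ∀ f a n k → k < n → f (a + k) ≢ 0 → interval f a n ≢ 0
interval-nonzero f a (suc n) zero _ f≢0 eq = f≢0 (≡.trans (cong f (ℕₚ.+-identityʳ a)) (ℕₚ.m+n≡0⇒m≡0 (f a) eq))
interval-nonzero f a (suc n) (suc k) (s≤s k<n) f≢0 eq = interval-nonzero f (suc a) n k k<n
  (subst (λ b → f b ≢ 0) (ℕₚ.+-suc a k) f≢0) (ℕₚ.m+n≡0⇒n≡0 (f a) eq)

module Realise (n c : ℕ) (x : Fin c → Fin n → ℤ) (k : Fin c → Fin n → ℕ)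
  (signs : ∀ t q → (x t q ≡[mod (2 * n * c + 1) ] (+ k t q)) ⊎ (x t q ≡[mod (2 * n * c + 1) ] (- (+ k t q))))
  (covers : ∀ f → ℕΣ.sum (λ t → ℕΣ.sum (λ q → f (k t q))) ≡ interval f 1 (n * c))
  (zero-sum : ∀ t → ℤΣ.sum (x t) ≡ 0ℤ) where

  private
    M N : ℕ
    M = 2 * n * c + 1
    N = n * c

    M≡ : M ≡ suc (N + N)
    M≡ = lemma n c
      where
      lemma : ∀ n c → 2 * n * c + 1 ≡ suc (n * c + n * c)
      lemma = solve-∀

    -- Testing `covers` with the indicator of one number shows that this number occurs.
    find : ∀ (i : Fin N) → ∃[ t ] ∃[ q ] k t q ≡ suc (toℕ i)
    find i = let t , t≢0 = sum-nonzero _ (λ eq → interval-nonzero (indicator (suc (toℕ i))) 1 N (toℕ i) (Finₚ.toℕ<n i)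
                             (λ z → ℕₚ.1+n≢0 (≡.trans (≡.sym (indicator-self (suc (toℕ i)))) z))
                             (≡.trans (≡.sym (covers (indicator (suc (toℕ i))))) eq))
                 q , q≢0 = sum-nonzero _ t≢0
             in t , q , indicator-nonzero _ _ q≢0

    -- The indicator of the complement of 1, ..., N; testing `covers` with it shows that no other
    -- number occurs.
    outside : ℕ → ℕ
    outside zero = 1
    outside (suc y) = if does (y ℕ.<? N) then 0 else 1

    interval-outside : ∀ a m → a + m ≤ N → interval outside (suc a) m ≡ 0
    interval-outside a zero _ = ≡.refl
    interval-outside a (suc m) a+m≤N =
        cong₂ _+_ (inside a<N) (interval-outside (suc a) m (subst (_≤ N) (ℕₚ.+-suc a m) a+m≤N))
      where
      a<N : a < N
      a<N = ℕₚ.<-≤-trans (ℕₚ.m<m+n a (s≤s z≤n)) a+m≤N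
      inside : a < N → outside (suc a) ≡ 0
      inside a<N rewrite dec-true (a ℕ.<? N) a<N = ≡.refl

    sum-zero : ∀ {n} (F : Fin n → ℕ) → ℕΣ.sum F ≡ 0 → ∀ i → F i ≡ 0
    sum-zero {suc n} F eq zero = ℕₚ.m+n≡0⇒m≡0 (F zero) eq
    sum-zero {suc n} F eq (suc i) = sum-zero (F ∘ suc) (ℕₚ.m+n≡0⇒n≡0 (F zero) eq) i

    bounded : ∀ y → outside y ≡ 0 → ∃[ i ] y ≡ suc (toℕ {N} i)
    bounded (suc y) eq with y ℕ.<? N
    ... | yes y<N = fromℕ< y<N , cong suc (≡.sym (Finₚ.toℕ-fromℕ< y<N))
    ... | no y≮N with () ← ≡.trans (≡.sym eq) (cong (if_then 0 else 1) (dec-false (y ℕ.<? N) y≮N))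

    code : ∀ t q → ∃[ i ] k t q ≡ suc (toℕ {N} i)
    code t q = bounded (k t q) (sum-zero _ (sum-zero _ (≡.trans (covers outside) (interval-outside 0 N ℕₚ.≤-refl)) t) q)

    position : Fin N → Fin c × Fin n
    position p = remQuot {c} n (cast (ℕₚ.*-comm n c) p)

    relabel : Fin N → Fin N
    relabel p = let t , q = position p in proj₁ (code t q)

    slot : Fin c → Fin n → Fin N
    slot t q = cast (ℕₚ.*-comm c n) (combine t q)

    position-slot : ∀ t q → position (slot t q) ≡ (t , q)
    position-slot t q = ≡.trans (cong (remQuot {c} n) (≡.trans (Finₚ.cast-trans (ℕₚ.*-comm c n) (ℕₚ.*-comm n c) (combine t q)) (Finₚ.cast-is-id _ (combine t q))))
      (Finₚ.remQuot-combine t q)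

    relabel-slot : ∀ t q → relabel (slot t q) ≡ proj₁ (code t q)
    relabel-slot t q = cong (λ (t , q) → proj₁ (code t q)) (position-slot t q)

    relabel-surjective : ∀ i → ∃[ p ] relabel p ≡ i
    relabel-surjective i = let t , q , eq = find i in slot t q ,
      ≡.trans (relabel-slot t q) (Finₚ.toℕ-injective (ℕₚ.suc-injective (≡.trans (≡.sym (proj₂ (code t q))) eq)))

    -- There are as many positions as numbers and every number occurs, so none occurs twice.
    k-injective : ∀ t q t′ q′ → k t q ≡ k t′ q′ → (t , q) ≡ (t′ , q′)
    k-injective t q t′ q′ eq = ≡.trans (≡.sym (position-slot t q)) (≡.trans (cong position
      (surjective⇒injective relabel relabel-surjective (slot t q) (slot t′ q′)
        (≡.trans (relabel-slot t q) (≡.trans (Finₚ.toℕ-injective (ℕₚ.suc-injective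
          (≡.trans (≡.sym (proj₂ (code t q))) (≡.trans eq (proj₂ (code t′ q′))))) )
              (≡.sym (relabel-slot t′ q′))))))
      (position-slot t′ q′))

    k≤N : ∀ t q → k t q ≤ N
    k≤N t q = subst (_≤ N) (≡.sym (proj₂ (code t q))) (Finₚ.toℕ<n (proj₁ (code t q)))

    k>0 : ∀ t q → 0 < k t q
    k>0 t q = subst (0 <_) (≡.sym (proj₂ (code t q))) (s≤s z≤n)

    opposite-signs : ∀ t q t′ q′ → ¬ ((+ k t q) ≡[mod M ] (- (+ k t′ q′)))
    opposite-signs t q t′ q′ eq = ℕₚ.<⇒≢ (ℕₚ.<-≤-trans (k>0 t q) (ℕₚ.m≤m+n _ (k t′ q′)))
      (≡.sym (ℤₚ.+-injective (multiple-bounded (subst (+ M ℤ∣.∣_) (lemma (+ k t q) (+ k t′ q′)) eq)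
        (subst (λ m → k t q + k t′ q′ < m) (≡.sym M≡) (s≤s (ℕₚ.+-mono-≤ (k≤N t q) (k≤N t′ q′)))))))
      where
      lemma : ∀ a b → a ℤ.- (- b) ≡ a ℤ.+ b
      lemma = ℤRing.solve-∀

    same-signs : ∀ t q t′ q′ → (+ k t q) ≡[mod M ] (+ k t′ q′) → (t , q) ≡ (t′ , q′)
    same-signs t q t′ q′ eq = k-injective t q t′ q′ (residue-injective (bound t q) (bound t′ q′) eq)
      where
      bound : ∀ t q → k t q < M
      bound t q = subst (k t q <_) (≡.sym M≡) (s≤s (ℕₚ.≤-trans (k≤N t q) (ℕₚ.m≤m+n N N)))

    neg-mod : ∀ x y → (- x) ≡[mod M ] (- y) → x ≡[mod M ] y
    neg-mod x y eq = subst (+ M ℤ∣.∣_) (lemma x y) (ℤ∣.∣m⇒∣-m eq)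
      where
      lemma : ∀ x y → - ((- x) ℤ.- (- y)) ≡ x ℤ.- y
      lemma = ℤRing.solve-∀

    link : ∀ {x y u v} → x ≡[mod M ] u → y ≡[mod M ] v → x ≡[mod M ] y → u ≡[mod M ] v
    link {x} {y} {u} {v} xu yv xy = begin
      u  ≈⟨ xu ⟨
      x  ≈⟨ xy ⟩
      y  ≈⟨ yv ⟩
      v  ∎
      where open ≈-Reasoning M

    Class : ℤ → ℕ → Set
    Class u k = (u ≡[mod M ] (+ k)) ⊎ (u ≡[mod M ] (- (+ k)))

    Class-neg : ∀ u k → Class u k → Class (- u) k
    Class-neg u k (inj₁ p) = inj₂ (ℤ/.⁻¹-cong M {u} {+ k} p)
    Class-neg u k (inj₂ p) = inj₁ (subst ((- u) ≡[mod M ]_) (ℤₚ.neg-involutive (+ k)) (ℤ/.⁻¹-cong M {u} { - (+ k)} p))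

    same-class : ∀ u v t q t′ q′ → Class u (k t q) → Class v (k t′ q′) → u ≡[mod M ] v → (t , q) ≡ (t′ , q′)
    same-class u v t q t′ q′ (inj₁ p) (inj₁ p′) eq =
        same-signs t q t′ q′ (link {u} {v} {+ k t q} {+ k t′ q′} p p′ eq)
    same-class u v t q t′ q′ (inj₂ p) (inj₂ p′) eq = same-signs t q t′ q′
      (neg-mod (+ k t q) (+ k t′ q′) (link {u} {v} { - (+ k t q)} { - (+ k t′ q′)} p p′ eq))
    same-class u v t q t′ q′ (inj₁ p) (inj₂ p′) eq = ⊥-elim (opposite-signs t q t′ q′
      (link {u} {v} {+ k t q} { - (+ k t′ q′)} p p′ eq))
    same-class u v t q t′ q′ (inj₂ p) (inj₁ p′) eq = ⊥-elim (opposite-signs t′ q′ t q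
      (link {v} {u} {+ k t′ q′} { - (+ k t q)} p′ p (ℤ/.sym M {u} {v} eq)))

    injective : ∀ t q t′ q′ → x t q ≡[mod M ] x t′ q′ → (t , q) ≡ (t′ , q′)
    injective t q t′ q′ = same-class (x t q) (x t′ q′) t q t′ q′ (signs t q) (signs t′ q′)

    not-self-opposite : ∀ u t q → Class u (k t q) → ¬ (u ≡[mod M ] (- u))
    not-self-opposite u t q (inj₁ p) eq = opposite-signs t q t q
      (link {u} { - u} {+ k t q} { - (+ k t q)} p (ℤ/.⁻¹-cong M {u} {+ k t q} p) eq)
    not-self-opposite u t q (inj₂ p) eq = opposite-signs t q t q (ℤ/.sym M { - (+ k t q)} {+ k t q}
      (link {u} { - u} { - (+ k t q)} {+ k t q} p
        (subst ((- u) ≡[mod M ]_) (ℤₚ.neg-involutive (+ k t q)) (ℤ/.⁻¹-cong M {u} { - (+ k t q)} p)) eq))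

    -- Entries that are opposite have the same absolute value in 1, ..., N, hence the same position;
    -- but no entry is its own opposite.
    antipodal : ∀ t q t′ q′ → ¬ (x t q ≡[mod M ] (- (x t′ q′)))
    antipodal t q t′ q′ eq = not-self-opposite (x t q) t q (signs t q)
      (subst (λ (t′ , q′) → x t q ≡[mod M ] (- (x t′ q′)))
        (≡.sym (same-class (x t q) (- x t′ q′) t q t′ q′ (signs t q) (Class-neg (x t′ q′) (k t′ q′) (signs t′ q′)) eq)) eq)

    reach : ∀ y v → Class y v → 0 < v → v ≤ N → ∃[ t ] ∃[ q ] ((x t q ≡[mod M ] y) ⊎ ((- x t q) ≡[mod M ] y))
    reach y (suc v) y≈ _ v<N = let t , q , eq = find (fromℕ< v<N) in
      t , q , match (x t q) y≈ (subst (Class (x t q)) (≡.trans eq (cong suc (Finₚ.toℕ-fromℕ< v<N))) (signs t q))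
      where
      via : ∀ {x z} → x ≡[mod M ] z → y ≡[mod M ] z → x ≡[mod M ] y
      via {x} {z} p q = ℤ/.trans M {x} {z} {y} p (ℤ/.sym M {y} {z} q)
      match : ∀ x → Class y (suc v) → Class x (suc v) → (x ≡[mod M ] y) ⊎ ((- x) ≡[mod M ] y)
      match x (inj₁ p) (inj₁ q) = inj₁ (via {x} {+ suc v} q p)
      match x (inj₂ p) (inj₂ q) = inj₁ (via {x} { -[1+ v ]} q p)
      match x (inj₁ p) (inj₂ q) = inj₂ (via { - x} {+ suc v} (ℤ/.⁻¹-cong M {x} { -[1+ v ]} q) p)
      match x (inj₂ p) (inj₁ q) = inj₂ (via { - x} { -[1+ v ]} (ℤ/.⁻¹-cong M {x} {+ suc v} q) p)

    exhaustive : ∀ y → ¬ (y ≡[mod M ] 0ℤ) → ∃[ t ] ∃[ q ] ((x t q ≡[mod M ] y) ⊎ ((- x t q) ≡[mod M ] y))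
    exhaustive y y≉0 = let i , eq = residue y M {{M≢0}} in reduce (toℕ i) (Finₚ.toℕ<n i) eq
      where
      M≢0 : NonZero M
      M≢0 = subst NonZero (≡.sym M≡) _
      lemma : ∀ r m → r ℤ.- (- m) ≡ m ℤ.+ r
      lemma = ℤRing.solve-∀
      wrap : ∀ r → r < M → (+ r) ≡[mod M ] (- (+ (M ∸ r)))
      wrap r r<M = subst (+ M ℤ∣.∣_)
        (≡.trans (cong +_ (≡.sym (ℕₚ.m∸n+n≡m (ℕₚ.<⇒≤ r<M)))) (≡.sym (lemma (+ r) (+ (M ∸ r))))) ℤ∣.∣-refl
      reduce : ∀ r → r < M → (+ r) ≡[mod M ] y → ∃[ t ] ∃[ q ] ((x t q ≡[mod M ] y) ⊎ ((- x t q) ≡[mod M ] y))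
      reduce zero _ eq = ⊥-elim (y≉0 (ℤ/.sym M {0ℤ} {y} eq))
      reduce (suc r) r<M eq = split (suc r ℕ.≤? N)
        where
        y≈ : y ≡[mod M ] (+ suc r)
        y≈ = ℤ/.sym M {+ suc r} {y} eq
        split : Dec (suc r ≤ N) → _
        split (yes r≤N) = reach y (suc r) (inj₁ y≈) (s≤s z≤n) r≤N
        -- A residue beyond N is minus its complement to M, and that complement is at most N because
        -- M = 2N + 1.
        split (no r≰N) = reach y (M ∸ suc r)
            (inj₂ (ℤ/.trans M {y} {+ suc r} { - (+ (M ∸ suc r))} y≈ (wrap (suc r) r<M)))
          (ℕₚ.m<n⇒0<n∸m r<M) (ℕₚ.≤-trans (ℕₚ.∸-monoʳ-≤ M (ℕₚ.≰⇒> r≰N))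
            (ℕₚ.≤-reflexive (≡.trans (cong (_∸ suc N) M≡) (ℕₚ.m+n∸n≡m N N))))

  arrays : M⁰S (ℤ/ M) (Nonzero (ℤ/ M)) 2 n n 2 c
  arrays = FullArrays.two-rows (ℤ/ M) x injective antipodal exhaustive (λ t → ≡⇒mod M (zero-sum t))

module Entries {n : ℕ} where
  entry : (L : List (Vec ℤ n)) → Fin (length L) → Fin n → ℤ
  entry L t q = Vec.lookup (List.lookup L t) q

  sum-block : ∀ {n} f (B : Vec ℤ n) → ℕΣ.sum (λ q → f ∣ Vec.lookup B q ∣) ≡ sumBlock f B
  sum-block f [] = ≡.refl
  sum-block f (x ∷ B) = cong (λ z → f ∣ x ∣ + z) (sum-block f B)

  sum-entries : ∀ f L → ℕΣ.sum (λ t → ℕΣ.sum (λ q → f ∣ entry L t q ∣)) ≡ sumBlocks f L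
  sum-entries f [] = ≡.refl
  sum-entries f (B ∷ L) = cong₂ _+_ (sum-block f B) (sum-entries f L)

  total-entries : ∀ {n} (B : Vec ℤ n) → ℤΣ.sum (Vec.lookup B) ≡ blockTotal B
  total-entries [] = ≡.refl
  total-entries (x ∷ B) = cong (λ z → x ℤ.+ z) (total-entries B)

  zero-entries : ∀ {L : List (Vec ℤ n)} → ZeroBlocks L → ∀ t → ℤΣ.sum (entry L t) ≡ 0ℤ
  zero-entries {B ∷ L} (z ∷ zs) zero = ≡.trans (total-entries B) z
  zero-entries {B ∷ L} (z ∷ zs) (suc t) = zero-entries zs t

realise : ∀ {n c R} (X : Signed n R) → length (Signed.blocks X) ≡ c → (φ : ℕ → ℕ) →
          (∀ x → (x ≡[mod (2 * n * c + 1) ] (+ φ ∣ x ∣)) ⊎ (x ≡[mod (2 * n * c + 1) ] (- (+ φ ∣ x ∣)))) →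
          (∀ f → R (f ∘ φ) ≡ exact (n * c) f) → M⁰S (ℤ/ (2 * n * c + 1)) (Nonzero (ℤ/ (2 * n * c + 1))) 2 n n
              2 c
realise {n} X ≡.refl φ signs folds = Realise.arrays n (length blocks) (entry blocks)
    (λ t q → φ ∣ entry blocks t q ∣)
  (λ t q → signs (entry blocks t q))
      (λ f → ≡.trans (sum-entries (f ∘ φ) blocks) (≡.trans (covers (f ∘ φ)) (folds f)))
  (zero-entries zero-blocks)
  where
  open Signed X
  open Entries

interval-cong-bounded : ∀ f g a n → (∀ x → x < a + n → f x ≡ g x) → interval f a n ≡ interval g a n
interval-cong-bounded f g a zero eq = ≡.refl
interval-cong-bounded f g a (suc n) eq = cong₂ _+_ (eq a (ℕₚ.m<m+n a (s≤s z≤n)))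
  (interval-cong-bounded f g (suc a) n (λ x x< → eq x (subst (x <_) (≡.sym (ℕₚ.+-suc a n)) x<)))

-- Brings the hook back into 1, ..., N: modulo 2N + 1 the number N + 1 is -N, and signs do not
-- matter for the absolute values.
fold : ℕ → ℕ → ℕ
fold N y = if does (y ℕ.≟ suc N) then N else y

fold-end : ∀ N → fold N (suc N) ≡ N
fold-end N rewrite dec-true (N ℕ.≟ N) ≡.refl = ≡.refl

fold-inside : ∀ N y → y ≢ suc N → fold N y ≡ y
fold-inside N y ≢ rewrite dec-false (y ℕ.≟ suc N) ≢ = ≡.refl

abs-sign : ∀ M x → (x ≡[mod M ] (+ ∣ x ∣)) ⊎ (x ≡[mod M ] (- (+ ∣ x ∣)))
abs-sign M (+ a) = inj₁ (ℤ/.refl M {+ a})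
abs-sign M -[1+ a ] = inj₂ (ℤ/.refl M { -[1+ a ]})

fold-sign : ∀ N M → M ≡ suc (N + N) → ∀ x → (x ≡[mod M ] (+ fold N ∣ x ∣)) ⊎ (x ≡[mod M ] (- (+ fold N ∣ x ∣)))
fold-sign N M M≡ x with ∣ x ∣ ℕ.≟ suc N
... | no ≢ rewrite fold-inside N ∣ x ∣ ≢ = abs-sign M x
... | yes eq rewrite ≡.trans (cong (fold N) eq) (fold-end N) = wrap x eq
  where
  sum≡M : ∀ N → + 1 ℤ.+ (N ℤ.+ N) ≡ (+ 1 ℤ.+ N) ℤ.- (- N)
  sum≡M = ℤRing.solve-∀
  sum≡-M : ∀ N → - (+ 1 ℤ.+ (N ℤ.+ N)) ≡ (- (+ 1 ℤ.+ N)) ℤ.- N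
  sum≡-M = ℤRing.solve-∀
  wrap : ∀ x → ∣ x ∣ ≡ suc N → (x ≡[mod M ] (+ N)) ⊎ (x ≡[mod M ] (- (+ N)))
  wrap (+ _) ≡.refl = inj₂ (subst (+ M ℤ∣.∣_) (≡.trans (cong +_ M≡) (sum≡M (+ N))) ℤ∣.∣-refl)
  wrap -[1+ _ ] ≡.refl = inj₁ (subst (+ M ℤ∣.∣_) (≡.trans (cong (λ m → - (+ m)) M≡) (sum≡-M (+ N))) (ℤ∣.∣m⇒∣-m ℤ∣.∣-refl))

system⇒arrays : ∀ {n c} .{{_ : NonZero n}} → System n c → M⁰S (ℤ/ (2 * n * c + 1))
    (Nonzero (ℤ/ (2 * n * c + 1))) 2 n n 2 c
system⇒arrays {n} {c} (inj₁ X) = realise X (blocks-length {c = c} X (exact-1 (n * c))) id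
    (abs-sign (2 * n * c + 1)) (λ _ → ≡.refl)
system⇒arrays {n} {c} (inj₂ X) = realise X (blocks-length {c = c} X (hooked-1 (n * c))) (fold (n * c))
    (fold-sign (n * c) (2 * n * c + 1) (lemma n c)) (folds (n * c))
  where
  lemma : ∀ n c → 2 * n * c + 1 ≡ suc (n * c + n * c)
  lemma = solve-∀
  folds : ∀ N f → hooked N (f ∘ fold N) ≡ exact N f
  folds zero f = ≡.refl
  folds (suc N) f = ≡.trans (cong₂ _+_
      (interval-cong-bounded (f ∘ fold (suc N)) f 1 N (λ x x< → cong f (fold-inside (suc N) x (ℕₚ.<⇒≢ (ℕₚ.m<n⇒m<1+n x<)))))
      (≡.trans (cong f (fold-end (suc N))) (≡.sym (ℕₚ.+-identityʳ _))))
    (≡.trans (interval-+ f 1 N 1 ≡.refl) (cong (interval f 1) (ℕₚ.+-comm N 1)))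

-- Skolem sequences

sumKeys sumPlaces : (ℕ → ℕ) → List (ℕ × ℕ × ℕ) → ℕ
sumKeys f [] = 0
sumKeys f ((j , _ , _) ∷ L) = f j + sumKeys f L
sumPlaces f [] = 0
sumPlaces f ((_ , a , b) ∷ L) = (f a + f b) + sumPlaces f L

-- Order b + 1 needs 2b + 2 places, counted from 0. In the hooked case 2b + 3 places are used and
-- the last but one stays empty.
exactPlaces hookedPlaces : ℕ → (ℕ → ℕ) → ℕ
exactPlaces b f = interval f 0 (suc (suc (b + b)))
hookedPlaces b f = interval f 0 (suc (b + b)) + f (suc (suc (b + b)))

-- A (hooked) Skolem sequence of order b + 1: a triple (j , x , y) stands for the
-- two occurrences x and y = x + j of j. The occurrences p and q of the largest
-- number b + 1 are kept apart.
record Skolem (b : ℕ) (P : ℕ → (ℕ → ℕ) → ℕ) : Set where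
  field
    rest : List (ℕ × ℕ × ℕ)
    differences : All (λ (j , x , y) → y ≡ x + j) rest
    p q : ℕ
    q≡p+c : q ≡ p + suc b
    keys : ∀ f → sumKeys f rest ≡ interval f 1 b
    places : ∀ f → f p + f q + sumPlaces f rest ≡ P b f

-- Nested arcs from a, a + 1, ... to b + r - 1, b + r - 2, ...: their lengths drop by 2 down to g. A
-- nest thus disposes of a run of numbers of one parity and occupies two intervals of places. The
-- condition on a nest says that its innermost arc, from a + r - 1 to b, has length g.
nest : ℕ → ℕ → ℕ → ℕ → List (ℕ × ℕ × ℕ)
nest a b g zero = []
nest a b g (suc r) = (g + r * 2 , a , b + r) ∷ nest (suc a) b g r

nest-differences : ∀ a b g r → suc b ≡ a + r + g → All (λ (j , x , y) → y ≡ x + j) (nest a b g r)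
nest-differences a b g zero _ = []
nest-differences a b g (suc r) eq =
  ≡.trans (cong (_+ r) (ℕₚ.suc-injective (≡.trans eq (lemma a r g)))) (lemma₂ a r g) ∷
  nest-differences (suc a) b g r (≡.trans eq (lemma a r g))
  where
  lemma : ∀ a r g → a + suc r + g ≡ suc (a + r + g)
  lemma = solve-∀
  lemma₂ : ∀ a r g → a + r + g + r ≡ a + (g + r * 2)
  lemma₂ = solve-∀

nest-keys : ∀ f a b g r → sumKeys f (nest a b g r) ≡ progression 2 f g r
nest-keys f a b g zero = ≡.refl
nest-keys f a b g (suc r) = ≡.trans (cong (λ z → f (g + r * 2) + z) (nest-keys f (suc a) b g r))
    (≡.sym (progression-last 2 f g r))

nest-places : ∀ f a b g r → sumPlaces f (nest a b g r) ≡ interval f a r + interval f b r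
nest-places f a b g zero = ≡.refl
nest-places f a b g (suc r) = ≡.trans (cong (λ z → f a + f (b + r) + z) (nest-places f (suc a) b g r))
  (≡.trans (lemma (f a) _ _ _) (cong (λ z → f a + interval f (suc a) r + z)
    (≡.trans (cong (λ x → f (b + x) + interval f b r) (≡.sym (ℕₚ.*-identityʳ r))) (≡.sym (progression-last 1 f b r)))))
  where
  lemma : ∀ a b c d → a + b + (c + d) ≡ a + c + (b + d)
  lemma = solve-∀

sumKeys-++ : ∀ f K L → sumKeys f (K ++ L) ≡ sumKeys f K + sumKeys f L
sumKeys-++ f [] L = ≡.refl
sumKeys-++ f ((j , _ , _) ∷ K) L = ≡.trans (cong (λ z → f j + z) (sumKeys-++ f K L))
    (≡.sym (ℕₚ.+-assoc (f j) _ _))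

sumPlaces-++ : ∀ f K L → sumPlaces f (K ++ L) ≡ sumPlaces f K + sumPlaces f L
sumPlaces-++ f [] L = ≡.refl
sumPlaces-++ f ((_ , a , b) ∷ K) L = ≡.trans (cong (λ z → f a + f b + z) (sumPlaces-++ f K L))
    (≡.sym (ℕₚ.+-assoc (f a + f b) _ _))

assemble : List (ℕ × ℕ × ℕ × ℕ) → List (ℕ × ℕ × ℕ) → List (ℕ × ℕ × ℕ)
assemble [] singles = singles
assemble ((a , b , g , r) ∷ nests) singles = nest a b g r ++ assemble nests singles

assemble-differences : ∀ nests singles → All (λ (a , b , g , r) → suc b ≡ a + r + g) nests →
                   All (λ (j , x , y) → y ≡ x + j) singles → All (λ (j , x , y) → y ≡ x + j)
                       (assemble nests singles)
assemble-differences [] singles [] ok = ok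
assemble-differences ((a , b , g , r) ∷ nests) singles (eq ∷ eqs) ok =
  Allₚ.++⁺ (nest-differences a b g r eq) (assemble-differences nests singles eqs ok)

nestKeys nestPlaces : (ℕ → ℕ) → List (ℕ × ℕ × ℕ × ℕ) → ℕ
nestKeys f [] = 0
nestKeys f ((a , b , g , r) ∷ nests) = progression 2 f g r + nestKeys f nests
nestPlaces f [] = 0
nestPlaces f ((a , b , g , r) ∷ nests) = (interval f a r + interval f b r) + nestPlaces f nests

assemble-keys : ∀ f nests singles → sumKeys f (assemble nests singles) ≡ nestKeys f nests + sumKeys f singles
assemble-keys f [] singles = ≡.refl
assemble-keys f ((a , b , g , r) ∷ nests) singles =
    ≡.trans (sumKeys-++ f (nest a b g r) (assemble nests singles))
  (≡.trans (cong₂ _+_ (nest-keys f a b g r) (assemble-keys f nests singles)) (≡.sym (ℕₚ.+-assoc (progression 2 f g r) _ _)))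

assemble-places : ∀ f nests singles → sumPlaces f (assemble nests singles) ≡ nestPlaces f nests + sumPlaces f
    singles
assemble-places f [] singles = ≡.refl
assemble-places f ((a , b , g , r) ∷ nests) singles =
    ≡.trans (sumPlaces-++ f (nest a b g r) (assemble nests singles))
  (≡.trans (cong₂ _+_ (nest-places f a b g r) (assemble-places f nests singles)) (≡.sym (ℕₚ.+-assoc (interval f a r + interval f b r) _ _)))

order1 : Skolem 0 exactPlaces
order1 = record
  { rest = []
  ; differences = []
  ; p = 0 ; q = 1 ; q≡p+c = ≡.refl
  ; keys = λ f → ≡.refl
  ; places = λ f → places-lemma (f 0) (f 1)
  }
  where
  places-lemma : ∀ x0 x1 → x0 + x1 + 0 ≡ x0 + (x1 + 0)
  places-lemma = solve-∀

order2 : Skolem 1 hookedPlaces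
order2 = record
  { rest = (1 , 0 , 1) ∷ []
  ; differences = ≡.refl ∷ []
  ; p = 2 ; q = 4 ; q≡p+c = ≡.refl
  ; keys = λ f → keys-lemma (f 1)
  ; places = λ f → places-lemma (f 0) (f 1) (f 2) (f 4)
  }
  where
  keys-lemma : ∀ x1 → x1 + 0 ≡ x1 + 0
  keys-lemma = solve-∀
  places-lemma : ∀ x0 x1 x2 x4 → x2 + x4 + ((x0 + x1) + 0) ≡ (x0 + (x1 + (x2 + 0))) + x4
  places-lemma = solve-∀

order3 : Skolem 2 hookedPlaces
order3 = record
  { rest = (1 , 1 , 2) ∷ (2 , 4 , 6) ∷ []
  ; differences = ≡.refl ∷ ≡.refl ∷ []
  ; p = 0 ; q = 3 ; q≡p+c = ≡.refl
  ; keys = λ f → keys-lemma (f 1) (f 2)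
  ; places = λ f → places-lemma (f 0) (f 1) (f 2) (f 3) (f 4) (f 6)
  }
  where
  keys-lemma : ∀ x1 x2 → x1 + (x2 + 0) ≡ x1 + (x2 + 0)
  keys-lemma = solve-∀
  places-lemma : ∀ x0 x1 x2 x3 x4 x6 → x0 + x3 + ((x1 + x2) + ((x4 + x6) + 0)) ≡
      (x0 + (x1 + (x2 + (x3 + (x4 + 0))))) + x6
  places-lemma = solve-∀

order4 : Skolem 3 exactPlaces
order4 = record
  { rest = (2 , 1 , 3) ∷ (3 , 2 , 5) ∷ (1 , 6 , 7) ∷ []
  ; differences = ≡.refl ∷ ≡.refl ∷ ≡.refl ∷ []
  ; p = 0 ; q = 4 ; q≡p+c = ≡.refl
  ; keys = λ f → keys-lemma (f 1) (f 2) (f 3)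
  ; places = λ f → places-lemma (f 0) (f 1) (f 2) (f 3) (f 4) (f 5) (f 6) (f 7)
  }
  where
  keys-lemma : ∀ x1 x2 x3 → x2 + (x3 + (x1 + 0)) ≡ x1 + (x2 + (x3 + 0))
  keys-lemma = solve-∀
  places-lemma : ∀ x0 x1 x2 x3 x4 x5 x6 x7 → x0 + x4 + ((x1 + x3) + ((x2 + x5) + ((x6 + x7) + 0))) ≡ x0 +
      (x1 + (x2 + (x3 + (x4 + (x5 + (x6 + (x7 + 0)))))))
  places-lemma = solve-∀

order5 : Skolem 4 exactPlaces
order5 = record
  { rest = (2 , 0 , 2) ∷ (4 , 1 , 5) ∷ (3 , 3 , 6) ∷ (1 , 7 , 8) ∷ []
  ; differences = ≡.refl ∷ ≡.refl ∷ ≡.refl ∷ ≡.refl ∷ []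
  ; p = 4 ; q = 9 ; q≡p+c = ≡.refl
  ; keys = λ f → keys-lemma (f 1) (f 2) (f 3) (f 4)
  ; places = λ f → places-lemma (f 0) (f 1) (f 2) (f 3) (f 4) (f 5) (f 6) (f 7) (f 8) (f 9)
  }
  where
  keys-lemma : ∀ x1 x2 x3 x4 → x2 + (x4 + (x3 + (x1 + 0))) ≡ x1 + (x2 + (x3 + (x4 + 0)))
  keys-lemma = solve-∀
  places-lemma : ∀ x0 x1 x2 x3 x4 x5 x6 x7 x8 x9 →
      x4 + x9 + ((x0 + x2) + ((x1 + x5) + ((x3 + x6) + ((x7 + x8) + 0)))) ≡ x0 +
      (x1 + (x2 + (x3 + (x4 + (x5 + (x6 + (x7 + (x8 + (x9 + 0)))))))))
  places-lemma = solve-∀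

-- Families depending on a parameter u: a form (k , m) denotes k + m u, so that
-- equations between forms hold by computation.
Form : Set
Form = ℕ × ℕ

module Linear (u : ℕ) where
  ⟦_⟧ : Form → ℕ
  ⟦ k , m ⟧ = k + m * u

  infixl 6 _∔_
  _∔_ : Form → Form → Form
  (k , m) ∔ (k′ , m′) = k + k′ , m + m′

  scale : ℕ → Form → Form
  scale d (k , m) = k * d , m * d

  ⟦⟧-+ : ∀ x y → ⟦ x ⟧ + ⟦ y ⟧ ≡ ⟦ x ∔ y ⟧
  ⟦⟧-+ (k , m) (k′ , m′) = lemma k m k′ m′ u
    where
    lemma : ∀ k m k′ m′ u → k + m * u + (k′ + m′ * u) ≡ k + k′ + (m + m′) * u
    lemma = solve-∀

  map₃ : List (Form × Form × Form) → List (ℕ × ℕ × ℕ)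
  map₃ = List.map λ (x , y , z) → ⟦ x ⟧ , ⟦ y ⟧ , ⟦ z ⟧

  map₄ : List (Form × Form × Form × Form) → List (ℕ × ℕ × ℕ × ℕ)
  map₄ = List.map λ (x , y , z , w) → ⟦ x ⟧ , ⟦ y ⟧ , ⟦ z ⟧ , ⟦ w ⟧

  singles-ok : ∀ L → All (λ (j , x , y) → y ≡ x ∔ j) L → All (λ (j , x , y) → y ≡ x + j) (map₃ L)
  singles-ok [] [] = []
  singles-ok ((j , x , _) ∷ L) (≡.refl ∷ eqs) = ≡.sym (⟦⟧-+ x j) ∷ singles-ok L eqs

  nests-ok : ∀ L → All (λ (a , b , g , r) → (1 , 0) ∔ b ≡ a ∔ r ∔ g) L →
      All (λ (a , b , g , r) → suc b ≡ a + r + g) (map₄ L)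
  nests-ok [] [] = []
  nests-ok ((a , b , g , r) ∷ L) (eq ∷ eqs) =
    ≡.trans (cong ⟦_⟧ eq) (≡.sym (≡.trans (cong (_+ ⟦ g ⟧) (⟦⟧-+ a r)) (⟦⟧-+ (a ∔ r) g))) ∷ nests-ok L eqs

  data LinearTiling (d : ℕ) (f : ℕ → ℕ) : Form → Form → ℕ → Set where
    end : ∀ {a} → LinearTiling d f a a 0
    piece : ∀ {a e v} n → LinearTiling d f (a ∔ scale d n) e v →
        LinearTiling d f a e (progression d f ⟦ a ⟧ ⟦ n ⟧ + v)
    point : ∀ {a e v} → LinearTiling d f (a ∔ (d , 0)) e v → LinearTiling d f a e (f ⟦ a ⟧ + v)

  ⟦⟧-step : ∀ a n d → ⟦ a ⟧ + ⟦ n ⟧ * d ≡ ⟦ a ∔ scale d n ⟧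
  ⟦⟧-step (k , m) (k′ , m′) d = lemma k m k′ m′ d u
    where
    lemma : ∀ k m k′ m′ d u → k + m * u + (k′ + m′ * u) * d ≡ k + k′ * d + (m + m′ * d) * u
    lemma = solve-∀

  tiling : ∀ {d f a e v} → LinearTiling d f a e v → Tiling d f ⟦ a ⟧ ⟦ e ⟧ v
  tiling end = end
  tiling {d} {a = a} (piece n t) = piece ⟦ n ⟧ (⟦⟧-step a n d) (tiling t)
  tiling {d} {a = a} (point t) = point
      (≡.trans (cong (λ z → ⟦ a ⟧ + z) (≡.sym (ℕₚ.+-identityʳ d))) (⟦⟧-+ a (d , 0))) (tiling t)

  linearly-tiled : ∀ d .{{_ : NonZero d}} f {v} a n → LinearTiling d f a (a ∔ scale d n) v →
      v ≡ progression d f ⟦ a ⟧ ⟦ n ⟧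
  linearly-tiled d f a n t = tiled ⟦ n ⟧ (⟦⟧-step a n d) (tiling t)

-- Order 8 + 4u. The even numbers below the order form one nest; the odd runs 3, ..., 1 + 2u and 7 +
-- 2u, ..., 5 + 4u form two smaller ones; 1, 3 + 2u, 5 + 2u and 7 + 4u fill remaining places singly.
-- The other three families follow the same plan for the other residues of the order modulo 4.
familyA : ∀ u → Skolem (7 + 4 * u) exactPlaces
familyA u = record
  { rest = assemble (map₄ nests) (map₃ singles)
  ; differences = assemble-differences (map₄ nests) (map₃ singles)
      (nests-ok nests (≡.refl ∷ ≡.refl ∷ ≡.refl ∷ []))
          (singles-ok singles (≡.refl ∷ ≡.refl ∷ ≡.refl ∷ ≡.refl ∷ []))
  ; p = ⟦ (7 , 4) ⟧
  ; q = ⟦ (15 , 8) ⟧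
  ; q≡p+c = ≡.sym (⟦⟧-+ (7 , 4) (8 , 4))
  ; keys = λ f → ≡.trans (assemble-keys f (map₄ nests) (map₃ singles)) (≡.trans
      (reorder-keys (progression 2 f ⟦ (2 , 0) ⟧ ⟦ (3 , 2) ⟧) (progression 2 f ⟦ (7 , 2) ⟧ ⟦ (0 , 1) ⟧)
        (progression 2 f ⟦ (3 , 0) ⟧ ⟦ (0 , 1) ⟧) (f ⟦ (5 , 2) ⟧) (f ⟦ (1 , 0) ⟧) (f ⟦ (3 , 2) ⟧)
            (f ⟦ (7 , 4) ⟧))
      (≡.trans (cong₂ _+_ (linearly-tiled 2 f (1 , 0) (4 , 2) (point (piece (0 , 1) (point (point (piece (0 , 1) (point end)))))))
                         (linearly-tiled 2 f (2 , 0) (3 , 2) (piece (3 , 2) end)))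
        (≡.trans (interleave′ f 1 ⟦ (3 , 2) ⟧) (cong (interval f 1) (cong suc (⟦⟧-+ (3 , 2) (3 , 2)))))))
  ; places = λ f → ≡.trans (cong (λ z → f ⟦ (7 , 4) ⟧ + f ⟦ (15 , 8) ⟧ + z) (assemble-places f (map₄ nests) (map₃ singles)))
      (≡.trans (reorder (f ⟦ (7 , 4) ⟧) (f ⟦ (15 , 8) ⟧) (interval f ⟦ (8 , 4) ⟧ ⟦ (3 , 2) ⟧) (interval f ⟦ (12 , 6) ⟧ ⟦ (3 , 2) ⟧)
        (interval f ⟦ (0 , 0) ⟧ ⟦ (0 , 1) ⟧) (interval f ⟦ (6 , 3) ⟧ ⟦ (0 , 1) ⟧)
            (interval f ⟦ (3 , 1) ⟧ ⟦ (0 , 1) ⟧)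
        (interval f ⟦ (5 , 2) ⟧ ⟦ (0 , 1) ⟧) (f ⟦ (0 , 1) ⟧) (f ⟦ (5 , 3) ⟧) (f ⟦ (1 , 1) ⟧) (f ⟦ (2 , 1) ⟧)
        (f ⟦ (3 , 2) ⟧) (f ⟦ (6 , 4) ⟧) (f ⟦ (4 , 2) ⟧) (f ⟦ (11 , 6) ⟧))
        (≡.trans (linearly-tiled 1 f (0 , 0) (16 , 8)
            (piece (0 , 1) (point (point (point (piece (0 , 1) (point (point (piece (0 , 1) (point
            (piece (0 , 1) (point (point (piece (3 , 2) (point (piece (3 , 2) (point end)))))))))))))))))
          (cong (λ k → interval f 0 (suc (suc k))) (≡.sym (⟦⟧-+ (7 , 4) (7 , 4))))))
  }
  where
  open Linear u
  nests : List (Form × Form × Form × Form)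
  nests = ((8 , 4) , (12 , 6) , (2 , 0) , (3 , 2)) ∷ ((0 , 0) , (6 , 3) , (7 , 2) , (0 , 1)) ∷
      ((3 , 1) , (5 , 2) , (3 , 0) , (0 , 1)) ∷ []
  singles : List (Form × Form × Form)
  singles = ((5 , 2) , (0 , 1) , (5 , 3)) ∷ ((1 , 0) , (1 , 1) , (2 , 1)) ∷ ((3 , 2) , (3 , 2) , (6 , 4)) ∷
      ((7 , 4) , (4 , 2) , (11 , 6)) ∷ []
  reorder-keys : ∀ x0 x1 x2 y0 y1 y2 y3 → (x0 + (x1 + (x2 + 0))) + (y0 + (y1 + (y2 + (y3 + 0)))) ≡
    (y1 + (x2 + (y2 + (y0 + (x1 + (y3 + 0)))))) + (x0 + 0)
  reorder-keys = solve-∀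
  reorder : ∀ x0 x1 x2 x3 x4 x5 x6 x7 x8 x9 x10 x11 x12 x13 x14 x15 →
    x0 + x1 + (((x2 + x3) + ((x4 + x5) + ((x6 + x7) + 0))) + ((x8 + x9) + ((x10 + x11) + ((x12 + x13) + ((x14 + x15) + 0))))) ≡
    (x4 + (x8 + (x10 + (x11 + (x6 + (x12 + (x14 + (x7 + (x9 + (x5 + (x13 + (x0 + (x2 + (x15 + (x3 + (x1 + 0))))))))))))))))
  reorder = solve-∀

familyB : ∀ u → Skolem (8 + 4 * u) exactPlaces
familyB u = record
  { rest = assemble (map₄ nests) (map₃ singles)
  ; differences = assemble-differences (map₄ nests) (map₃ singles)
      (nests-ok nests (≡.refl ∷ ≡.refl ∷ ≡.refl ∷ [])) (singles-ok singles (≡.refl ∷ ≡.refl ∷ []))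
  ; p = ⟦ (4 , 2) ⟧
  ; q = ⟦ (13 , 6) ⟧
  ; q≡p+c = ≡.sym (⟦⟧-+ (4 , 2) (9 , 4))
  ; keys = λ f → ≡.trans (assemble-keys f (map₄ nests) (map₃ singles)) (≡.trans
      (reorder-keys (progression 2 f ⟦ (2 , 0) ⟧ ⟦ (4 , 2) ⟧) (progression 2 f ⟦ (5 , 2) ⟧ ⟦ (2 , 1) ⟧)
        (progression 2 f ⟦ (3 , 0) ⟧ ⟦ (0 , 1) ⟧) (f ⟦ (1 , 0) ⟧) (f ⟦ (3 , 2) ⟧))
      (≡.trans (cong₂ _+_ (linearly-tiled 2 f (1 , 0) (4 , 2) (point (piece (0 , 1) (point (piece (2 , 1) end)))))
                         (linearly-tiled 2 f (2 , 0) (4 , 2) (piece (4 , 2) end)))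
        (≡.trans (interleave f 1 ⟦ (4 , 2) ⟧) (cong (interval f 1) (⟦⟧-+ (4 , 2) (4 , 2))))))
  ; places = λ f → ≡.trans (cong (λ z → f ⟦ (4 , 2) ⟧ + f ⟦ (13 , 6) ⟧ + z) (assemble-places f (map₄ nests) (map₃ singles)))
      (≡.trans (reorder (f ⟦ (4 , 2) ⟧) (f ⟦ (13 , 6) ⟧) (interval f ⟦ (9 , 4) ⟧ ⟦ (4 , 2) ⟧) (interval f ⟦ (14 , 6) ⟧ ⟦ (4 , 2) ⟧)
        (interval f ⟦ (0 , 0) ⟧ ⟦ (2 , 1) ⟧) (interval f ⟦ (6 , 3) ⟧ ⟦ (2 , 1) ⟧)
            (interval f ⟦ (4 , 1) ⟧ ⟦ (0 , 1) ⟧)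
        (interval f ⟦ (6 , 2) ⟧ ⟦ (0 , 1) ⟧) (f ⟦ (2 , 1) ⟧) (f ⟦ (3 , 1) ⟧) (f ⟦ (5 , 2) ⟧) (f ⟦ (8 , 4) ⟧))
        (≡.trans (linearly-tiled 1 f (0 , 0) (18 , 8)
            (piece (2 , 1) (point (point (piece (0 , 1) (point (point (piece (0 , 1) (piece (2 , 1)
            (point (piece (4 , 2) (point (piece (4 , 2) end)))))))))))))
          (cong (λ k → interval f 0 (suc (suc k))) (≡.sym (⟦⟧-+ (8 , 4) (8 , 4))))))
  }
  where
  open Linear u
  nests : List (Form × Form × Form × Form)
  nests = ((9 , 4) , (14 , 6) , (2 , 0) , (4 , 2)) ∷ ((0 , 0) , (6 , 3) , (5 , 2) , (2 , 1)) ∷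
      ((4 , 1) , (6 , 2) , (3 , 0) , (0 , 1)) ∷ []
  singles : List (Form × Form × Form)
  singles = ((1 , 0) , (2 , 1) , (3 , 1)) ∷ ((3 , 2) , (5 , 2) , (8 , 4)) ∷ []
  reorder-keys : ∀ x0 x1 x2 y0 y1 → (x0 + (x1 + (x2 + 0))) + (y0 + (y1 + 0)) ≡
    (y0 + (x2 + (y1 + (x1 + 0)))) + (x0 + 0)
  reorder-keys = solve-∀
  reorder : ∀ x0 x1 x2 x3 x4 x5 x6 x7 x8 x9 x10 x11 →
    x0 + x1 + (((x2 + x3) + ((x4 + x5) + ((x6 + x7) + 0))) + ((x8 + x9) + ((x10 + x11) + 0))) ≡
    (x4 + (x8 + (x9 + (x6 + (x0 + (x10 + (x7 + (x5 + (x11 + (x2 + (x1 + (x3 + 0))))))))))))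
  reorder = solve-∀

familyC : ∀ u → Skolem (5 + 4 * u) hookedPlaces
familyC u = record
  { rest = assemble (map₄ nests) (map₃ singles)
  ; differences = assemble-differences (map₄ nests) (map₃ singles)
      (nests-ok nests (≡.refl ∷ ≡.refl ∷ ≡.refl ∷ [])) (singles-ok singles (≡.refl ∷ ≡.refl ∷ ≡.refl ∷ []))
  ; p = ⟦ (6 , 4) ⟧
  ; q = ⟦ (12 , 8) ⟧
  ; q≡p+c = ≡.sym (⟦⟧-+ (6 , 4) (6 , 4))
  ; keys = λ f → ≡.trans (assemble-keys f (map₄ nests) (map₃ singles)) (≡.trans
      (reorder-keys (progression 2 f ⟦ (2 , 0) ⟧ ⟦ (2 , 2) ⟧) (progression 2 f ⟦ (5 , 2) ⟧ ⟦ (0 , 1) ⟧)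
        (progression 2 f ⟦ (3 , 0) ⟧ ⟦ (0 , 1) ⟧) (f ⟦ (5 , 4) ⟧) (f ⟦ (3 , 2) ⟧) (f ⟦ (1 , 0) ⟧))
      (≡.trans (cong₂ _+_ (linearly-tiled 2 f (1 , 0) (3 , 2) (point (piece (0 , 1) (point (piece (0 , 1) (point end))))))
                         (linearly-tiled 2 f (2 , 0) (2 , 2) (piece (2 , 2) end)))
        (≡.trans (interleave′ f 1 ⟦ (2 , 2) ⟧) (cong (interval f 1) (cong suc (⟦⟧-+ (2 , 2) (2 , 2)))))))
  ; places = λ f → ≡.trans (cong (λ z → f ⟦ (6 , 4) ⟧ + f ⟦ (12 , 8) ⟧ + z) (assemble-places f (map₄ nests) (map₃ singles)))
      (≡.trans (reorder (f ⟦ (6 , 4) ⟧) (f ⟦ (12 , 8) ⟧) (interval f ⟦ (0 , 0) ⟧ ⟦ (2 , 2) ⟧) (interval f ⟦ (3 , 2) ⟧ ⟦ (2 , 2) ⟧)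
        (interval f ⟦ (7 , 4) ⟧ ⟦ (0 , 1) ⟧) (interval f ⟦ (11 , 7) ⟧ ⟦ (0 , 1) ⟧)
        (interval f ⟦ (7 , 5) ⟧ ⟦ (0 , 1) ⟧) (interval f ⟦ (9 , 6) ⟧ ⟦ (0 , 1) ⟧) (f ⟦ (2 , 2) ⟧)
            (f ⟦ (7 , 6) ⟧)
        (f ⟦ (5 , 4) ⟧) (f ⟦ (8 , 6) ⟧) (f ⟦ (9 , 7) ⟧) (f ⟦ (10 , 7) ⟧))
        (≡.trans (cong (λ z → z + f ⟦ (12 , 8) ⟧) (linearly-tiled 1 f (0 , 0) (11 , 8)
            (piece (2 , 2) (point (piece (2 , 2) (point (point (piece (0 , 1) (piece (0 , 1) (point
            (point (piece (0 , 1) (point (point (piece (0 , 1) end)))))))))))))))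
          (cong (λ k → interval f 0 (suc k) + f (suc (suc k))) (≡.sym (⟦⟧-+ (5 , 4) (5 , 4))))))
  }
  where
  open Linear u
  nests : List (Form × Form × Form × Form)
  nests = ((0 , 0) , (3 , 2) , (2 , 0) , (2 , 2)) ∷ ((7 , 4) , (11 , 7) , (5 , 2) , (0 , 1)) ∷
      ((7 , 5) , (9 , 6) , (3 , 0) , (0 , 1)) ∷ []
  singles : List (Form × Form × Form)
  singles = ((5 , 4) , (2 , 2) , (7 , 6)) ∷ ((3 , 2) , (5 , 4) , (8 , 6)) ∷ ((1 , 0) , (9 , 7) , (10 , 7)) ∷ []
  reorder-keys : ∀ x0 x1 x2 y0 y1 y2 → (x0 + (x1 + (x2 + 0))) + (y0 + (y1 + (y2 + 0))) ≡
    (y2 + (x2 + (y1 + (x1 + (y0 + 0))))) + (x0 + 0)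
  reorder-keys = solve-∀
  reorder : ∀ x0 x1 x2 x3 x4 x5 x6 x7 x8 x9 x10 x11 x12 x13 →
    x0 + x1 + (((x2 + x3) + ((x4 + x5) + ((x6 + x7) + 0))) + ((x8 + x9) + ((x10 + x11) + ((x12 + x13) + 0)))) ≡
    (x2 + (x8 + (x3 + (x10 + (x0 + (x4 + (x6 + (x9 + (x11 + (x7 + (x12 + (x13 + (x5 + 0))))))))))))) + x1
  reorder = solve-∀

familyD : ∀ u → Skolem (6 + 4 * u) hookedPlaces
familyD u = record
  { rest = assemble (map₄ nests) (map₃ singles)
  ; differences = assemble-differences (map₄ nests) (map₃ singles)
      (nests-ok nests (≡.refl ∷ ≡.refl ∷ ≡.refl ∷ []))
          (singles-ok singles (≡.refl ∷ ≡.refl ∷ ≡.refl ∷ ≡.refl ∷ []))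
  ; p = ⟦ (7 , 4) ⟧
  ; q = ⟦ (14 , 8) ⟧
  ; q≡p+c = ≡.sym (⟦⟧-+ (7 , 4) (7 , 4))
  ; keys = λ f → ≡.trans (assemble-keys f (map₄ nests) (map₃ singles)) (≡.trans
      (reorder-keys (progression 2 f ⟦ (2 , 0) ⟧ ⟦ (2 , 2) ⟧) (progression 2 f ⟦ (7 , 2) ⟧ ⟦ (0 , 1) ⟧)
        (progression 2 f ⟦ (3 , 0) ⟧ ⟦ (0 , 1) ⟧) (f ⟦ (5 , 2) ⟧) (f ⟦ (1 , 0) ⟧) (f ⟦ (3 , 2) ⟧)
            (f ⟦ (6 , 4) ⟧))
      (≡.trans (cong₂ _+_ (linearly-tiled 2 f (1 , 0) (3 , 2) (point (piece (0 , 1) (point (point (piece (0 , 1) end))))))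
                         (linearly-tiled 2 f (2 , 0) (3 , 2) (piece (2 , 2) (point end))))
        (≡.trans (interleave f 1 ⟦ (3 , 2) ⟧) (cong (interval f 1) (⟦⟧-+ (3 , 2) (3 , 2))))))
  ; places = λ f → ≡.trans (cong (λ z → f ⟦ (7 , 4) ⟧ + f ⟦ (14 , 8) ⟧ + z) (assemble-places f (map₄ nests) (map₃ singles)))
      (≡.trans (reorder (f ⟦ (7 , 4) ⟧) (f ⟦ (14 , 8) ⟧) (interval f ⟦ (8 , 4) ⟧ ⟦ (2 , 2) ⟧) (interval f ⟦ (11 , 6) ⟧ ⟦ (2 , 2) ⟧)
        (interval f ⟦ (0 , 0) ⟧ ⟦ (0 , 1) ⟧) (interval f ⟦ (6 , 3) ⟧ ⟦ (0 , 1) ⟧)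
            (interval f ⟦ (3 , 1) ⟧ ⟦ (0 , 1) ⟧)
        (interval f ⟦ (5 , 2) ⟧ ⟦ (0 , 1) ⟧) (f ⟦ (0 , 1) ⟧) (f ⟦ (5 , 3) ⟧) (f ⟦ (1 , 1) ⟧) (f ⟦ (2 , 1) ⟧)
        (f ⟦ (3 , 2) ⟧) (f ⟦ (6 , 4) ⟧) (f ⟦ (4 , 2) ⟧) (f ⟦ (10 , 6) ⟧))
        (≡.trans (cong (λ z → z + f ⟦ (14 , 8) ⟧) (linearly-tiled 1 f (0 , 0) (13 , 8)
            (piece (0 , 1) (point (point (point (piece (0 , 1) (point (point (piece (0 , 1) (point
            (piece (0 , 1) (point (point (piece (2 , 2) (point (piece (2 , 2) end)))))))))))))))))
          (cong (λ k → interval f 0 (suc k) + f (suc (suc k))) (≡.sym (⟦⟧-+ (6 , 4) (6 , 4))))))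
  }
  where
  open Linear u
  nests : List (Form × Form × Form × Form)
  nests = ((8 , 4) , (11 , 6) , (2 , 0) , (2 , 2)) ∷ ((0 , 0) , (6 , 3) , (7 , 2) , (0 , 1)) ∷
      ((3 , 1) , (5 , 2) , (3 , 0) , (0 , 1)) ∷ []
  singles : List (Form × Form × Form)
  singles = ((5 , 2) , (0 , 1) , (5 , 3)) ∷ ((1 , 0) , (1 , 1) , (2 , 1)) ∷ ((3 , 2) , (3 , 2) , (6 , 4)) ∷
      ((6 , 4) , (4 , 2) , (10 , 6)) ∷ []
  reorder-keys : ∀ x0 x1 x2 y0 y1 y2 y3 → (x0 + (x1 + (x2 + 0))) + (y0 + (y1 + (y2 + (y3 + 0)))) ≡
    (y1 + (x2 + (y2 + (y0 + (x1 + 0))))) + (x0 + (y3 + 0))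
  reorder-keys = solve-∀
  reorder : ∀ x0 x1 x2 x3 x4 x5 x6 x7 x8 x9 x10 x11 x12 x13 x14 x15 →
    x0 + x1 + (((x2 + x3) + ((x4 + x5) + ((x6 + x7) + 0))) + ((x8 + x9) + ((x10 + x11) + ((x12 + x13) + ((x14 + x15) + 0))))) ≡
    (x4 + (x8 + (x10 + (x11 + (x6 + (x12 + (x14 + (x7 + (x9 + (x5 + (x13 + (x0 + (x2 + (x15 + (x3 + 0))))))))))))))) + x1
  reorder = solve-∀

-- The order is b + 1. For even order the five-element blocks are laid out in the same way whether
-- or not the sequence is hooked, while odd orders have to be separated modulo 4; hence the cases.
data SkolemFor (b : ℕ) : Set where
  even-exact  : ∀ h → b ≡ suc (h + h) → Skolem b exactPlaces → SkolemFor b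
  even-hooked : ∀ h → b ≡ suc (h + h) → Skolem b hookedPlaces → SkolemFor b
  one-mod-4   : ∀ h → b ≡ 4 * h → Skolem b exactPlaces → SkolemFor b
  three-mod-4 : ∀ h → b ≡ 2 + 4 * h → Skolem b hookedPlaces → SkolemFor b

skolem : ∀ b → SkolemFor b
skolem 0 = one-mod-4 0 ≡.refl order1
skolem 1 = even-hooked 0 ≡.refl order2
skolem 2 = three-mod-4 0 ≡.refl order3
skolem 3 = even-exact 1 ≡.refl order4
skolem 4 = one-mod-4 1 ≡.refl order5
skolem (suc (suc (suc (suc (suc b))))) =
    subst SkolemFor (cong (λ z → 5 + z) (≡.sym (proj₂ (proj₂ (split b)))))
    (large (proj₁ (split b)) (proj₁ (proj₂ (split b))))
  where
  open import Data.Fin using (Fin; toℕ)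
  open import Data.Fin.Patterns using (0F; 1F; 2F; 3F)
  split : ∀ x → ∃[ r ] ∃[ u ] x ≡ toℕ {4} r + 4 * u
  split 0 = 0F , 0 , ≡.refl
  split 1 = 1F , 0 , ≡.refl
  split 2 = 2F , 0 , ≡.refl
  split 3 = 3F , 0 , ≡.refl
  split (suc (suc (suc (suc x)))) = let r , u , eq = split x in r , suc u , ≡.trans (cong (λ z → 4 + z) eq) (lemma (toℕ r) u)
    where
    lemma : ∀ r u → 4 + (r + 4 * u) ≡ r + 4 * suc u
    lemma = solve-∀
  l₀ : ∀ u → 5 + 4 * u ≡ suc (2 + 2 * u + (2 + 2 * u))
  l₀ = solve-∀
  l₁ : ∀ u → 6 + 4 * u ≡ 2 + 4 * suc u
  l₁ = solve-∀
  l₂ : ∀ u → 7 + 4 * u ≡ suc (3 + 2 * u + (3 + 2 * u))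
  l₂ = solve-∀
  l₃ : ∀ u → 8 + 4 * u ≡ 4 * suc (suc u)
  l₃ = solve-∀
  large : ∀ r u → SkolemFor (5 + (toℕ {4} r + 4 * u))
  large 0F u = even-hooked (2 + 2 * u) (l₀ u) (familyC u)
  large 1F u = three-mod-4 (suc u) (l₁ u) (familyD u)
  large 2F u = even-exact (3 + 2 * u) (l₂ u) (familyA u)
  large 3F u = one-mod-4 (suc (suc u)) (l₃ u) (familyB u)

-- Parts (4) and (5)

places-exact : ∀ f o b → exactPlaces b (λ x → f (suc (o + x))) ≡ interval f (suc o) (suc (suc (b + b)))
places-exact f o b = ≡.trans (progression-shift 1 f (suc o) 0 (suc (suc (b + b))))
  (cong (λ a → interval f (suc a) (suc (suc (b + b)))) (ℕₚ.+-identityʳ o))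

places-hooked : ∀ f o b → hookedPlaces b (λ x → f (suc (o + x))) ≡ interval f (suc o) (suc (b + b)) + f
    (suc (o + suc (suc (b + b))))
places-hooked f o b = cong (λ z → z + f (suc (o + suc (suc (b + b)))))
    (≡.trans (progression-shift 1 f (suc o) 0 (suc (b + b)))
  (cong (λ a → interval f (suc a) (suc (b + b))) (ℕₚ.+-identityʳ o)))

interval-last : ∀ f b → interval f 1 b + f (suc b) ≡ interval f 1 (suc b)
interval-last f b = ≡.trans (cong (λ z → interval f 1 b + z) (≡.sym (ℕₚ.+-identityʳ (f (suc b)))))
  (≡.trans (interval-+ f 1 b 1 ≡.refl) (cong (interval f 1) (ℕₚ.+-comm b 1)))

hooked≡ : ∀ {N M x} f → N ≡ suc M → x ≡ 2 + M → interval f 1 M + f x ≡ hooked N f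
hooked≡ f ≡.refl ≡.refl = ≡.refl

-- The classical passage from a Skolem sequence to a difference triple: j plus its first occurrence
-- minus its second, with the places moved beyond o.
triple : ℕ → ℕ → ℕ → ℕ → Vec ℤ 3
triple o j x y = + j ∷ + suc (o + x) ∷ -[1+ o + y ] ∷ []

triple-zero : ∀ o j x y → y ≡ x + j → blockTotal (triple o j x y) ≡ 0ℤ
triple-zero o j x .(x + j) ≡.refl = lemma (+ o) (+ j) (+ x)
  where
  lemma : ∀ o j x → j ℤ.+ (+ 1 ℤ.+ (o ℤ.+ x) ℤ.+ (- (+ 1 ℤ.+ (o ℤ.+ (x ℤ.+ j))) ℤ.+ 0ℤ)) ≡ 0ℤ
  lemma = ℤRing.solve-∀

triples : ℕ → List (ℕ × ℕ × ℕ) → List (Vec ℤ 3)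
triples o [] = []
triples o ((j , x , y) ∷ L) = triple o j x y ∷ triples o L

triples-zero : ∀ o {L} → All (λ (j , x , y) → y ≡ x + j) L → ZeroBlocks (triples o L)
triples-zero o [] = []
triples-zero o {(j , x , y) ∷ L} (eq ∷ eqs) = triple-zero o j x y eq ∷ triples-zero o eqs

triples-cover : ∀ f o L → sumBlocks f (triples o L) ≡ sumKeys f L + sumPlaces (λ x → f (suc (o + x))) L
triples-cover f o [] = ≡.refl
triples-cover f o ((j , x , y) ∷ L) =
    ≡.trans (cong (λ z → sumBlock f (triple o j x y) + z) (triples-cover f o L))
  (lemma (f j) (f (suc (o + x))) (f (suc (o + y))) (sumKeys f L) (sumPlaces (λ x → f (suc (o + x))) L))
  where
  lemma : ∀ a b c d e → a + (b + (c + 0)) + (d + e) ≡ a + d + (b + c + e)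
  lemma = solve-∀

module _ {b : ℕ} {P : ℕ → (ℕ → ℕ) → ℕ} (S : Skolem b P) where
  open Skolem S

  skolem-3 : ∀ {R} → (∀ f → interval f 1 (suc b) + P b (λ x → f (suc (suc b + x))) ≡ R f) → Signed 3 R
  skolem-3 eq = record
    { blocks = triples (suc b) ((suc b , p , q) ∷ rest)
    ; zero-blocks = triples-zero (suc b) (q≡p+c ∷ differences)
    ; covers = λ f → ≡.trans (triples-cover f (suc b) ((suc b , p , q) ∷ rest))
        (≡.trans (cong₂ _+_ (≡.trans (ℕₚ.+-comm (f (suc b)) _) (≡.trans (cong (λ z → z + f (suc b)) (keys f)) (interval-last f b)))
                            (places (λ x → f (suc (suc b + x)))))
                 (eq f))
    }

  fiveHead : ℕ → ℕ → Vec ℤ 5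
  fiveHead o y = + 1 ∷ -[1+ o + p ] ∷ + suc (o + q) ∷ + y ∷ -[1+ y + suc b ] ∷ []

  five : ℕ → ℕ × ℕ × ℕ → ℕ → Vec ℤ 5
  five o (j , x , y) a = + suc j ∷ + suc (o + x) ∷ -[1+ o + y ] ∷ + a ∷ -[1+ a ] ∷ []

  fives : ℕ → List (ℕ × ℕ × ℕ) → List ℕ → List (Vec ℤ 5)
  fives o = List.zipWith (five o)

  sumPairs : (ℕ → ℕ) → List ℕ → ℕ
  sumPairs f [] = 0
  sumPairs f (a ∷ as) = (f a + f (suc a)) + sumPairs f as

  sumPairs-++ : ∀ f K L → sumPairs f (K ++ L) ≡ sumPairs f K + sumPairs f L
  sumPairs-++ f [] L = ≡.refl
  sumPairs-++ f (a ∷ K) L = ≡.trans (cong (λ z → f a + f (suc a) + z) (sumPairs-++ f K L))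
      (≡.sym (ℕₚ.+-assoc (f a + f (suc a)) _ _))

  near : ℕ → ℕ → List ℕ
  near a zero = []
  near a (suc k) = a ∷ near (2 + a) k

  near-length : ∀ a k → length (near a k) ≡ k
  near-length a zero = ≡.refl
  near-length a (suc k) = cong suc (near-length (2 + a) k)

  near-pairs : ∀ f a k → sumPairs f (near a k) ≡ interval f a (k * 2)
  near-pairs f a zero = ≡.refl
  near-pairs f a (suc k) = ≡.trans (cong (λ z → f a + f (suc a) + z) (near-pairs f (2 + a) k))
      (ℕₚ.+-assoc (f a) (f (suc a)) _)

  fives-zero : ∀ o {L} as → All (λ (j , x , y) → y ≡ x + j) L → ZeroBlocks (fives o L as)
  fives-zero o as [] = []
  fives-zero o [] (_ ∷ _) = []
  fives-zero o {(j , x , .(x + j)) ∷ L} (a ∷ as) (≡.refl ∷ eqs) = lemma (+ o) (+ j) (+ x) (+ a) ∷ fives-zero o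
      as eqs
    where
    lemma : ∀ o j x a → + 1 ℤ.+ j ℤ.+
        (+ 1 ℤ.+ (o ℤ.+ x) ℤ.+ (- (+ 1 ℤ.+ (o ℤ.+ (x ℤ.+ j))) ℤ.+ (a ℤ.+ (- (+ 1 ℤ.+ a) ℤ.+ 0ℤ)))) ≡ 0ℤ
    lemma = ℤRing.solve-∀

  fives-cover : ∀ f o L as → length L ≡ length as →
    sumBlocks f (fives o L as) ≡ sumKeys (f ∘ suc) L + sumPlaces (λ x → f (suc (o + x))) L + sumPairs f as
  fives-cover f o [] [] _ = ≡.refl
  fives-cover f o ((j , x , y) ∷ L) (a ∷ as) eq = ≡.trans
    (cong (λ z → sumBlock f (five o (j , x , y) a) + z) (fives-cover f o L as (ℕₚ.suc-injective eq)))
    (lemma (f (suc j)) (f (suc (o + x))) (f (suc (o + y))) (f a) (f (suc a)) (sumKeys (f ∘ suc) L) (sumPlaces (λ x → f (suc (o + x))) L) (sumPairs f as))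
    where
    lemma : ∀ j x y a b k p q → j + (x + (y + (a + (b + 0)))) + (k + p + q) ≡ j + k + (x + y + p) + (a + b + q)
    lemma = solve-∀

  rest-length : length rest ≡ b
  rest-length = ≡.trans (≡.sym (count rest)) (≡.trans (keys (const 1)) (progression-1 1 1 b))
    where
    count : ∀ L → sumKeys (const 1) L ≡ length L
    count [] = ≡.refl
    count (_ ∷ L) = cong suc (count L)

  -- In all blocks but one, the entry j is replaced by j + 1 and compensated by a
  -- pair of consecutive numbers; the last block gets 1 and a pair at distance b + 2.
  skolem-5 : ∀ {R} o y k a k′ a′ → k + k′ ≡ b →
    (∀ f → f y + f (suc (y + suc b)) + (interval f a (k * 2) + interval f a′ (k′ * 2)) +
           (interval f 1 (suc b) + P b (λ x → f (suc (o + x)))) ≡ R f) → Signed 5 R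
  skolem-5 o y k a k′ a′ k+k′≡b eq = record
    { blocks = fiveHead o y ∷ fives o rest as
    ; zero-blocks = head-zero q≡p+c ∷ fives-zero o as differences
    ; covers = λ f → ≡.trans (cong (λ z → sumBlock f (fiveHead o y) + z) (≡.trans (fives-cover f o rest as lengths)
          (cong₂ (λ u v → u + sumPlaces (λ x → f (suc (o + x))) rest + v)
            (≡.trans (keys (f ∘ suc)) (progression-shift 1 f 1 1 b))
            (≡.trans (sumPairs-++ f (near a k) (near a′ k′)) (cong₂ _+_ (near-pairs f a k) (near-pairs f a′ k′))))))
        (≡.trans (lemma (f 1) (f (suc (o + p))) (f (suc (o + q))) (f y) (f (suc (y + suc b))) (interval f 2 b)
                   (sumPlaces (λ x → f (suc (o + x))) rest) (interval f a (k * 2) + interval f a′ (k′ * 2)))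
          (≡.trans (cong (λ z → f y + f (suc (y + suc b)) + (interval f a (k * 2) + interval f a′ (k′ * 2)) + (interval f 1 (suc b) + z))
                     (places (λ x → f (suc (o + x)))))
            (eq f)))
    }
    where
    as : List ℕ
    as = near a k ++ near a′ k′
    lengths : length rest ≡ length as
    lengths = ≡.trans rest-length (≡.sym (≡.trans (Listₚ.length-++ (near a k))
      (≡.trans (cong₂ _+_ (near-length a k) (near-length a′ k′)) k+k′≡b)))
    head-zero : q ≡ p + suc b → blockTotal (fiveHead o y) ≡ 0ℤ
    head-zero eq = ≡.trans (cong (λ q → blockTotal (+ 1 ∷ -[1+ o + p ] ∷ + suc (o + q) ∷ + y ∷ -[1+ y + suc b ] ∷ [])) eq)
      (lemma₀ (+ o) (+ p) (+ y) (+ suc b))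
      where
      lemma₀ : ∀ o p y c → + 1 ℤ.+ (- (+ 1 ℤ.+ (o ℤ.+ p)) ℤ.+ (+ 1 ℤ.+ (o ℤ.+ (p ℤ.+ c)) ℤ.+ (y ℤ.+ (- (+ 1 ℤ.+ (y ℤ.+ c)) ℤ.+ 0ℤ)))) ≡ 0ℤ
      lemma₀ = ℤRing.solve-∀
    lemma : ∀ a p q y z i s n → a + (p + (q + (y + (z + 0)))) + (i + s + n) ≡ y + z + n + (a + i + (p + q + s))
    lemma = solve-∀

system-3 : ∀ b → System 3 (suc b)
system-3 b = go (skolem b)
  where
  exact-case : Skolem b exactPlaces → System 3 (suc b)
  exact-case S = inj₁ (skolem-3 S λ f → ≡.trans (cong (λ z → interval f 1 (suc b) + z) (places-exact f (suc b) b))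
    (≡.trans (interval-+ f 1 (suc b) (suc (suc (b + b))) ≡.refl) (cong (interval f 1) (lemma b))))
    where
    lemma : ∀ b → suc b + suc (suc (b + b)) ≡ 3 * suc b
    lemma = solve-∀
  hooked-case : Skolem b hookedPlaces → System 3 (suc b)
  hooked-case S = inj₂ (skolem-3 S λ f → ≡.trans (cong (λ z → interval f 1 (suc b) + z) (places-hooked f (suc b) b))
    (≡.trans (≡.sym (ℕₚ.+-assoc (interval f 1 (suc b)) _ _))
      (≡.trans (cong (λ z → z + f (suc (suc b + suc (suc (b + b))))) (interval-+ f 1 (suc b) (suc (b + b)) ≡.refl))
        (hooked≡ {3 * suc b} f (lemma b) (lemma₂ b)))))
    where
    lemma : ∀ b → 3 * suc b ≡ suc (suc b + suc (b + b))
    lemma = solve-∀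
    lemma₂ : ∀ b → suc (suc b + suc (suc (b + b))) ≡ 2 + (suc b + suc (b + b))
    lemma₂ = solve-∀
  go : SkolemFor b → System 3 (suc b)
  go (even-exact _ _ S)  = exact-case S
  go (even-hooked _ _ S) = hooked-case S
  go (one-mod-4 _ _ S)   = exact-case S
  go (three-mod-4 _ _ S) = hooked-case S

-- With c = b + 1, the pair at distance c + 1 encloses c numbers. For even c these split into
-- consecutive pairs, and all pairs fit between the keys 1, ..., c and the places beyond 3c. For odd
-- c a hook repairs the parity: if c is 1 modulo 4, the pair is 4c, 5c + 1 and its far end becomes
-- the hook of the result; if c is 3 modulo 4, the pair starts at 3c, the gap left by the hooked
-- sequence, and encloses that sequence's hook 3c + 1.
system-5 : ∀ b → System 5 (suc b)
system-5 b = go (skolem b)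
  where
  even : ∀ h f rest {e} (z w : ℕ) → z ≡ suc (suc (suc (suc (h + h))) + suc (suc (h + h))) →
      w ≡ suc (3 * suc (suc (h + h))) →
         Tiling 1 f w e rest → Tiling 1 f 1 e (interval f 1 (suc (suc (h + h))) + (f (suc (suc (suc (h + h)))) +
           (interval f (suc (suc (suc (suc (h + h))))) (suc h * 2) + (f z + (interval f (suc z) (h * 2) + rest)))))
  even h f rest z w ≡.refl ≡.refl t = piece (suc (suc (h + h))) (l₁ h)
      (point (l₂ h) (piece (suc h * 2) (l₃ h) (point (l₄ h) (piece (h * 2) (l₅ h) t))))
    where
    l₁ : ∀ h → 1 + suc (suc (h + h)) * 1 ≡ suc (suc (suc (h + h)))
    l₁ = solve-∀
    l₂ : ∀ h → suc (suc (suc (h + h))) + 1 ≡ suc (suc (suc (suc (h + h))))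
    l₂ = solve-∀
    l₃ : ∀ h → suc (suc (suc (suc (h + h)))) + suc h * 2 * 1 ≡ suc (suc (suc (suc (h + h))) + suc (suc (h + h)))
    l₃ = solve-∀
    l₄ : ∀ h → suc (suc (suc (suc (h + h))) + suc (suc (h + h))) + 1 ≡ suc
        (suc (suc (suc (suc (h + h))) + suc (suc (h + h))))
    l₄ = solve-∀
    l₅ : ∀ h → suc (suc (suc (suc (suc (h + h))) + suc (suc (h + h)))) + h * 2 * 1 ≡ suc (3 * suc (suc (h + h)))
    l₅ = solve-∀
  size-even : ∀ h → suc h + h ≡ suc (h + h)
  size-even = solve-∀
  reorder : ∀ y z i j k p → y + z + (i + j) + (k + p) ≡ k + (y + (i + (z + (j + p))))
  reorder = solve-∀
  reorder-hooked : ∀ y z i j k p h → y + z + (i + j) + (k + (p + h)) ≡ k + (y + (i + (z + (j + (p + 0))))) + h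
  reorder-hooked = solve-∀
  c-even : ℕ → ℕ
  c-even h = suc (suc (h + h))
  even-exact-case : ∀ h → Skolem (suc (h + h)) exactPlaces → System 5 (c-even h)
  even-exact-case h S = inj₁ (skolem-5 S (3 * c) y (suc h) (suc y) h (suc z) (size-even h) λ f →
    ≡.trans (cong (λ w → f y + f z + (interval f (suc y) (suc h * 2) + interval f (suc z) (h * 2))
            + (interval f 1 c + w)) (places-exact f (3 * c) (suc (h + h))))
      (≡.trans (reorder (f y) (f z) (interval f (suc y) (suc h * 2)) (interval f (suc z) (h * 2)) (interval f 1 c)
            (interval f (suc (3 * c)) (suc (suc (suc (h + h) + suc (h + h))))))
        (≡.trans (cong (λ w → interval f 1 c + (f y + (interval f (suc y) (suc h * 2) + (f z + (interval f (suc z) (h * 2) + w))))) (≡.sym (ℕₚ.+-identityʳ _)))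
          (tiled {1} {f} {1} (5 * c) (size h)
                     (even h f _ z (suc (3 * c)) ≡.refl ≡.refl (piece (suc (suc (suc (h + h) + suc (h + h)))) ≡.refl end))))))
    where
    c = c-even h
    y = suc c
    z = suc (y + c)
    size : ∀ h → 1 + 5 * suc (suc (h + h)) * 1 ≡ suc (3 * suc (suc (h + h))) + suc
        (suc (suc (h + h) + suc (h + h))) * 1
    size = solve-∀
  even-hooked-case : ∀ h → Skolem (suc (h + h)) hookedPlaces → System 5 (c-even h)
  even-hooked-case h S = inj₂ (skolem-5 S (3 * c) y (suc h) (suc y) h (suc z) (size-even h) λ f →
    ≡.trans (cong (λ w → f y + f z + (interval f (suc y) (suc h * 2) + interval f (suc z) (h * 2))
            + (interval f 1 c + w)) (places-hooked f (3 * c) (suc (h + h))))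
      (≡.trans (reorder-hooked (f y) (f z) (interval f (suc y) (suc h * 2)) (interval f (suc z) (h * 2)) (interval f 1 c)
            (interval f (suc (3 * c)) (suc (suc (h + h) + suc (h + h))))
                (f (suc (3 * c + suc (suc (suc (h + h) + suc (h + h)))))))
        (≡.trans (cong (λ w → w + f (suc (3 * c + suc (suc (suc (h + h) + suc (h + h))))))
                   (tiled {1} {f} {1} (3 * c + suc (suc (h + h) + suc (h + h))) (size h)
                     (even h f _ z (suc (3 * c)) ≡.refl ≡.refl (piece (suc (suc (h + h) + suc (h + h))) ≡.refl end))))
          (hooked≡ {5 * c} f (M≡ h) (end≡ h)))))
    where
    c = c-even h
    y = suc c
    z = suc (y + c)
    size : ∀ h → 1 + (3 * suc (suc (h + h)) + suc (suc (h + h) + suc (h + h))) * 1 ≡ suc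
        (3 * suc (suc (h + h))) + suc (suc (h + h) + suc (h + h)) * 1
    size = solve-∀
    M≡ : ∀ h → 5 * suc (suc (h + h)) ≡ suc (3 * suc (suc (h + h)) + suc (suc (h + h) + suc (h + h)))
    M≡ = solve-∀
    end≡ : ∀ h → suc (3 * suc (suc (h + h)) + suc (suc (suc (h + h) + suc (h + h)))) ≡ 2 +
        (3 * suc (suc (h + h)) + suc (suc (h + h) + suc (h + h)))
    end≡ = solve-∀
  one-case : ∀ h → Skolem (4 * h) exactPlaces → System 5 (suc (4 * h))
  one-case h S = inj₂ (skolem-5 S (suc (4 * h)) y (2 * h) (4 + 12 * h) (2 * h) (suc y) (l₀ h) λ f →
    ≡.trans (cong (λ w → f y + f (suc (y + suc (4 * h))) + (interval f (4 + 12 * h) (2 * h * 2) + interval f (suc y) (2 * h * 2))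
            + (interval f 1 (suc (4 * h)) + w)) (places-exact f (suc (4 * h)) (4 * h)))
      (≡.trans (shuffle (f y) (f (suc (y + suc (4 * h)))) (interval f (4 + 12 * h) (2 * h * 2)) (interval f (suc y) (2 * h * 2))
          (interval f 1 (suc (4 * h))) (interval f (suc (suc (4 * h))) (suc (suc (4 * h + 4 * h)))))
        (≡.trans (cong (λ w → w + f (suc (y + suc (4 * h)))) (tiled {1} {f} {1} (4 + 20 * h) (size h)
            (piece (suc (4 * h)) (l₁ h) (piece (suc (suc (4 * h + 4 * h))) (l₂ h) (piece (2 * h * 2) (l₃ h) (point (l₄ h) (piece (2 * h * 2) (l₅ h) end)))))))
          (hooked≡ {5 * suc (4 * h)} f (M≡ h) (end≡ h)))))
    where
    y = 4 + 16 * h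
    l₀ : ∀ h → 2 * h + 2 * h ≡ 4 * h
    l₀ = solve-∀
    shuffle : ∀ y z i j k p → y + z + (i + j) + (k + p) ≡ k + (p + (i + (y + (j + 0)))) + z
    shuffle = solve-∀
    l₁ : ∀ h → 1 + suc (4 * h) * 1 ≡ suc (suc (4 * h))
    l₁ = solve-∀
    l₂ : ∀ h → suc (suc (4 * h)) + suc (suc (4 * h + 4 * h)) * 1 ≡ 4 + 12 * h
    l₂ = solve-∀
    l₃ : ∀ h → 4 + 12 * h + 2 * h * 2 * 1 ≡ 4 + 16 * h
    l₃ = solve-∀
    l₄ : ∀ h → 4 + 16 * h + 1 ≡ suc (4 + 16 * h)
    l₄ = solve-∀
    l₅ : ∀ h → suc (4 + 16 * h) + 2 * h * 2 * 1 ≡ 5 + 20 * h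
    l₅ = solve-∀
    size : ∀ h → 1 + (4 + 20 * h) * 1 ≡ 5 + 20 * h
    size = solve-∀
    M≡ : ∀ h → 5 * suc (4 * h) ≡ suc (4 + 20 * h)
    M≡ = solve-∀
    end≡ : ∀ h → suc (4 + 16 * h + suc (4 * h)) ≡ 2 + (4 + 20 * h)
    end≡ = solve-∀
  three-case : ∀ h → Skolem (2 + 4 * h) hookedPlaces → System 5 (3 + 4 * h)
  three-case h S = inj₁ (skolem-5 S (3 + 4 * h) y (1 + 2 * h) (11 + 12 * h) (1 + 2 * h) (14 + 16 * h) (l₀ h) λ f →
    ≡.trans (cong₂ (λ z w → f y + f z + (interval f (11 + 12 * h) ((1 + 2 * h) * 2) + interval f (14 + 16 * h) ((1 + 2 * h) * 2)) + (interval f 1 (3 + 4 * h) + w))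
              (z≡ h) (≡.trans (places-hooked f (3 + 4 * h) (2 + 4 * h))
                (cong (λ x → interval f (suc (3 + 4 * h)) (suc (2 + 4 * h + (2 + 4 * h))) + f x) (hook≡ h))))
      (≡.trans (shuffle (f y) (f (13 + 16 * h)) (interval f (11 + 12 * h) ((1 + 2 * h) * 2)) (interval f (14 + 16 * h) ((1 + 2 * h) * 2))
          (interval f 1 (3 + 4 * h)) (interval f (suc (3 + 4 * h)) (suc (2 + 4 * h + (2 + 4 * h))))
              (f (10 + 12 * h)))
        (tiled {1} {f} {1} (5 * (3 + 4 * h)) (size h)
          (piece (3 + 4 * h) (l₁ h) (piece (suc (2 + 4 * h + (2 + 4 * h))) (l₂ h) (point (l₃ h) (point (l₄ h)
            (piece ((1 + 2 * h) * 2) (l₅ h) (point (l₆ h) (piece ((1 + 2 * h) * 2) (l₇ h) end))))))))))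
    where
    y = 9 + 12 * h
    l₀ : ∀ h → 1 + 2 * h + (1 + 2 * h) ≡ 2 + 4 * h
    l₀ = solve-∀
    z≡ : ∀ h → suc (9 + 12 * h + suc (2 + 4 * h)) ≡ 13 + 16 * h
    z≡ = solve-∀
    hook≡ : ∀ h → suc (3 + 4 * h + suc (suc (2 + 4 * h + (2 + 4 * h)))) ≡ 10 + 12 * h
    hook≡ = solve-∀
    shuffle : ∀ y z i j k p w → y + z + (i + j) + (k + (p + w)) ≡ k + (p + (y + (w + (i + (z + (j + 0))))))
    shuffle = solve-∀
    l₁ : ∀ h → 1 + (3 + 4 * h) * 1 ≡ suc (3 + 4 * h)
    l₁ = solve-∀
    l₂ : ∀ h → suc (3 + 4 * h) + suc (2 + 4 * h + (2 + 4 * h)) * 1 ≡ 9 + 12 * h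
    l₂ = solve-∀
    l₃ : ∀ h → 9 + 12 * h + 1 ≡ 10 + 12 * h
    l₃ = solve-∀
    l₄ : ∀ h → 10 + 12 * h + 1 ≡ 11 + 12 * h
    l₄ = solve-∀
    l₅ : ∀ h → 11 + 12 * h + (1 + 2 * h) * 2 * 1 ≡ 13 + 16 * h
    l₅ = solve-∀
    l₆ : ∀ h → 13 + 16 * h + 1 ≡ 14 + 16 * h
    l₆ = solve-∀
    l₇ : ∀ h → 14 + 16 * h + (1 + 2 * h) * 2 * 1 ≡ 16 + 20 * h
    l₇ = solve-∀
    size : ∀ h → 1 + 5 * (3 + 4 * h) * 1 ≡ 16 + 20 * h
    size = solve-∀
  go : SkolemFor b → System 5 (suc b)
  go (even-exact h ≡.refl S)  = even-exact-case h S
  go (even-hooked h ≡.refl S) = even-hooked-case h S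
  go (one-mod-4 h ≡.refl S)   = one-case h S
  go (three-mod-4 h ≡.refl S) = three-case h S

pairUp : ∀ {n} → List (Vec ℤ n) → List (Vec ℤ (n + n))
pairUp (A ∷ B ∷ L) = (A Vec.++ B) ∷ pairUp L
pairUp _ = []

pairUp-zero : ∀ {n} {L : List (Vec ℤ n)} → ZeroBlocks L → ZeroBlocks (pairUp L)
pairUp-zero [] = []
pairUp-zero (_ ∷ []) = []
pairUp-zero {L = A ∷ B ∷ _} (a ∷ b ∷ zs) = ≡.trans (blockTotal-++ A B) (cong₂ ℤ._+_ a b) ∷ pairUp-zero zs

pairUp-cover : ∀ {n} f c (L : List (Vec ℤ n)) → length L ≡ c + c → sumBlocks f (pairUp L) ≡ sumBlocks f L
pairUp-cover f zero [] _ = ≡.refl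
pairUp-cover f (suc c) (A ∷ []) eq with () ← ≡.trans (ℕₚ.suc-injective eq) (ℕₚ.+-suc c c)
pairUp-cover f (suc c) (A ∷ B ∷ L) eq = ≡.trans (cong₂ _+_ (sumBlock-++ f A B)
    (pairUp-cover f c L (ℕₚ.suc-injective (≡.trans (ℕₚ.suc-injective eq) (ℕₚ.+-suc c c)))))
  (ℕₚ.+-assoc (sumBlock f A) _ _)

system-6 : ∀ b → System 6 (suc b)
system-6 b = go (system-3 (b + suc b))
  where
  c = suc b
  paired : ∀ {R R′} (X : Signed 3 R) → length (Signed.blocks X) ≡ c + c → (∀ f → R f ≡ R′ f) → Signed 6 R′
  paired X len eq = record
    { blocks = pairUp (Signed.blocks X)
    ; zero-blocks = pairUp-zero (Signed.zero-blocks X)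
    ; covers = λ f → ≡.trans (pairUp-cover f c (Signed.blocks X) len) (≡.trans (Signed.covers X f) (eq f))
    }
  size : ∀ c → 3 * (c + c) ≡ 6 * c
  size = solve-∀
  go : System 3 (c + c) → System 6 c
  go (inj₁ X) = inj₁ (paired X (blocks-length {c = c + c} X (exact-1 (3 * (c + c)))) (λ f → cong (λ N → exact N f) (size c)))
  go (inj₂ X) = inj₂ (paired X (blocks-length {c = c + c} X (hooked-1 (3 * (c + c)))) (λ f → cong (λ N → hooked N f) (size c)))

system : ∀ n b → System (3 + n) (suc b)
system 0 b = system-3 b
system 1 b = system-4 (suc b)
system 2 b = system-5 b
system 3 b = system-6 b
system (suc (suc (suc (suc n)))) b = extend (system n b)

two-rows-sets-exist : ∀ n c → 3 ≤ n → 1 ≤ c → M⁰S (ℤ/ (2 * n * c + 1)) (Nonzero (ℤ/ (2 * n * c + 1))) 2 n n 2 c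
two-rows-sets-exist (suc (suc (suc n))) (suc b) _ _ = system⇒arrays (system n b)
two-rows-sets-exist (suc (suc zero)) _ (s≤s (s≤s ())) _
two-rows-sets-exist (suc zero) _ (s≤s ()) _

two-rows-sets : ∀ n c → 1 ≤ c → 2 ≤ n → M⁰S (ℤ/ (2 * n * c + 1)) (Nonzero (ℤ/ (2 * n * c + 1))) 2 n n 2 c ⇔
    (3 ≤ n)
two-rows-sets n c 1≤c 2≤n = mk⇔ (necessary n c 1≤c 2≤n) (λ 3≤n → two-rows-sets-exist n c 3≤n 1≤c)
  where
  necessary : ∀ n c → 1 ≤ c → 2 ≤ n → M⁰S (ℤ/ (2 * n * c + 1)) (Nonzero (ℤ/ (2 * n * c + 1))) 2 n n 2 c → 3 ≤ n
  necessary 2 (suc c) _ _ A = ⊥-elim (FullArrays.no-2×2 (ℤ/ (2 * 2 * suc c + 1)) 0F A)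
  necessary (suc (suc (suc n))) c _ _ A = s≤s (s≤s (s≤s z≤n))
  necessary 1 _ _ (s≤s ()) _

-- Transposing and stacking arrays without empty cells

module _ {g ℓ p} (G : AbelianGroup g ℓ) {Ω : AbelianGroup.Carrier G → Set p} where
  open AbelianGroup G

  transpose : ∀ {m n s k c} → M⁰S G Ω m n s k c → M⁰S G Ω n m k s c
  transpose A = record
    { arrays = λ t j i → arrays t i j
    ; entries∈Ω = λ t j i → entries∈Ω t i j
    ; appears = λ x x∈Ω → let (t , i , j) , found = appears x x∈Ω in (t , j , i) , found
    ; once = λ { x (t , j , i) (t′ , j′ , i′) p p′ → cong (λ (t , i , j) → t , j , i) (once x (t , i , j) (t′ , i′ , j′) p p′) }
    ; rowFilled = colFilled
    ; colFilled = rowFilled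
    ; rowSum = colSum
    ; colSum = rowSum
    }
    where open M⁰S A

  stack : ∀ {n c} → M⁰S G Ω 2 n n 2 c → M⁰S G Ω (c * 2) n n (c * 2) 1
  stack {n} {c} A = record
    { arrays = λ _ ρ → at (remQuot {c} 2 ρ)
    ; entries∈Ω = λ _ ρ q → entries∈Ω _ _ q
    ; appears = λ x x∈Ω → let (t , r , q) , y , eq , y≈x = appears x x∈Ω in
        (0F , combine t r , q) , y , ≡.trans (cong (λ tr → at tr q) (Finₚ.remQuot-combine t r)) eq , y≈x
    ; once = λ { x (0F , ρ , q) (0F , ρ′ , q′) found found′ →
        cong₂ (λ ρ q → 0F , ρ , q) (same-row ρ ρ′ (once x _ _ found found′))
            (cong (proj₂ ∘ proj₂) (once x _ _ found found′)) }
    ; rowFilled = λ _ ρ → rowFilled _ _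
    ; colFilled = λ _ q → F.full-count _ (λ ρ → entry ρ q) (λ ρ → full ρ q)
    ; rowSum = λ _ ρ → rowSum _ _
    ; colSum = λ _ q → trans (F.full-sum _ (λ ρ → entry ρ q) (λ ρ → full ρ q))
        (trans (sum-combine c (λ ρ → entry ρ q)) (sum-ε λ t →
          trans (sum-cong (λ r → reflexive (cong (λ (t , r) → A.at t r q) (Finₚ.remQuot-combine t r))))
              (A.at-col t q)))
    }
    where
    open M⁰S A
    open Lines G
    module F = FullArrays G
    module A = F.FullArray A
    at : Fin c × Fin 2 → Fin n → Maybe Carrier
    at (t , r) = arrays t r
    entry : Fin (c * 2) → Fin n → Carrier
    entry ρ q = A.at (proj₁ (remQuot {c} 2 ρ)) (proj₂ (remQuot {c} 2 ρ)) q
    full : ∀ ρ q → at (remQuot {c} 2 ρ) q ≡ just (entry ρ q)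
    full ρ q = proj₂ (A.filledAt _ _ q)
    same-row : ∀ ρ ρ′ {q q′} → (proj₁ (remQuot {c} 2 ρ) , proj₂ (remQuot {c} 2 ρ) , q) ≡
        (proj₁ (remQuot {c} 2 ρ′) , proj₂ (remQuot {c} 2 ρ′) , q′) → ρ ≡ ρ′
    same-row ρ ρ′ eq = combine-injective′ {c} (cong₂ _,_ (cong proj₁ eq) (cong (proj₁ ∘ proj₂) eq))

-- For odd K the group has even order, and the sum of all its residues, to which 0 contributes
-- nothing, is not zero.
nonzero-total : ∀ {m n s k} K → M⁰ (ℤ/ (suc K)) (Nonzero (ℤ/ (suc K))) m n s k → 2 ℕ∣.∣ K
nonzero-total K A = decidable-stable (2 ℕ∣.∣? K) λ odd → sum-residues≉0 K (even-suc odd) (ℤ/.trans (suc K)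
    {ℤΣ.sum {suc K} (λ i → + toℕ i)} {ℤΣ.sum {K} e} {0ℤ}
    (≡⇒mod (suc K) (ℤₚ.+-identityˡ (ℤΣ.sum {K} e)))
    (total-zero (ℤ/ (suc K)) A e e-injective e≉0 e-exhaustive))
  where
  e : Fin K → ℤ
  e i = + suc (toℕ i)
  e-injective : ∀ i j → e i ≡[mod suc K ] e j → i ≡ j
  e-injective i j eq = Finₚ.suc-injective (Fin-residue-injective (Fin.suc i) (Fin.suc j) eq)
  e≉0 : ∀ i → ¬ (e i ≡[mod suc K ] 0ℤ)
  e≉0 i eq with () ← Fin-residue-injective (Fin.suc i) Fin.zero eq
  e-exhaustive : ∀ x → ¬ (x ≡[mod suc K ] 0ℤ) → ∃[ i ] e i ≡[mod suc K ] x
  e-exhaustive x x≉0 = positive (residue x (suc K))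
    where
    positive : (∃[ i ] (+ toℕ {suc K} i) ≡[mod suc K ] x) → ∃[ i ] e i ≡[mod suc K ] x
    positive (Fin.zero , eq) = ⊥-elim (x≉0 (ℤ/.sym (suc K) {0ℤ} {x} eq))
    positive (Fin.suc i , eq) = i , eq
  even-suc : Odd K → 2 ℕ∣.∣ suc K
  even-suc odd = let h , eq = odd⇒1+2* odd in ℕ∣.divides (suc h) (≡.trans (cong suc eq) (lemma h))
    where
    lemma : ∀ h → suc (suc (h + h)) ≡ suc h * 2
    lemma = solve-∀

full-nonzero : ∀ m n → 2 ≤ m → 2 ≤ n →
  M⁰ (ℤ/ (m * n + 1)) (Nonzero (ℤ/ (m * n + 1))) m n n m ⇔ ((2 ℕ∣.∣ m * n) × (5 < m * n))
full-nonzero m n 2≤m 2≤n = mk⇔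
  (λ A → nonzero-total (m * n) (subst (λ N → M⁰ (ℤ/ N) (Nonzero (ℤ/ N)) m n n m) (ℕₚ.+-comm (m * n) 1) A) , large m n 2≤m 2≤n A)
  (λ (2∣mn , 5<mn) → [ (λ 2∣m → by-rows m n 2∣m 2≤n 5<mn) , (λ 2∣n → by-columns m n 2∣n 2≤m 5<mn) ]′ (euclidsLemma m n prime[2] 2∣mn))
  where
  Full : ℕ → ℕ → Set
  Full m n = M⁰ (ℤ/ (m * n + 1)) (Nonzero (ℤ/ (m * n + 1))) m n n m
  large : ∀ m n → 2 ≤ m → 2 ≤ n → Full m n → 5 < m * n
  large 2 2 _ _ A = ⊥-elim (FullArrays.no-2×2 (ℤ/ 5) 0F A)
  large 2 (suc (suc (suc n))) _ _ A = ℕₚ.*-monoʳ-≤ 2 {3} {3 + n} (s≤s (s≤s (s≤s z≤n)))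
  large (suc (suc (suc m))) n _ 2≤n A = ℕₚ.≤-trans (ℕₚ.*-monoʳ-≤ 3 2≤n)
      (ℕₚ.*-monoˡ-≤ n {3} {3 + m} (s≤s (s≤s (s≤s z≤n))))
  large 1 _ (s≤s ()) _ _
  large 2 1 _ (s≤s ()) _
  stacked : ∀ c n → 1 ≤ c → 3 ≤ n → Full (c * 2) n
  stacked c n 1≤c 3≤n = subst (λ N → M⁰ (ℤ/ N) (Nonzero (ℤ/ N)) (c * 2) n n (c * 2)) (lemma c n)
    (stack (ℤ/ (2 * n * c + 1)) (two-rows-sets-exist n c 3≤n 1≤c))
    where
    lemma : ∀ c n → 2 * n * c + 1 ≡ c * 2 * n + 1
    lemma = solve-∀
  flip : ∀ m n → Full m n → Full n m
  flip m n A = subst (λ N → M⁰ (ℤ/ N) (Nonzero (ℤ/ N)) n m m n) (cong (λ N → N + 1) (ℕₚ.*-comm m n))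
      (transpose (ℤ/ (m * n + 1)) A)
  by-rows : ∀ m n → 2 ℕ∣.∣ m → 2 ≤ n → 5 < m * n → Full m n
  by-rows _ (suc (suc (suc n))) (ℕ∣.divides (suc c) ≡.refl) _ _ = stacked (suc c) (3 + n) (s≤s z≤n)
      (s≤s (s≤s (s≤s z≤n)))
  -- With only two columns there are at least four rows, so a single array with two rows and that
  -- many columns is transposed.
  by-rows _ 2 (ℕ∣.divides (suc (suc c)) ≡.refl) _ _ = flip 2 (suc (suc c) * 2)
      (stacked 1 (suc (suc c) * 2) (s≤s z≤n) (s≤s (s≤s (s≤s z≤n))))
  by-rows _ 2 (ℕ∣.divides 1 ≡.refl) _ (s≤s (s≤s (s≤s (s≤s ()))))
  by-rows _ 1 _ (s≤s ()) _
  by-columns : ∀ m n → 2 ℕ∣.∣ n → 2 ≤ m → 5 < m * n → Full m n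
  by-columns m n 2∣n 2≤m 5<mn = flip n m (by-rows n m 2∣n 2≤m (subst (5 <_) (ℕₚ.*-comm m n) 5<mn))

theorem1p9 : ∀ {a ℓ : Level} →
  -- parts (1)-(3), under the standing hypotheses on m, n, s, k, c
  ((m n s k c : ℕ) → 1 ≤ c → 2 ≤ s → s ≤ n → 2 ≤ k → k ≤ m → m * s ≡ n * k →
    -- (1)
    (M⁰S (ℤ/ (n * k * c)) (Whole (ℤ/ (n * k * c))) m n s k c ⇔ (¬ (2 ∣ n * k * c)))
    -- (2)
    × (4 ∣ gcd s k → (G : AbelianGroup a ℓ) → HasOrder G (n * k * c) → In𝒢 G (n * k * c) →
        M⁰S G (Whole G) m n s k c)
    -- (3)  (q = nk/d)
    × (¬ (2 ∣ n * k) → gcd n (gcd s k ∸ 1) ≡ 1 → (q : ℕ) → gcd s k * q ≡ n * k →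
        M⁰ (ℤ/ (gcd s k) ⊕ ℤ/ q) (Whole (ℤ/ (gcd s k) ⊕ ℤ/ q)) m n s k))
  -- (4)  (m = 2, s = n, k = 2)
  × ((n c : ℕ) → 1 ≤ c → 2 ≤ n →
      (M⁰S (ℤ/ (2 * n * c + 1)) (Nonzero (ℤ/ (2 * n * c + 1))) 2 n n 2 c ⇔ (3 ≤ n)))
  -- (5)  (s = n, k = m)
  × ((m n : ℕ) → 2 ≤ m → 2 ≤ n →
      (M⁰ (ℤ/ (m * n + 1)) (Nonzero (ℤ/ (m * n + 1))) m n n m ⇔ ((2 ∣ m * n) × (5 < m * n))))
  -- (6)  (m = 2, s = n, k = 2)
  × ((n : ℕ) → 2 ≤ n → (G : AbelianGroup a ℓ) → HasOrder G (2 * n + 1) →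
      (M⁰ G (Nonzero G) 2 n n 2 ⇔ ((¬ (G ≅ ℤ/ 5)) × (¬ (G ≅ (ℤ/ 3 ⊕ ℤ/ 3))))))
theorem1p9 {a} {ℓ} = partial , two-rows-sets , full-nonzero , λ n 2≤n G order → two-rows-nonzero G 2≤n order
  where
  partial : (m n s k c : ℕ) → 1 ≤ c → 2 ≤ s → s ≤ n → 2 ≤ k → k ≤ m → m * s ≡ n * k → _
  partial m n s k c 1≤c 2≤s s≤n 2≤k k≤m ms≡nk =
    mk⇔ (cyclic⇒odd (n * k * c) {{nkc≢0}}) (cyclic-exists S 2≤s 2≤k) ,
    -- As 4 divides d, the order is even, so membership in 𝒢 must come from two involutions.
    (λ 4∣d G order → [ (λ odd → ⊥-elim (odd (2∣nkc 4∣d))) ,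
                       (λ (x , y , x² , y² , x≉y) → four-diagonals-exist G S 4∣d order x y x² y² x≉y) ]′) ,
    (λ odd coprime → direct-sum-exists S odd (d≢1 coprime))
    where
    S : Shape m n s k (gcd s k)
    S = shape {m} {n} {s} {k} 2≤s s≤n ms≡nk
    2≤n : 2 ≤ n
    2≤n = ℕₚ.≤-trans 2≤s s≤n
    positive : ∀ {x} → 2 ≤ x → NonZero x
    positive 2≤x = ℕ.>-nonZero (ℕₚ.≤-trans (s≤s z≤n) 2≤x)
    nkc≢0 : NonZero (n * k * c)
    nkc≢0 = ℕₚ.m*n≢0 (n * k) c {{ℕₚ.m*n≢0 n k {{positive 2≤n}} {{positive 2≤k}}}} {{ℕ.>-nonZero 1≤c}}
    2∣nkc : 4 ∣ gcd s k → 2 ∣ n * k * c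
    2∣nkc 4∣d = ℕ∣.∣-trans (ℕ∣.divides 2 ≡.refl) (ℕ∣.∣-trans 4∣d (ℕ∣.∣-trans (GCD.gcd[m,n]∣n s k)
      (ℕ∣.∣-trans (ℕ∣.n∣m*n n) (ℕ∣.m∣m*n c))))
    -- For d = 1 the hypothesis would read gcd (n, 0) = 1, that is n = 1.
    d≢1 : gcd n (gcd s k ∸ 1) ≡ 1 → gcd s k ≢ 1
    d≢1 coprime d≡1 = ℕₚ.<⇒≢ 2≤n (≡.sym (≡.trans (≡.sym (GCD.gcd-identityʳ n))
      (≡.trans (cong (λ d → gcd n (d ∸ 1)) (≡.sym d≡1)) coprime)))
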